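{- The problem $\mathrm{LCR}$ can be solved in time $$\mathcal{O}\bigl(\mathrm{Wit}(\mathtt{L},\mathtt{D})\cdot \mathrm{Valid}(\mathtt{L},\mathtt{D},\mathtt{C})\bigr),$$ where $\mathrm{Wit}(\mathtt{L},\mathtt{D}) = (\mathtt{L}\cdot(\mathtt{D}+1))^{\mathtt{L}\cdot\mathtt{D}}\cdot \mathtt{D}^{\mathtt{D}}\cdot \mathtt{L}$ and $\mathrm{Valid}(\mathtt{L},\mathtt{D},\mathtt{C}) = \mathtt{L}^3\cdot \mathtt{D}^2\cdot \mathtt{C}^2$.
   Context: Programs. A (shared memory) program is a tuple $\mathcal{A}=(D,a^0,(P_i)_{i\in[1..t]})$ with a finite data domain $D$, an initial memory value $a^0\in D$, and threads $P_i$. Let $\mathrm{Op}(D)=\{!a,?a \mid a\in D\}$ ($!a$ writes $a$ to the memory, $?a$ reads $a$ from it). Each thread is a nondeterministic finite automaton $P_i=(\mathrm{Op}(D),Q_i,q_i^0,\delta_i)$ with finite state set $Q_i$, initial state $q_i^0$ and transition relation $\delta_i\subseteq Q_i\times(\mathrm{Op}(D)\cup\{\varepsilon\})\times Q_i$. A configuration is a pair $(\mathit{pc},a)$ with $\mathit{pc}\in Q_1\times\dots\times Q_t$ and $a\in D$; the initial configuration is $c^0=((q_1^0,\dots,q_t^0),a^0)$. A step lets one thread $P_i$ take a transition from its current state $q$ to $q'$ (the other threads keep their states): a transition $(q,?a,q')$ is possible only if the memory holds $a$, and leaves the memory unchanged; a transition $(q,!b,q')$ is possible for any memory value and sets the memory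 to $b$; a transition $(q,\varepsilon,q')$ leaves the memory unchanged. Write $c\rightarrow^*_{\mathcal{A}}c'$ if $c'$ is reachable from $c$ by a finite sequence of steps. Leader Contributor Reachability ($\mathrm{LCR}$). Input: a program $\mathcal{A}=(D,a^0,(P_L,P_C))$ with two threads, the leader $P_L$ (state set $Q_L$) and the contributor $P_C$ (state set $Q_C$), and a set $F_L\subseteq Q_L$ of unsafe states. For $t\in\mathbb{N}$, let $\mathcal{A}^t=(D,a^0,(P_L,(P_C)_{i\in[1..t]}))$ be the program with one leader and exactly $t$ copies of $P_C$, and let $C^f$ be the set of configurations in which the leader is in a state of $F_L$. Question: is there a $t\in\mathbb{N}$ such that $c^0\rightarrow^*_{\mathcal{A}^t}c$ for some $c\in C^f$? Parameters: $\mathtt{D}=|D|$, $\mathtt{L}=|Q_L|$, $\mathtt{C}=|Q_C|$. -}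

module Defs where

open import Data.Bool using (Bool; true; false; if_then_else_)
open import Data.Fin using (Fin; zero; suc; toℕ)
open import Data.Fin.Subset using (Subset; _∈_)
open import Data.List using (List; []; _∷_; _++_; map; concatMap; allFin)
open import Data.Maybe using (Maybe; just; nothing)
open import Data.Nat using (ℕ; zero; suc; _+_; _*_; _∸_; _^_; _≤_; _≡ᵇ_)
open import Data.Product using (∃-syntax; _×_)
import Data.Vec as Vec
import Data.Vec.Functional as Vector
open import Data.Vec.Functional using (Vector)
open import Function.Bundles using (_⇔_)
open import Relation.Binary.Construct.Closure.ReflexiveTransitive using (Star)
open import Relation.Binary.PropositionalEquality using (_≡_; _≢_)

-- Data domains and state sets are finite, hence taken to be of the form
-- Fin n.

data Op (D : ℕ) : Set where
  wr : Fin D → Op D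
  rd : Fin D → Op D

-- nothing is the label ε.
Label : ℕ → Set
Label D = Maybe (Op D)

record Thread (D : ℕ) : Set where
  field
    states : ℕ
    q⁰     : Fin states
    δ      : Fin states → Label D → Fin states → Bool

open Thread public

record Program : Set where
  field
    D       : ℕ
    a⁰      : Fin D
    t       : ℕ
    threads : Vector (Thread D) t

module Semantics (𝒜 : Program) where
  open Program 𝒜

  record Config : Set where
    constructor ⟨_,_⟩
    field
      pc  : (i : Fin t) → Fin (states (threads i))
      mem : Fin D

  open Config public

  c⁰ : Config
  c⁰ = ⟨ (λ i → q⁰ (threads i)) , a⁰ ⟩

  -- Effect l a b: an l-labelled transition can be taken when the memory
  -- holds a, and then leaves b in it.
  data Effect : Label D → Fin D → Fin D → Set where
    read  : ∀ {a}   → Effect (just (rd a)) a a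
    write : ∀ {a b} → Effect (just (wr b)) a b
    ε     : ∀ {a}   → Effect nothing a a

  record _⟶_ (c c′ : Config) : Set where
    field
      thread     : Fin t
      label      : Label D
      transition : δ (threads thread) (pc c thread) label (pc c′ thread) ≡ true
      effect     : Effect label (mem c) (mem c′)
      others     : ∀ j → j ≢ thread → pc c′ j ≡ pc c j

  _⟶*_ : Config → Config → Set
  _⟶*_ = Star _⟶_

record Instance : Set where
  field
    D           : ℕ
    a⁰          : Fin D
    leader      : Thread D
    contributor : Thread D
    unsafe      : Subset (states leader)

  |Q_L| : ℕ
  |Q_L| = states leader

  |Q_C| : ℕ
  |Q_C| = states contributor

_^^_ : Instance → ℕ → Program
I ^^ t = record
  { D       = D
  ; a⁰      = a⁰
  ; t       = suc t
  ; threads = leader Vector.∷ Vector.replicate t contributor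
  }
  where open Instance I

LCR : Instance → Set
LCR I = ∃[ t ] let open Semantics (I ^^ t) in
  ∃[ c ] (c⁰ ⟶* c) × (pc c zero ∈ Instance.unsafe I)

-- A random access machine: registers and an indirectly addressed memory, both
-- holding natural numbers. Costs are uniform: every instruction and every
-- node of an expression costs one unit. Addition and truncated subtraction
-- are the only arithmetic (with multiplication at unit cost the model
-- would no longer be polynomially related to Turing machines). Control
-- flow is structured instead of by jumps, which changes running times by
-- at most a constant factor.

data Expr : Set where
  con  : ℕ → Expr
  reg  : ℕ → Expr
  load : Expr → Expr
  _⊕_  : Expr → Expr → Expr
  _⊖_  : Expr → Expr → Expr

infixl 6 _⊕_ _⊖_

data Cmd : Set where
  skip  : Cmd
  _≔_   : ℕ → Expr → Cmd
  store : (address value : Expr) → Cmd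
  _⨾_   : Cmd → Cmd → Cmd
  ifnz  : Expr → Cmd → Cmd → Cmd
  while : Expr → Cmd → Cmd

infix  5 _≔_
infixr 4 _⨾_

record Store : Set where
  constructor ⟪_,_⟫
  field
    registers : ℕ → ℕ
    memory    : ℕ → ℕ

open Store public

_[_↦_] : (ℕ → ℕ) → ℕ → ℕ → (ℕ → ℕ)
(f [ x ↦ v ]) y = if x ≡ᵇ y then v else f y

eval : Expr → Store → ℕ
eval (con n)   s = n
eval (reg x)   s = registers s x
eval (load e)  s = memory s (eval e s)
eval (e ⊕ e′)  s = eval e s + eval e′ s
eval (e ⊖ e′)  s = eval e s ∸ eval e′ s

size : Expr → ℕ
size (con n)   = 1
size (reg x)   = 1
size (load e)  = 1 + size e
size (e ⊕ e′)  = 1 + (size e + size e′)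
size (e ⊖ e′)  = 1 + (size e + size e′)

-- c ⊢ s ⇓ s′ cost n: started in s, c terminates in s′ after n units of time.
data _⊢_⇓_cost_ : Cmd → Store → Store → ℕ → Set where
  skip : ∀ {s} → skip ⊢ s ⇓ s cost 1

  assign : ∀ {s x e} →
    (x ≔ e) ⊢ s ⇓ ⟪ registers s [ x ↦ eval e s ] , memory s ⟫ cost (1 + size e)

  store : ∀ {s e e′} →
    store e e′ ⊢ s ⇓ ⟪ registers s , memory s [ eval e s ↦ eval e′ s ] ⟫
      cost (1 + (size e + size e′))

  seq : ∀ {c c′ s s′ s″ m n} →
    c ⊢ s ⇓ s′ cost m → c′ ⊢ s′ ⇓ s″ cost n → (c ⨾ c′) ⊢ s ⇓ s″ cost (m + n)

  ifnz-then : ∀ {e c c′ s s′ n} → eval e s ≢ 0 →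
    c ⊢ s ⇓ s′ cost n → ifnz e c c′ ⊢ s ⇓ s′ cost (1 + size e + n)

  ifnz-else : ∀ {e c c′ s s′ n} → eval e s ≡ 0 →
    c′ ⊢ s ⇓ s′ cost n → ifnz e c c′ ⊢ s ⇓ s′ cost (1 + size e + n)

  while-stop : ∀ {e c s} → eval e s ≡ 0 →
    while e c ⊢ s ⇓ s cost (1 + size e)

  while-step : ∀ {e c s s′ s″ m n} → eval e s ≢ 0 →
    c ⊢ s ⇓ s′ cost m → while e c ⊢ s′ ⇓ s″ cost n →
    while e c ⊢ s ⇓ s″ cost (1 + size e + m + n)

contents : List ℕ → ℕ → ℕ
contents []       i       = 0
contents (n ∷ ns) zero    = n
contents (n ∷ ns) (suc i) = contents ns i

-- The input is in the memory from address 0 on; all else is zero.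
initial : List ℕ → Store
initial ns = ⟪ (λ _ → 0) , contents ns ⟫

output : Store → ℕ
output s = registers s 0

bit : Bool → ℕ
bit b = if b then 1 else 0

labels : ∀ D → List (Label D)
labels D = nothing ∷ map (λ a → just (wr a)) (allFin D)
                  ++ map (λ a → just (rd a)) (allFin D)

-- The transition relation as a table of bits, indexed by source, label and
-- target, the target varying fastest.
table : ∀ {D} → Thread D → List ℕ
table {D} P =
  concatMap (λ q → concatMap (λ l → map (λ q′ → bit (δ P q l q′))
    (allFin (states P))) (labels D)) (allFin (states P))

encode : Instance → List ℕ
encode I =
  D ∷ |Q_L| ∷ |Q_C| ∷ toℕ a⁰ ∷ toℕ (q⁰ leader) ∷ toℕ (q⁰ contributor) ∷
  map bit (Vec.toList unsafe) ++ table leader ++ table contributor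
  where open Instance I

-- One machine decides all instances, within a constant multiple of f. The
-- bound is required of every instance, not only of those with large
-- parameters.
_SolvableInTimeO_ : (Instance → Set) → (Instance → ℕ) → Set
P SolvableInTimeO f =
  ∃[ c ] ∃[ k ] ∀ I → ∃[ s ] ∃[ n ]
    (c ⊢ initial (encode I) ⇓ s cost n) × (n ≤ k * f I) × (output s ≡ 1 ⇔ P I)

Wit : (L D : ℕ) → ℕ
Wit L D = (L * (D + 1)) ^ (L * D) * D ^ D * L

Valid : (L D C : ℕ) → ℕ
Valid L D C = L ^ 3 * D ^ 2 * C ^ 2

{-# OPTIONS --safe #-}
-- With arbitrarily many contributors, every contributor state reached once
-- can be populated by as many copies as wanted (copycat argument), and these
-- copies stay available. Leader state and memory value thus move in a graph on
-- L D nodes, whose edges are the leader's transitions and the writes of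
-- populated contributor states, while the populated set only grows. Within a
-- strongly connected component the leader may go around freely, so the set may
-- be saturated with all transitions whose labels occur in the component. A
-- play is then described by the nodes at which it enters new components. These
-- are distinct, since every node visited earlier reaches the current one; hence
-- there are at most L D of them, although the graph gains edges on the way.
-- The algorithm simulates all (L D) ^ (L D) words of L D nodes, each in time
-- quadratic in C and polynomial in L and D.
module Submission where

open import Defs
open import Data.Bool using (Bool; true; false; if_then_else_; T; _∧_; _∨_)
open import Data.Empty using (⊥; ⊥-elim)
open import Data.Fin using (Fin; zero; suc; toℕ; fromℕ<; combine; remQuot)
import Data.Fin.Properties as Fin
open import Data.Fin.Subset using (_∈_)
open import Data.List using (List; []; _∷_; _++_; map; concatMap; allFin; length; tabulate)
import Data.List as List
import Data.List.Properties as List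
open import Data.Maybe using (just; nothing)
open import Data.Nat using (ℕ; zero; suc; _+_; _*_; _∸_; _^_; _≤_; _<_; _⊔_; pred; _≡ᵇ_; _<ᵇ_; z≤n; s≤s; _≟_; _/_; _%_; >-nonZero)
open import Data.Nat.DivMod using (m≡m%n+[m/n]*n; [m+kn]%n≡m%n; m<n⇒m%n≡m; m%n<n; m/n≤m)
open import Data.Nat.Properties
open import Data.Nat.Solver using (module +-*-Solver)
open import Data.Product using (Σ; ∃-syntax; _×_; _,_; proj₁; proj₂)
open import Data.Sum using (_⊎_; inj₁; inj₂)
open import Data.Unit using (⊤; tt)
import Data.Vec as Vec
import Data.Vec.Properties as Vec
open import Function using (_∘_; id; case_of_)
open import Function.Bundles using (_⇔_; mk⇔)
open import Relation.Binary.Construct.Closure.ReflexiveTransitive using (Star; _◅_; _◅◅_; reverse) renaming (ε to ε*)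
open import Relation.Binary.PropositionalEquality using (_≡_; _≢_; ≢-sym; refl; sym; trans; cong; cong₂; subst; subst₂; module ≡-Reasoning)
open import Relation.Nullary using (¬_; Dec; yes; no; contradiction)
open import Relation.Nullary.Decidable using (decidable-stable)
open import Data.List.Membership.Propositional using () renaming (_∈_ to _∈ˡ_)
import Data.List.Relation.Unary.All as All
import Data.List.Relation.Unary.AllPairs as AllPairs
open import Data.List.Relation.Unary.Any using (here; there)
open import Data.List.Relation.Unary.Unique.Propositional using (Unique)
open import Data.List.Membership.Propositional.Properties using (∈-lookup)

-- A language of loop programs, compiled to the random access machine

-- Testing a word is sound for every word: a letter that is not reachable at its turn is skipped, so
-- no guess has to be validated. For completeness a chain is padded with repetitions of its latest
-- node, and the strict bound on its length leaves a letter whose round saturates the last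
-- component. In the model saturation is an intersection and membership in a component is never
-- decided. Plays are therefore covered only up to double negation, which disappears because the
-- final answer is a number compared with 1.
--
-- The cost is read off the syntax of a loop language whose loop bounds are constants of the input,
-- as a monomial in `3 L D`, `C` and the number of words. Since the machine cannot multiply,
-- addresses in the transition tables come from lists of multiples set up by repeated addition. The
-- search takes time of the order `(L D) ^ (L D) * L ^ 4 * D ^ 4 * C ^ 2`. This exceeds the
-- polynomial factors of the required bound by `D ^ 2`, and the factor `D ^ D` pays for it.

data Exp : Set where
  lit var : ℕ → Exp
  arr     : (k : ℕ) {k<16 : T (k <ᵇ 16)} → Exp → Exp
  raw     : Exp → Exp
  _⊞_ _⊟_ : Exp → Exp → Exp

infixl 6 _⊞_ _⊟_

data Com : Set where
  nop  : Com
  set  : ℕ → Exp → Com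
  put  : (k : ℕ) {k<16 : T (k <ᵇ 16)} → Exp → Exp → Com
  _⍮_  : Com → Com → Com
  cond : Exp → Com → Com → Com
  for  : (x n : ℕ) → Com → Com

infixr 4 _⍮_

record State : Set where
  constructor ⟦_,_⟧
  field
    vars : ℕ → ℕ
    arrs : ℕ → ℕ → ℕ

open State

setV : ℕ → ℕ → State → State
setV x v s = ⟦ vars s [ x ↦ v ] , arrs s ⟧

putA : ℕ → ℕ → ℕ → State → State
putA k i v s = ⟦ vars s , (λ k′ → if k ≡ᵇ k′ then arrs s k′ [ i ↦ v ] else arrs s k′) ⟧

-- raw reads the memory of the random access machine, in which the arrays
-- are interleaved: entry i of array k has the address 16 i + k.
val : Exp → State → ℕ
val (lit n)   s = n
val (var x)   s = vars s x
val (arr k e) s = arrs s k (val e s)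
val (raw e)   s = arrs s (val e s % 16) (val e s / 16)
val (e ⊞ e′)  s = val e s + val e′ s
val (e ⊟ e′)  s = val e s ∸ val e′ s

up : ∀ {a} {A : Set a} → ℕ → (ℕ → A → A) → A → A
up zero    f x = x
up (suc n) f x = f n (up n f x)

select : ∀ {a} {A : Set a} → ℕ → A → A → A
select zero    x y = y
select (suc _) x y = x

run : Com → State → State
run nop           s = s
run (set x e)     s = setV x (val e s) s
run (put k e e′)  s = putA k (val e s) (val e′ s) s
run (c ⍮ c′)      s = run c′ (run c s)
run (cond e c c′) s = select (val e s) (run c s) (run c′ s)
run (for x n c)   s = up (vars s n) (λ i s′ → run c (setV x i s′)) s

-- Loop invariants and frame conditions.

up-inv : ∀ {a p} {A : Set a} (P : ℕ → A → Set p) {f : ℕ → A → A} {x : A} n →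
  P 0 x → (∀ i y → i < n → P i y → P (suc i) (f i y)) → P n (up n f x)
up-inv P zero    P0 step = P0
up-inv P (suc n) P0 step =
  step n _ ≤-refl (up-inv P n P0 λ i y i<n → step i y (m≤n⇒m≤1+n i<n))

up-inv′ : ∀ {a p} {A : Set a} (P : A → Set p) {f : ℕ → A → A} {x : A} n →
  P x → (∀ i y → P y → P (f i y)) → P (up n f x)
up-inv′ P n Px step = up-inv (λ _ → P) n Px λ i y _ → step i y

≡ᵇ-refl : ∀ n → (n ≡ᵇ n) ≡ true
≡ᵇ-refl zero    = refl
≡ᵇ-refl (suc n) = ≡ᵇ-refl n

≢⇒≡ᵇ : ∀ {m n} → m ≢ n → (m ≡ᵇ n) ≡ false
≢⇒≡ᵇ {m} {n} m≢n with m ≡ᵇ n in eq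
... | false = refl
... | true  = ⊥-elim (m≢n (≡ᵇ⇒≡ m n (subst T (sym eq) tt)))

update-same : ∀ f x {v : ℕ} → (f [ x ↦ v ]) x ≡ v
update-same f x rewrite ≡ᵇ-refl x = refl

update-other : ∀ f {x y} {v : ℕ} → x ≢ y → (f [ x ↦ v ]) y ≡ f y
update-other f x≢y rewrite ≢⇒≡ᵇ x≢y = refl

-- A syntactic check with Boolean result, so that the frame condition of a concrete command is
-- settled by `refl`.
writesV : ℕ → Com → Bool
writesV y nop           = false
writesV y (set x e)     = x ≡ᵇ y
writesV y (put k e e′)  = false
writesV y (c ⍮ c′)      = writesV y c ∨ writesV y c′
writesV y (cond e c c′) = writesV y c ∨ writesV y c′
writesV y (for x n c)   = (x ≡ᵇ y) ∨ writesV y c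

writesA : ℕ → Com → Bool
writesA j nop           = false
writesA j (set x e)     = false
writesA j (put k e e′)  = k ≡ᵇ j
writesA j (c ⍮ c′)      = writesA j c ∨ writesA j c′
writesA j (cond e c c′) = writesA j c ∨ writesA j c′
writesA j (for x n c)   = writesA j c

∨-falseˡ : ∀ {b c} → (b ∨ c) ≡ false → b ≡ false
∨-falseˡ {false} _ = refl

∨-falseʳ : ∀ {b c} → (b ∨ c) ≡ false → c ≡ false
∨-falseʳ {false} p = p

vars-frame : ∀ c {y} s → writesV y c ≡ false → vars (run c s) y ≡ vars s y
vars-frame nop           s p = refl
vars-frame (set x e)     s p rewrite p = refl
vars-frame (put k e e′)  s p = refl
vars-frame (c ⍮ c′)      s p =
  trans (vars-frame c′ (run c s) (∨-falseʳ {writesV _ c} p)) (vars-frame c s (∨-falseˡ p))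
vars-frame (cond e c c′) s p with val e s
... | zero  = vars-frame c′ s (∨-falseʳ {writesV _ c} p)
... | suc _ = vars-frame c s (∨-falseˡ p)
vars-frame (for x n c) {y} s p = up-inv′ (λ s′ → vars s′ y ≡ vars s y) (vars s n) refl
  λ i s′ eq → trans (vars-frame c (setV x i s′) (∨-falseʳ {x ≡ᵇ y} p)) (trans (lemma i s′) eq)
  where
  lemma : ∀ i s′ → vars (setV x i s′) y ≡ vars s′ y
  lemma i s′ rewrite ∨-falseˡ {x ≡ᵇ y} p = refl

arrs-frame : ∀ c {j} s → writesA j c ≡ false → ∀ i → arrs (run c s) j i ≡ arrs s j i
arrs-frame nop           s p i = refl
arrs-frame (set x e)     s p i = refl
arrs-frame (put k e e′)  s p i rewrite p = refl
arrs-frame (c ⍮ c′)      s p i =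
  trans (arrs-frame c′ (run c s) (∨-falseʳ {writesA _ c} p) i) (arrs-frame c s (∨-falseˡ p) i)
arrs-frame (cond e c c′) s p i with val e s
... | zero  = arrs-frame c′ s (∨-falseʳ {writesA _ c} p) i
... | suc _ = arrs-frame c s (∨-falseˡ p) i
arrs-frame (for x n c) {j} s p i = up-inv′ (λ s′ → arrs s′ j i ≡ arrs s j i) (vars s n) refl
  λ i′ s′ eq → trans (arrs-frame c (setV x i′ s′) p i) eq

-- Compilation to the random access machine, and its correctness.

dbl : ℕ → ℕ
dbl zero    = zero
dbl (suc n) = suc (suc (dbl n))

dbl≡ᵇdbl : ∀ m n → (dbl m ≡ᵇ dbl n) ≡ (m ≡ᵇ n)
dbl≡ᵇdbl zero    zero    = refl
dbl≡ᵇdbl zero    (suc n) = refl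
dbl≡ᵇdbl (suc m) zero    = refl
dbl≡ᵇdbl (suc m) (suc n) = dbl≡ᵇdbl m n

odd≡ᵇdbl : ∀ m n → (suc (dbl m) ≡ᵇ dbl n) ≡ false
odd≡ᵇdbl zero    zero    = refl
odd≡ᵇdbl zero    (suc n) = refl
odd≡ᵇdbl (suc m) zero    = refl
odd≡ᵇdbl (suc m) (suc n) = odd≡ᵇdbl m n

dbl≡ᵇodd : ∀ m n → (dbl m ≡ᵇ suc (dbl n)) ≡ false
dbl≡ᵇodd zero    zero    = refl
dbl≡ᵇodd zero    (suc n) = refl
dbl≡ᵇodd (suc m) zero    = refl
dbl≡ᵇodd (suc m) (suc n) = dbl≡ᵇodd m n

twice : Expr → Expr
twice e = e ⊕ e

loc : ℕ → ℕ → ℕ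
loc k i = i * 16 + k

-- The factor 16 of the interleaving is obtained by four doublings. Each array access thus repeats
-- its index expression sixteen times, which affects only the constant factor of the running time.
compileE : Exp → Expr
compileE (lit n)   = con n
compileE (var x)   = reg (dbl x)
compileE (arr k e) = load (twice (twice (twice (twice (compileE e)))) ⊕ con k)
compileE (raw e)   = load (compileE e)
compileE (e ⊞ e′)  = compileE e ⊕ compileE e′
compileE (e ⊟ e′)  = compileE e ⊖ compileE e′

-- A variable x lives in the even register dbl x; the counter and the limit
-- of a loop at nesting depth d live in odd registers.
counter limit : ℕ → ℕ
counter d = suc (dbl d)
limit d = suc (dbl (suc d))

-- `run` fixes the number of rounds and the successive values of `x` in advance, whatever the body
-- does to `n` and `x`. Hence the limit is saved on entry, and `x` is only a copy of a hidden
-- counter. Two hidden registers per loop explain the depth `2 + d` of the body.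
compile : ℕ → Com → Cmd
compile d nop           = skip
compile d (set x e)     = dbl x ≔ compileE e
compile d (put k e e′)  =
  store (twice (twice (twice (twice (compileE e)))) ⊕ con k) (compileE e′)
compile d (c ⍮ c′)      = compile d c ⨾ compile d c′
compile d (cond e c c′) = ifnz (compileE e) (compile d c) (compile d c′)
compile d (for x n c)   =
  counter d ≔ con 0 ⨾ limit d ≔ reg (dbl n) ⨾
  while (reg (limit d) ⊖ reg (counter d))
    (dbl x ≔ reg (counter d) ⨾ compile (2 + d) c ⨾ counter d ≔ reg (counter d) ⊕ con 1)

sumUp : ℕ → (ℕ → ℕ) → ℕ
sumUp zero    f = 0
sumUp (suc n) f = sumUp n f + f n

-- An upper bound: a conditional is charged for both branches. A round of a loop costs 4 for the
-- test, 2 for setting `x` and 4 for the increment; the 8 outside consists of two assignments and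
-- the failing test.
cost : Com → State → ℕ
cost nop           s = 1
cost (set x e)     s = 1 + size (compileE e)
cost (put k e e′)  s =
  1 + (size (twice (twice (twice (twice (compileE e)))) ⊕ con k) + size (compileE e′))
cost (c ⍮ c′)      s = cost c s + cost c′ (run c s)
cost (cond e c c′) s = 1 + size (compileE e) + (cost c s + cost c′ s)
cost (for x n c)   s =
  8 + sumUp (vars s n) λ i →
    10 + cost c (setV x i (up i (λ i s′ → run c (setV x i s′)) s))

-- Odd registers are left unconstrained, so that the bookkeeping of loops is invisible. Below 16 the
-- pair of array and index is determined by the address.
record _~_ (σ : Store) (s : State) : Set where
  field
    regs : ∀ x → registers σ (dbl x) ≡ vars s x
    mems : ∀ k i → T (k <ᵇ 16) → memory σ (loc k i) ≡ arrs s k i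

open _~_

16-fold : ∀ v k → ((v + v + (v + v)) + (v + v + (v + v))) + ((v + v + (v + v)) + (v + v + (v + v))) + k ≡ loc k v
16-fold = solve 2 (λ v k → ((v :+ v :+ (v :+ v)) :+ (v :+ v :+ (v :+ v))) :+ ((v :+ v :+ (v :+ v)) :+ (v :+ v :+ (v :+ v))) :+ k := v :* con 16 :+ k) refl
  where open +-*-Solver

loc-injective : ∀ k k′ i i′ → T (k <ᵇ 16) → T (k′ <ᵇ 16) → loc k i ≡ loc k′ i′ → k ≡ k′ × i ≡ i′
loc-injective k k′ i i′ k<16 k′<16 eq = k≡k′ , i≡i′
  where
  rem : ∀ k i → T (k <ᵇ 16) → loc k i % 16 ≡ k
  rem k i k<16 = trans (cong (_% 16) (+-comm (i * 16) k)) (trans ([m+kn]%n≡m%n k i 16) (m<n⇒m%n≡m (<ᵇ⇒< k 16 k<16)))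
  k≡k′ : k ≡ k′
  k≡k′ = trans (sym (rem k i k<16)) (trans (cong (_% 16) eq) (rem k′ i′ k′<16))
  i≡i′ : i ≡ i′
  i≡i′ = *-cancelʳ-≡ i i′ 16 (+-cancelʳ-≡ k (i * 16) (i′ * 16) (trans eq (cong (i′ * 16 +_) (sym k≡k′))))

val-sound : ∀ e {σ s} → σ ~ s → eval (compileE e) σ ≡ val e s
addr-sound : ∀ e k {σ s} → σ ~ s →
  eval (twice (twice (twice (twice (compileE e)))) ⊕ con k) σ ≡ loc k (val e s)

val-sound (lit n)   R = refl
val-sound (var x)   R = regs R x
val-sound (arr k {k<16} e) {σ} {s} R =
  trans (cong (memory σ) (addr-sound e k R)) (mems R k (val e s) k<16)
val-sound (raw e) {σ} {s} R = begin
  memory σ (eval (compileE e) σ)          ≡⟨ cong (memory σ) (val-sound e R) ⟩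
  memory σ (val e s)                      ≡⟨ cong (memory σ) (trans (m≡m%n+[m/n]*n (val e s) 16) (+-comm (val e s % 16) _)) ⟩
  memory σ (loc (val e s % 16) (val e s / 16)) ≡⟨ mems R _ _ (<⇒<ᵇ (m%n<n (val e s) 16)) ⟩
  arrs s (val e s % 16) (val e s / 16)    ∎
  where open ≡-Reasoning
val-sound (e ⊞ e′)  R = cong₂ _+_ (val-sound e R) (val-sound e′ R)
val-sound (e ⊟ e′)  R = cong₂ _∸_ (val-sound e R) (val-sound e′ R)

addr-sound e k {s = s} R rewrite val-sound e R = 16-fold (val e s) k

~-set : ∀ {σ s} x v → σ ~ s → ⟪ registers σ [ dbl x ↦ v ] , memory σ ⟫ ~ setV x v s
~-set {σ} {s} x v R .regs y rewrite dbl≡ᵇdbl x y with x ≡ᵇ y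
... | true  = refl
... | false = regs R y
~-set x v R .mems = mems R

~-hidden : ∀ {σ s} d v → σ ~ s → ⟪ registers σ [ suc (dbl d) ↦ v ] , memory σ ⟫ ~ s
~-hidden d v R .regs y rewrite odd≡ᵇdbl d y = regs R y
~-hidden d v R .mems = mems R

~-put : ∀ {σ s} k i v → T (k <ᵇ 16) → σ ~ s → ⟪ registers σ , memory σ [ loc k i ↦ v ] ⟫ ~ putA k i v s
~-put k i v k<16 R .regs = regs R
~-put {σ} {s} k i v k<16 R .mems k′ i′ k′<16 with k ≟ k′ | i ≟ i′
... | yes refl | yes refl rewrite ≡ᵇ-refl k | ≡ᵇ-refl i = update-same (memory σ) (loc k i)
... | yes refl | no i≢i′ rewrite ≡ᵇ-refl k | ≢⇒≡ᵇ i≢i′ =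
  trans (update-other (memory σ) (i≢i′ ∘ proj₂ ∘ loc-injective k k i i′ k<16 k<16)) (mems R k i′ k<16)
... | no k≢k′ | _ rewrite ≢⇒≡ᵇ k≢k′ =
  trans (update-other (memory σ) (k≢k′ ∘ proj₁ ∘ loc-injective k k′ i i′ k<16 k′<16)) (mems R k′ i′ k′<16)

-- These odd registers hold the counters and limits of the enclosing loops, about which `_~_` says
-- nothing.
Keeps : ℕ → Store → Store → Set
Keeps d σ σ′ = ∀ j → j < d → registers σ′ (suc (dbl j)) ≡ registers σ (suc (dbl j))

record Simulates (d : ℕ) (c : Com) (σ : Store) (s : State) : Set where
  constructor simulates
  field
    end       : Store
    time      : ℕ
    execution : compile d c ⊢ σ ⇓ end cost time
    in-time   : time ≤ cost c s
    related   : end ~ run c s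
    keeps     : Keeps d σ end

keeps-even : ∀ d σ x v → Keeps d σ ⟪ registers σ [ dbl x ↦ v ] , memory σ ⟫
keeps-even d σ x v j _ rewrite dbl≡ᵇodd x j = refl

keeps-odd : ∀ d e σ v → d ≤ e → Keeps d σ ⟪ registers σ [ suc (dbl e) ↦ v ] , memory σ ⟫
keeps-odd d e σ v d≤e j j<d rewrite dbl≡ᵇdbl e j | ≢⇒≡ᵇ {e} {j} (λ { refl → <⇒≱ j<d d≤e }) = refl

counter≢limit : ∀ d → counter d ≢ limit d
counter≢limit d p = m≢1+n+m (dbl d) {1} (suc-injective p)

simulate : ∀ c d σ s → σ ~ s → Simulates d c σ s
simulate nop d σ s R = simulates σ 1 skip ≤-refl R λ _ _ → refl
simulate (set x e) d σ s R = simulates _ _ assign ≤-refl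
  (subst (λ v → ⟪ registers σ [ dbl x ↦ eval (compileE e) σ ] , memory σ ⟫ ~ setV x v s) (val-sound e R)
    (~-set x (eval (compileE e) σ) R))
  (keeps-even d σ x (eval (compileE e) σ))
simulate (put k {k<16} e e′) d σ s R = simulates _ _ store ≤-refl
  (subst₂ (λ a v → ⟪ registers σ , memory σ [ a ↦ v ] ⟫ ~ putA k (val e s) (val e′ s) s)
    (sym (addr-sound e k R)) (sym (val-sound e′ R)) (~-put k (val e s) (val e′ s) k<16 R))
  λ _ _ → refl
simulate (c ⍮ c′) d σ s R with simulate c d σ s R
... | simulates σ₁ m₁ E₁ b₁ R₁ K₁ with simulate c′ d σ₁ (run c s) R₁
... | simulates σ₂ m₂ E₂ b₂ R₂ K₂ =
  simulates σ₂ (m₁ + m₂) (seq E₁ E₂) (+-mono-≤ b₁ b₂) R₂ λ j j<d → trans (K₂ j j<d) (K₁ j j<d)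
simulate (cond e c c′) d σ s R with val e s in eq
... | zero with simulate c′ d σ s R
...   | simulates σ₁ m₁ E₁ b₁ R₁ K₁ = simulates σ₁ _ (ifnz-else (trans (val-sound e R) eq) E₁)
        (+-monoʳ-≤ (1 + size (compileE e)) (≤-trans b₁ (m≤n+m _ (cost c s))))
        (subst (λ v → σ₁ ~ select v (run c s) (run c′ s)) (sym eq) R₁) K₁
simulate (cond e c c′) d σ s R | suc n with simulate c d σ s R
...   | simulates σ₁ m₁ E₁ b₁ R₁ K₁ = simulates σ₁ _
        (ifnz-then (λ p → 1+n≢0 (trans (sym eq) (trans (sym (val-sound e R)) p))) E₁)
        (+-monoʳ-≤ (1 + size (compileE e)) (≤-trans b₁ (m≤m+n (cost c s) _)))
        (subst (λ v → σ₁ ~ select v (run c s) (run c′ s)) (sym eq) R₁) K₁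
simulate (for x y c) d σ s R = finish (loop n 0 refl σ₂ R₂ counter≡0 limit≡n)
  where
  n = vars s y
  body = λ i s′ → run c (setV x i s′)
  σ₁ = ⟪ registers σ [ counter d ↦ 0 ] , memory σ ⟫
  R₁ : σ₁ ~ s
  R₁ = ~-hidden d 0 R
  σ₂ = ⟪ registers σ₁ [ limit d ↦ registers σ₁ (dbl y) ] , memory σ ⟫
  R₂ : σ₂ ~ s
  R₂ = ~-hidden (suc d) (registers σ₁ (dbl y)) R₁
  limit≡n : registers σ₂ (limit d) ≡ n
  limit≡n = trans (update-same (registers σ₁) (limit d)) (regs R₁ y)
  counter≡0 : registers σ₂ (counter d) ≡ 0
  counter≡0 = trans (update-other (registers σ₁) (≢-sym (counter≢limit d))) (update-same (registers σ) (counter d))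
  test = reg (limit d) ⊖ reg (counter d)
  W = while test
    (dbl x ≔ reg (counter d) ⨾ compile (2 + d) c ⨾ counter d ≔ reg (counter d) ⊕ con 1)
  costs = λ i → 10 + cost c (setV x i (up i body s))
  -- The rounds before `i` are added on the left instead of being subtracted on the right; the 4 is
  -- the failing test at the end.
  LoopFrom : ℕ → Store → Set
  LoopFrom i σ = ∃[ σ′ ] ∃[ m ]
    (W ⊢ σ ⇓ σ′ cost m) × m + sumUp i costs ≤ 4 + sumUp n costs × σ′ ~ up n body s × Keeps d σ σ′
  loop : ∀ j i → i + j ≡ n → ∀ σ → σ ~ up i body s →
    registers σ (counter d) ≡ i → registers σ (limit d) ≡ n → LoopFrom i σ
  loop zero i i+0≡n σ R at-i at-n with trans (sym (+-identityʳ i)) i+0≡n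
  ... | refl = σ , _ , while-stop (trans (cong₂ _∸_ at-n at-i) (n∸n≡0 i)) ,
    ≤-refl , R , λ _ _ → refl
  loop (suc j) i i+j≡n σ R at-i at-n with simulate c (2 + d) σx (setV x i (up i body s)) Rx
    where
    σx = ⟪ registers σ [ dbl x ↦ registers σ (counter d) ] , memory σ ⟫
    Rx : σx ~ setV x i (up i body s)
    Rx = subst (λ v → σx ~ setV x v (up i body s)) at-i (~-set x (registers σ (counter d)) R)
  ... | simulates σc m E b Rc Kc = again
    where
    σx = ⟪ registers σ [ dbl x ↦ registers σ (counter d) ] , memory σ ⟫
    σn = ⟪ registers σc [ counter d ↦ registers σc (counter d) + 1 ] , memory σc ⟫
    i<n : i < n
    i<n = subst (suc i ≤_) (trans (sym (+-suc i j)) i+j≡n) (m≤m+n (suc i) j)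
    -- At depth `2 + d` the body keeps the hidden registers with indices `d` and `suc d`, which are
    -- the counter and the limit of this loop.
    c≡ : registers σc (counter d) ≡ i
    c≡ = trans (Kc d (m≤n+m (suc d) 1)) (trans (keeps-even (2 + d) σ x (registers σ (counter d)) d (m≤n+m (suc d) 1)) at-i)
    l≡ : registers σc (limit d) ≡ n
    l≡ = trans (Kc (suc d) ≤-refl) (trans (keeps-even (2 + d) σ x (registers σ (counter d)) (suc d) ≤-refl) at-n)
    again : LoopFrom i σ
    again with loop j (suc i) (trans (sym (+-suc i j)) i+j≡n) σn (~-hidden d (registers σc (counter d) + 1) Rc)
           (trans (update-same (registers σc) (counter d)) (trans (cong (_+ 1) c≡) (+-comm i 1)))
           (trans (update-other (registers σc) (counter≢limit d)) l≡)
    ... | σ′ , m′ , E′ , b′ , R′ , K′ = σ′ , _ ,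
      while-step (λ p → m<n⇒n≢0 (m<n⇒0<n∸m i<n) (trans (sym (cong₂ _∸_ at-n at-i)) p))
        (seq assign (seq E assign)) E′ ,
      ≤-trans (≤-reflexive (solve 3 (λ m′ m S → con 4 :+ (con 2 :+ (m :+ con 4)) :+ m′ :+ S := m′ :+ (S :+ (con 10 :+ m))) refl m′ m (sumUp i costs)))
        (≤-trans (+-monoʳ-≤ m′ (+-monoʳ-≤ (sumUp i costs) (+-monoʳ-≤ 10 b))) b′) ,
      R′ ,
      λ j j<d → trans (K′ j j<d) (trans (keeps-odd d d σc (registers σc (counter d) + 1) ≤-refl j j<d)
        (trans (Kc j (m≤n⇒m≤1+n (m≤n⇒m≤1+n j<d))) (keeps-even d σ x (registers σ (counter d)) j j<d)))
      where open +-*-Solver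
  finish : LoopFrom 0 σ₂ → Simulates d (for x y c) σ s
  finish (σ′ , m , E , b , R′ , K) = simulates σ′ _ (seq assign (seq assign E))
    (+-monoʳ-≤ 4 (≤-trans (≤-reflexive (sym (+-identityʳ m))) b)) R′
    λ j j<d → trans (K j j<d) (trans (keeps-odd d (suc d) σ₁ (registers σ₁ (dbl y)) (n≤1+n d) j j<d)
      (keeps-odd d d σ 0 ≤-refl j j<d))

-- Static cost bounds of the form k A ^ a C ^ c T ^ t

record Degree : Set where
  constructor deg
  field
    inA inC inT : ℕ

_⊔ᵈ_ _+ᵈ_ : Degree → Degree → Degree
deg a c t ⊔ᵈ deg a′ c′ t′ = deg (a ⊔ a′) (c ⊔ c′) (t ⊔ t′)
deg a c t +ᵈ deg a′ c′ t′ = deg (a + a′) (c + c′) (t + t′)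

-- Loops are bounded by the variables 1 to 7 only, holding D, L, C, L D,
-- 2 D + 1, (L D) ^ (L D) and 9 (2 D + 1) L² C²; here A stands for 3 L D and T
-- for (L D) ^ (L D).
degreeV : ℕ → Degree
degreeV 1 = deg 1 0 0
degreeV 2 = deg 1 0 0
degreeV 3 = deg 0 1 0
degreeV 4 = deg 1 0 0
degreeV 5 = deg 1 0 0
degreeV 6 = deg 0 0 1
degreeV 7 = deg 3 2 0
degreeV _ = deg 0 0 0

degree : Com → Degree
degree nop           = deg 0 0 0
degree (set x e)     = deg 0 0 0
degree (put k e e′)  = deg 0 0 0
degree (c ⍮ c′)      = degree c ⊔ᵈ degree c′
degree (cond e c c′) = degree c ⊔ᵈ degree c′
degree (for x n c)   = degreeV n +ᵈ degree c

factor : Com → ℕ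
factor nop           = 1
factor (set x e)     = 1 + size (compileE e)
factor (put k e e′)  =
  1 + (size (twice (twice (twice (twice (compileE e)))) ⊕ con k) + size (compileE e′))
factor (c ⍮ c′)      = factor c + factor c′
factor (cond e c c′) = 1 + size (compileE e) + (factor c + factor c′)
factor (for x n c)   = 8 + (10 + factor c)

-- Variables below 16 are constants of the search and 1 to 7 bound its loops. As a safe command
-- cannot change them, one bound on these variables serves all rounds of all nested loops.
safe : Com → Bool
safe nop           = true
safe (set x e)     = 15 <ᵇ x
safe (put k e e′)  = true
safe (c ⍮ c′)      = safe c ∧ safe c′
safe (cond e c c′) = safe c ∧ safe c′
safe (for x n c)   = (15 <ᵇ x) ∧ (n <ᵇ 8) ∧ safe c

T-∧ˡ : ∀ {b c} → T (b ∧ c) → T b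
T-∧ˡ {true} _ = tt

T-∧ʳ : ∀ {b c} → T (b ∧ c) → T c
T-∧ʳ {true} p = p

params≢ : ∀ {x y} → T (15 <ᵇ x) → T (y <ᵇ 16) → x ≢ y
params≢ {x} {y} p q refl = <⇒≱ (<ᵇ⇒< x 16 q) (<ᵇ⇒< 15 x p)

params≢ᵇ : ∀ {x y} → T (15 <ᵇ x) → T (y <ᵇ 16) → (x ≡ᵇ y) ≡ false
params≢ᵇ {x} {y} p q = ≢⇒≡ᵇ (params≢ {x} {y} p q)

safe⇒¬writesV : ∀ c y → T (safe c) → T (y <ᵇ 16) → writesV y c ≡ false
safe⇒¬writesV nop y p q = refl
safe⇒¬writesV (set x e) y p q = params≢ᵇ {x} {y} p q
safe⇒¬writesV (put k e e′) y p q = refl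
safe⇒¬writesV (c ⍮ c′) y p q
  rewrite safe⇒¬writesV c y (T-∧ˡ p) q = safe⇒¬writesV c′ y (T-∧ʳ {safe c} p) q
safe⇒¬writesV (cond e c c′) y p q
  rewrite safe⇒¬writesV c y (T-∧ˡ p) q = safe⇒¬writesV c′ y (T-∧ʳ {safe c} p) q
safe⇒¬writesV (for x n c) y p q
  rewrite params≢ᵇ {x} {y} (T-∧ˡ p) q = safe⇒¬writesV c y (T-∧ʳ {n <ᵇ 8} (T-∧ʳ {15 <ᵇ x} p)) q

sumUp-≤ : ∀ n {f b} → (∀ i → f i ≤ b) → sumUp n f ≤ n * b
sumUp-≤ zero    f≤b = z≤n
sumUp-≤ (suc n) {f} {b} f≤b = ≤-trans (+-mono-≤ (sumUp-≤ n f≤b) (f≤b n)) (≤-reflexive (+-comm (n * b) b))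

module CostBound (A C T₀ : ℕ) (A≥1 : 1 ≤ A) (C≥1 : 1 ≤ C) (T≥1 : 1 ≤ T₀) where

  ⟦_⟧ᵈ : Degree → ℕ
  ⟦ deg a c t ⟧ᵈ = A ^ a * C ^ c * T₀ ^ t

  Bounded : State → Set
  Bounded s = ∀ y → T (y <ᵇ 8) → vars s y ≤ ⟦ degreeV y ⟧ᵈ

  power-≤ : ∀ {b m n} → 1 ≤ b → m ≤ n → b ^ m ≤ b ^ n
  power-≤ {suc b} _ = ^-monoʳ-≤ (suc b)

  ⊔ᵈ-≤ˡ : ∀ d e → ⟦ d ⟧ᵈ ≤ ⟦ d ⊔ᵈ e ⟧ᵈ
  ⊔ᵈ-≤ˡ (deg a c t) (deg a′ c′ t′) =
    *-mono-≤ (*-mono-≤ (power-≤ A≥1 (m≤m⊔n a a′)) (power-≤ C≥1 (m≤m⊔n c c′))) (power-≤ T≥1 (m≤m⊔n t t′))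

  ⊔ᵈ-≤ʳ : ∀ d e → ⟦ e ⟧ᵈ ≤ ⟦ d ⊔ᵈ e ⟧ᵈ
  ⊔ᵈ-≤ʳ (deg a c t) (deg a′ c′ t′) =
    *-mono-≤ (*-mono-≤ (power-≤ A≥1 (m≤n⊔m a a′)) (power-≤ C≥1 (m≤n⊔m c c′))) (power-≤ T≥1 (m≤n⊔m t t′))

  +ᵈ-* : ∀ d e → ⟦ d ⟧ᵈ * ⟦ e ⟧ᵈ ≡ ⟦ d +ᵈ e ⟧ᵈ
  +ᵈ-* (deg a c t) (deg a′ c′ t′)
    rewrite ^-distribˡ-+-* A a a′ | ^-distribˡ-+-* C c c′ | ^-distribˡ-+-* T₀ t t′ =
    solve 6 (λ a c t a′ c′ t′ → (a :* c :* t) :* (a′ :* c′ :* t′) := (a :* a′) :* (c :* c′) :* (t :* t′)) refl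
      (A ^ a) (C ^ c) (T₀ ^ t) (A ^ a′) (C ^ c′) (T₀ ^ t′)
    where open +-*-Solver

  ⟦⟧ᵈ≥1 : ∀ d → 1 ≤ ⟦ d ⟧ᵈ
  ⟦⟧ᵈ≥1 (deg a c t) =
    *-mono-≤ (*-mono-≤ (power-≤ {m = 0} {a} A≥1 z≤n) (power-≤ {m = 0} {c} C≥1 z≤n)) (power-≤ {m = 0} {t} T≥1 z≤n)

  n≤n*⟦⟧ᵈ : ∀ n d → n ≤ n * ⟦ d ⟧ᵈ
  n≤n*⟦⟧ᵈ n d = ≤-trans (≤-reflexive (sym (*-identityʳ n))) (*-monoʳ-≤ n (⟦⟧ᵈ≥1 d))

  Bounded-run : ∀ c {s} → T (safe c) → Bounded s → Bounded (run c s)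
  Bounded-run c {s} ok B y y<8 =
    subst (_≤ ⟦ degreeV y ⟧ᵈ) (sym (vars-frame c s (safe⇒¬writesV c y ok (<8⇒<16 y y<8)))) (B y y<8)
    where
    <8⇒<16 : ∀ y → T (y <ᵇ 8) → T (y <ᵇ 16)
    <8⇒<16 y p = <⇒<ᵇ (<-≤-trans (<ᵇ⇒< y 8 p) (m≤m+n 8 8))

  Bounded-setV : ∀ x v {s} → T (15 <ᵇ x) → Bounded s → Bounded (setV x v s)
  Bounded-setV x v {s} ok B = Bounded-run (set x (lit v)) {s} ok B

  -- All three bases are at least 1, hence so is every monomial, and additive constants are absorbed
  -- into the factor. A loop multiplies the monomial of its body by that of its bound.
  cost-≤ : ∀ c s → T (safe c) → Bounded s → cost c s ≤ factor c * ⟦ degree c ⟧ᵈ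
  cost-≤ nop s ok B = n≤n*⟦⟧ᵈ 1 (deg 0 0 0)
  cost-≤ (set x e) s ok B = n≤n*⟦⟧ᵈ _ (deg 0 0 0)
  cost-≤ (put k e e′) s ok B = n≤n*⟦⟧ᵈ _ (deg 0 0 0)
  cost-≤ (c ⍮ c′) s ok B = begin
    cost c s + cost c′ (run c s)
      ≤⟨ +-mono-≤ (cost-≤ c s (T-∧ˡ ok) B) (cost-≤ c′ _ (T-∧ʳ {safe c} ok) (Bounded-run c (T-∧ˡ ok) B)) ⟩
    factor c * ⟦ degree c ⟧ᵈ + factor c′ * ⟦ degree c′ ⟧ᵈ
      ≤⟨ +-mono-≤ (*-monoʳ-≤ (factor c) (⊔ᵈ-≤ˡ (degree c) (degree c′))) (*-monoʳ-≤ (factor c′) (⊔ᵈ-≤ʳ (degree c) (degree c′))) ⟩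
    factor c * M + factor c′ * M
      ≡⟨ *-distribʳ-+ M (factor c) (factor c′) ⟨
    (factor c + factor c′) * M ∎
    where
    open ≤-Reasoning
    M = ⟦ degree c ⊔ᵈ degree c′ ⟧ᵈ
  cost-≤ (cond e c c′) s ok B = begin
    n + (cost c s + cost c′ s)
      ≤⟨ +-mono-≤ (n≤n*⟦⟧ᵈ n (degree c ⊔ᵈ degree c′))
           (+-mono-≤ (cost-≤ c s (T-∧ˡ ok) B) (cost-≤ c′ s (T-∧ʳ {safe c} ok) B)) ⟩
    n * M + (factor c * ⟦ degree c ⟧ᵈ + factor c′ * ⟦ degree c′ ⟧ᵈ)
      ≤⟨ +-monoʳ-≤ (n * M) (+-mono-≤ (*-monoʳ-≤ (factor c) (⊔ᵈ-≤ˡ (degree c) (degree c′))) (*-monoʳ-≤ (factor c′) (⊔ᵈ-≤ʳ (degree c) (degree c′)))) ⟩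
    n * M + (factor c * M + factor c′ * M)
      ≡⟨ solve 4 (λ n f f′ M → n :* M :+ (f :* M :+ f′ :* M) := (n :+ (f :+ f′)) :* M) refl n (factor c) (factor c′) M ⟩
    (n + (factor c + factor c′)) * M ∎
    where
    open ≤-Reasoning
    open +-*-Solver using (solve; _:+_; _:*_; _:=_)
    n = 1 + size (compileE e)
    M = ⟦ degree c ⊔ᵈ degree c′ ⟧ᵈ
  cost-≤ (for x n c) s ok B = begin
    8 + sumUp (vars s n) costs
      ≤⟨ +-monoʳ-≤ 8 (sumUp-≤ (vars s n) per-round) ⟩
    8 + vars s n * ((10 + factor c) * ⟦ degree c ⟧ᵈ)
      ≤⟨ +-mono-≤ (n≤n*⟦⟧ᵈ 8 (degreeV n +ᵈ degree c)) (*-monoˡ-≤ ((10 + factor c) * ⟦ degree c ⟧ᵈ) (B n (T-∧ˡ (T-∧ʳ {15 <ᵇ x} ok)))) ⟩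
    8 * ⟦ degreeV n +ᵈ degree c ⟧ᵈ + ⟦ degreeV n ⟧ᵈ * ((10 + factor c) * ⟦ degree c ⟧ᵈ)
      ≡⟨ cong (8 * ⟦ degreeV n +ᵈ degree c ⟧ᵈ +_) (solve 3 (λ v k m → v :* (k :* m) := k :* (v :* m)) refl ⟦ degreeV n ⟧ᵈ (10 + factor c) ⟦ degree c ⟧ᵈ) ⟩
    8 * ⟦ degreeV n +ᵈ degree c ⟧ᵈ + (10 + factor c) * (⟦ degreeV n ⟧ᵈ * ⟦ degree c ⟧ᵈ)
      ≡⟨ cong (λ z → 8 * ⟦ degreeV n +ᵈ degree c ⟧ᵈ + (10 + factor c) * z) (+ᵈ-* (degreeV n) (degree c)) ⟩
    8 * ⟦ degreeV n +ᵈ degree c ⟧ᵈ + (10 + factor c) * ⟦ degreeV n +ᵈ degree c ⟧ᵈ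
      ≡⟨ *-distribʳ-+ ⟦ degreeV n +ᵈ degree c ⟧ᵈ 8 (10 + factor c) ⟨
    (8 + (10 + factor c)) * ⟦ degreeV n +ᵈ degree c ⟧ᵈ ∎
    where
    open ≤-Reasoning
    open +-*-Solver using (solve; _:+_; _:*_; _:=_)
    body = λ i s′ → run c (setV x i s′)
    costs = λ i → 10 + cost c (setV x i (up i body s))
    ok-c : T (safe c)
    ok-c = T-∧ʳ {n <ᵇ 8} (T-∧ʳ {15 <ᵇ x} ok)
    per-round : ∀ i → costs i ≤ (10 + factor c) * ⟦ degree c ⟧ᵈ
    per-round i = ≤-trans
      (+-mono-≤ (n≤n*⟦⟧ᵈ 10 (degree c))
        (cost-≤ c _ ok-c (Bounded-setV x i {up i body s} (T-∧ˡ ok)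
          (up-inv′ Bounded i B λ i′ s′ B′ → Bounded-run c ok-c (Bounded-setV x i′ {s′} (T-∧ˡ ok) B′)))))
      (≤-reflexive (sym (*-distribʳ-+ ⟦ degree c ⟧ᵈ 10 (factor c))))

-- Plays of the leader against a growing set of contributor states

Unique⇒lookup-injective : ∀ {A : Set} {xs : List A} → Unique xs →
  ∀ i j → List.lookup xs i ≡ List.lookup xs j → i ≡ j
Unique⇒lookup-injective (x∉ AllPairs.∷ u) zero    zero    eq = refl
Unique⇒lookup-injective (x∉ AllPairs.∷ u) zero    (suc j) eq = ⊥-elim (All.lookup x∉ (∈-lookup j) eq)
Unique⇒lookup-injective (x∉ AllPairs.∷ u) (suc i) zero    eq = ⊥-elim (All.lookup x∉ (∈-lookup i) (sym eq))
Unique⇒lookup-injective (x∉ AllPairs.∷ u) (suc i) (suc j) eq = cong suc (Unique⇒lookup-injective u i j eq)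

module Model (I : Instance) where

  open Instance I

  Node : Set
  Node = Fin |Q_L| × Fin D

  -- A copy of `Effect` that does not depend on the number of contributors; `Effect` belongs to the
  -- semantics of one program `I ^^ t`.
  data Eff : Label D → Fin D → Fin D → Set where
    read  : ∀ {a}   → Eff (just (rd a)) a a
    write : ∀ {a b} → Eff (just (wr b)) a b
    ε     : ∀ {a}   → Eff nothing a a

  ν₀ : Node
  ν₀ = q⁰ leader , a⁰

  Writable : (Fin |Q_C| → Set) → Fin D → Set
  Writable P b = ∃[ σ ] ∃[ σ′ ] P σ × δ contributor σ (just (wr b)) σ′ ≡ true

  data Edge (W : Fin D → Set) : Node → Node → Set where
    leads  : ∀ {q q′ l a a′} → δ leader q l q′ ≡ true → Eff l a a′ → Edge W (q , a) (q′ , a′)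
    writes : ∀ {q a b} → W b → Edge W (q , a) (q , b)

  Reach : (Fin D → Set) → Node → Node → Set
  Reach W = Star (Edge W)

  Edge-mono : ∀ {W W′} → (∀ {b} → W b → W′ b) → ∀ {μ ν} → Edge W μ ν → Edge W′ μ ν
  Edge-mono W⊆W′ (leads t e) = leads t e
  Edge-mono W⊆W′ (writes w)  = writes (W⊆W′ w)

  Reach-mono : ∀ {W W′} → (∀ {b} → W b → W′ b) → ∀ {μ ν} → Reach W μ ν → Reach W′ μ ν
  Reach-mono W⊆W′ ε*       = ε*
  Reach-mono W⊆W′ (e ◅ es) = Edge-mono W⊆W′ e ◅ Reach-mono W⊆W′ es

  Writable-mono : ∀ {P Q : Fin |Q_C| → Set} → (∀ {σ} → P σ → Q σ) → ∀ {b} → Writable P b → Writable Q b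
  Writable-mono P⊆Q (σ , σ′ , p , t) = σ , σ′ , P⊆Q p , t

  -- While the leader and the memory go around the strongly connected
  -- component of ν, arbitrarily many contributors take the transitions whose
  -- labels occur there.
  Closed : (Fin D → Set) → Node → (Fin |Q_C| → Set) → Set
  Closed W ν P = ∀ q a l σ σ′ → Reach W ν (q , a) → Reach W (q , a) ν →
    P σ → Eff l a a → δ contributor σ l σ′ ≡ true → P σ′

  Saturated : Node → (Fin |Q_C| → Set) → Set
  Saturated ν P = Closed (Writable P) ν P

  -- The least saturated superset, as an intersection; quantifying over
  -- Boolean predicates keeps it in Set.
  Saturation : Node → (Fin |Q_C| → Set) → Fin |Q_C| → Set
  Saturation ν P σ = ∀ (Q : Fin |Q_C| → Bool) →
    (∀ {x} → P x → T (Q x)) → Saturated ν (λ x → T (Q x)) → T (Q σ)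

  -- A path using values writable from the intersection is also a path for each `Q` in it. So every
  -- `Q` sees the label in its own component and is closed under the transition.
  Saturation-saturated : ∀ ν P → Saturated ν (Saturation ν P)
  Saturation-saturated ν P q a l σ σ′ to from Sσ e t Q P⊆Q satQ =
    satQ q a l σ σ′ (Reach-mono W⊆ to) (Reach-mono W⊆ from) (Sσ Q P⊆Q satQ) e t
    where
    W⊆ : ∀ {b} → Writable (Saturation ν P) b → Writable (λ x → T (Q x)) b
    W⊆ = Writable-mono λ s → s Q P⊆Q satQ

  ⊆-Saturation : ∀ {ν P σ} → P σ → Saturation ν P σ
  ⊆-Saturation p Q P⊆Q satQ = P⊆Q p

  -- A chain lists, latest first, the nodes at which the play of leader and
  -- memory enters a new strongly connected component.
  current : List Node → Node
  current []      = ν₀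
  current (ν ∷ ρ) = ν

  -- `base ρ` is what is populated when the component of the current node is entered, `stock ρ` what
  -- is populated after saturating there. The base of an extended chain is the old stock by
  -- definition.
  base stock : List Node → Fin |Q_C| → Set
  base []      σ = σ ≡ q⁰ contributor
  base (ν ∷ ρ) = Saturation (current ρ) (base ρ)
  stock ρ = Saturation (current ρ) (base ρ)

  Reachᶜ : List Node → Node → Node → Set
  Reachᶜ ρ = Reach (Writable (stock ρ))

  visited : List Node → List Node
  visited []      = ν₀ ∷ []
  visited (ν ∷ ρ) = ν ∷ visited ρ

  -- What is recorded is that the new node differs from all visited ones, not that it lies outside
  -- their components: this suffices to bound the length and avoids a negative statement about
  -- reachability.
  Chain : List Node → Set
  Chain []      = ⊤
  Chain (ν ∷ ρ) = Chain ρ × Reachᶜ ρ (current ρ) ν × All.All (ν ≢_) (visited ρ)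

  stock-mono : ∀ {ν ρ σ} → stock ρ σ → stock (ν ∷ ρ) σ
  stock-mono = ⊆-Saturation

  Reachᶜ-mono : ∀ {ν ρ μ μ′} → Reachᶜ ρ μ μ′ → Reachᶜ (ν ∷ ρ) μ μ′
  Reachᶜ-mono {ν} {ρ} = Reach-mono (Writable-mono λ {σ} → stock-mono {ν} {ρ} {σ})

  visited-reach : ∀ ρ → Chain ρ → ∀ {μ} → μ ∈ˡ visited ρ → Reachᶜ ρ μ (current ρ)
  visited-reach []      _           (here refl) = ε*
  visited-reach (ν ∷ ρ) _           (here refl) = ε*
  visited-reach (ν ∷ ρ) (v , r , _) (there μ∈)  =
    Reachᶜ-mono {ν} {ρ} (visited-reach ρ v μ∈ ◅◅ r)

  visited-unique : ∀ ρ → Chain ρ → Unique (visited ρ)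
  visited-unique []      _           = All.[] AllPairs.∷ AllPairs.[]
  visited-unique (ν ∷ ρ) (v , _ , d) = d AllPairs.∷ visited-unique ρ v

  length-visited : ∀ ρ → length (visited ρ) ≡ suc (length ρ)
  length-visited []      = refl
  length-visited (ν ∷ ρ) = cong suc (length-visited ρ)

  -- Pigeonhole on the visited nodes. As these include `ν₀`, there is one more of them than entries
  -- of the chain, and the bound is strict.
  Chain⇒short : ∀ ρ → Chain ρ → length ρ < |Q_L| * D
  Chain⇒short ρ v = subst (_≤ |Q_L| * D) (length-visited ρ)
    (Fin.injective⇒≤ {f = λ i → index (List.lookup (visited ρ) i)} λ {i} {j} eq →
      Unique⇒lookup-injective (visited-unique ρ v) i j (index-injective eq))
    where
    index : Node → Fin (|Q_L| * D)
    index (q , a) = combine q a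
    index-injective : ∀ {μ ν} → index μ ≡ index ν → μ ≡ ν
    index-injective {q , a} {q′ , a′} eq with Fin.combine-injective q a q′ a′ eq
    ... | refl , refl = refl

  Loop : List Node → Node → Set
  Loop ρ μ = Reachᶜ ρ (current ρ) μ × Reachᶜ ρ μ (current ρ)

  -- A step out of the component of the current node leads to a node not
  -- visited before, since every visited node reaches the current one. The
  -- double negation spares deciding membership in the component.
  extend : ∀ ρ μ ν → Chain ρ → Loop ρ μ → Edge (Writable (stock ρ)) μ ν →
    ¬ ¬ (∃[ ρ′ ] Chain ρ′ × Loop ρ′ ν × (∀ {σ} → stock ρ σ → stock ρ′ σ))
  extend ρ μ ν v (to , from) e none = none (ν ∷ ρ ,
      (v , to-ν , All.tabulate λ { μ′∈ refl → none (ρ , v , (to-ν , visited-reach ρ v μ′∈) , id) }) ,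
      (ε* , ε*) , λ {σ} → stock-mono {ν} {ρ} {σ})
    where
    to-ν : Reachᶜ ρ (current ρ) ν
    to-ν = to ◅◅ e ◅ ε*

  module Play (t : ℕ) where
    open Semantics (I ^^ t) renaming (read to readˢ; write to writeˢ; ε to εˢ)

    node : Config → Node
    node c = pc c zero , mem c

    Covered : Config → Set
    Covered c = ∃[ ρ ] Chain ρ × Loop ρ (node c) × (∀ i → stock ρ (pc c (suc i)))

    Effect⇒Eff : ∀ {l a b} → Effect l a b → Eff l a b
    Effect⇒Eff readˢ  = read
    Effect⇒Eff writeˢ = write
    Effect⇒Eff εˢ     = ε

    Eff⇒Effect : ∀ {l a b} → Eff l a b → Effect l a b
    Eff⇒Effect read  = readˢ
    Eff⇒Effect write = writeˢ
    Eff⇒Effect ε     = εˢ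

    Covered-initial : Covered c⁰
    Covered-initial = [] , tt , (ε* , ε*) , λ i → ⊆-Saturation {ν₀} {base []} refl

    Covered-step : ∀ {c c′} → c ⟶ c′ → Covered c → ¬ ¬ Covered c′
    Covered-step {c} {c′} s (ρ , v , loop , cov) none with _⟶_.thread s | _⟶_.transition s | _⟶_.others s
    ... | zero | tr | oth =
      extend ρ (node c) (node c′) v loop (leads tr (Effect⇒Eff (_⟶_.effect s)))
        λ (ρ′ , v′ , loop′ , ⊆′) → none (ρ′ , v′ , loop′ , λ i → ⊆′ (subst (stock ρ) (sym (oth (suc i) λ ())) (cov i)))
    ... | suc i | tr | oth = by-label tr (Effect⇒Eff (_⟶_.effect s)) loop refl
      where
      others-in : ∀ {ρ′} → (∀ {σ} → stock ρ σ → stock ρ′ σ) → stock ρ′ (pc c′ (suc i)) → ∀ j → stock ρ′ (pc c′ (suc j))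
      others-in {ρ′} ⊆′ at-i j with j Fin.≟ i
      ... | yes refl = at-i
      ... | no j≢i   = ⊆′ (subst (stock ρ) (sym (oth (suc j) λ p → j≢i (Fin.suc-injective p))) (cov j))
      finish : ∀ {ρ′} → Chain ρ′ → Loop ρ′ (pc c zero , mem c′) → (∀ {σ} → stock ρ σ → stock ρ′ σ) →
        stock ρ′ (pc c′ (suc i)) → ⊥
      finish {ρ′} v′ loop′ ⊆′ at-i = none (ρ′ , v′ ,
        subst (λ q → Loop ρ′ (q , mem c′)) (sym (oth zero λ ())) loop′ , others-in {ρ′} ⊆′ at-i)
      saturated : ∀ ρ′ → Saturated (current ρ′) (stock ρ′)
      saturated ρ′ = Saturation-saturated (current ρ′) (base ρ′)
      by-label : ∀ {l a a′} → δ contributor (pc c (suc i)) l (pc c′ (suc i)) ≡ true → Eff l a a′ →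
        Loop ρ (pc c zero , a) → mem c′ ≡ a′ → ⊥
      by-label tr read  loop refl = finish v loop id (saturated ρ _ _ _ _ _ (proj₁ loop) (proj₂ loop) (cov i) read tr)
      by-label tr ε     loop refl = finish v loop id (saturated ρ _ _ _ _ _ (proj₁ loop) (proj₂ loop) (cov i) ε tr)
      -- The write first moves the node, possibly into a new component. There the memory already
      -- holds the written value, so the same transition is one from this value to itself and falls
      -- under saturation at the new node.
      by-label tr write loop refl = extend ρ _ _ v loop (writes (_ , _ , cov i , tr))
        λ (ρ′ , v′ , loop′ , ⊆′) → finish v′ loop′ ⊆′ (saturated ρ′ _ _ _ _ _ (proj₁ loop′) (proj₂ loop′) (⊆′ (cov i)) write tr)

    Covered-steps : ∀ {c c′} → c ⟶* c′ → Covered c → ¬ ¬ Covered c′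
    Covered-steps ε*       cov none = none cov
    Covered-steps (s ◅ ss) cov none = Covered-step s cov λ cov′ → Covered-steps ss cov′ none

  Succeeds : List Node → Set
  Succeeds ρ = Chain ρ × ∃[ q ] ∃[ a ] Reachᶜ ρ (current ρ) (q , a) × q ∈ unsafe

  LCR⇒Succeeds : LCR I → ¬ ¬ (∃[ ρ ] Succeeds ρ)
  LCR⇒Succeeds (t , c , run , bad) none = Covered-steps run Covered-initial
    λ (ρ , v , loop , _) → none (ρ , v , _ , _ , proj₁ loop , bad)
    where open Play t

  -- Soundness: populating the stock with arbitrarily many contributors.

  Placement : Node → ∀ k → (Fin k → Fin |Q_C|) → Set
  Placement (q , a) k g = ∃[ t ] let open Semantics (I ^^ t) in
    ∃[ c ] (c⁰ ⟶* c) × pc c zero ≡ q × mem c ≡ a ×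
    Σ (Fin k → Fin t) λ ι → (∀ {x y} → ι x ≡ ι y → x ≡ y) × (∀ x → pc c (suc (ι x)) ≡ g x)

  -- With sufficiently many contributors, any finite number of them can be
  -- placed in states of P while leader and memory are at ν.
  Supplied : Node → (Fin |Q_C| → Set) → Set
  Supplied ν P = ∀ k (g : Fin k → Fin |Q_C|) → (∀ x → P (g x)) → Placement ν k g

  Supplied-mono : ∀ {ν} {P Q : Fin |Q_C| → Set} → (∀ σ → Q σ → P σ) → Supplied ν P → Supplied ν Q
  Supplied-mono Q⊆P S k g Qg = S k g λ x → Q⊆P (g x) (Qg x)

  Supplied-initial : Supplied ν₀ (_≡ q⁰ contributor)
  Supplied-initial k g all = k , _ , ε* , refl , refl , id , id , λ x → sym (all x)

  Supplied-unsafe : ∀ {q a P} → Supplied (q , a) P → q ∈ unsafe → LCR I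
  Supplied-unsafe S bad with S 0 (λ ()) (λ ())
  ... | t , c , run , refl , _ = t , c , run , bad

  module Move (t : ℕ) where
    open Semantics (I ^^ t) hiding (read; write; ε)

    move : ∀ {l a b σ σ′} → Eff l a b → δ contributor σ l σ′ ≡ true →
      ∀ c → mem c ≡ a → (i : Fin t) → pc c (suc i) ≡ σ →
      ∃[ c′ ] (c ⟶ c′) × pc c′ zero ≡ pc c zero × mem c′ ≡ b × pc c′ (suc i) ≡ σ′ ×
        (∀ j → j ≢ i → pc c′ (suc j) ≡ pc c (suc j))
    move {l} {a} {b} {σ} {σ′} e tr c refl i at-i =
      c′ , step , refl , refl , new-at (i Fin.≟ i) , λ j → new-off j (j Fin.≟ i)
      where
      new : (j : Fin t) → Dec (j ≡ i) → Fin |Q_C|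
      new j (yes _) = σ′
      new j (no _)  = pc c (suc j)
      new-at : ∀ d → new i d ≡ σ′
      new-at (yes _) = refl
      new-at (no z)  = ⊥-elim (z refl)
      new-off : ∀ j d → j ≢ i → new j d ≡ pc c (suc j)
      new-off j (yes p) z = ⊥-elim (z p)
      new-off j (no _)  z = refl
      c′ : Config
      c′ = ⟨ (λ { zero → pc c zero ; (suc j) → new j (j Fin.≟ i) }) , b ⟩
      step : c ⟶ c′
      step = record
        { thread = suc i
        ; transition = subst₂ (λ x y → δ contributor x l y ≡ true) (sym at-i) (sym (new-at (i Fin.≟ i))) tr
        ; effect = Play.Eff⇒Effect t e
        ; others = λ { zero _ → refl ; (suc j) z → new-off j (j Fin.≟ i) λ p → z (cong suc p) } }

  Supplied-edge : ∀ {μ ν P} → Edge (Writable P) μ ν → Supplied μ P → Supplied ν P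
  Supplied-edge {q , a} {q′ , a′} (leads tr e) S k g Pg with S k g Pg
  ... | t , c , run , refl , refl , ι , inj , at = t , c′ , run ◅◅ step ◅ ε* , refl , refl , ι , inj , at
    where
    open Semantics (I ^^ t)
    c′ : Config
    c′ = ⟨ (λ { zero → q′ ; (suc i) → pc c (suc i) }) , a′ ⟩
    step : c ⟶ c′
    step = record
      { thread = zero ; transition = tr ; effect = Play.Eff⇒Effect t e
      ; others = λ { zero z → ⊥-elim (z refl) ; (suc i) _ → refl } }
  -- One contributor more is requested in `σ`; it is spent on the write and then dropped from the
  -- placement.
  Supplied-edge (writes {b = b} (σ , σ′ , Pσ , tr)) S k g Pg
    with S (suc k) (λ { zero → σ ; (suc x) → g x }) (λ { zero → Pσ ; (suc x) → Pg x })
  ... | t , c , run , refl , refl , ι , inj , at with Move.move t write tr c refl (ι zero) (at zero)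
  ... | c′ , step , q≡ , b≡ , _ , off = t , c′ , run ◅◅ step ◅ ε* , q≡ , b≡ , ι ∘ suc ,
    Fin.suc-injective ∘ inj , λ x → trans (off (ι (suc x)) λ p → case inj p of λ ()) (at (suc x))

  Supplied-reach : ∀ {μ ν P} → Reach (Writable P) μ ν → Supplied μ P → Supplied ν P
  Supplied-reach ε*       S = S
  Supplied-reach (e ◅ es) S = Supplied-reach es (Supplied-edge e S)

  module Copycat (t : ℕ) (σ σ′ : Fin |Q_C|) (l : Label D) (a : Fin D)
                 (e : Eff l a a) (tr : δ contributor σ l σ′ ≡ true) where
    open Semantics (I ^^ t) hiding (read; write; ε)

    -- Since `l` takes the value `a` to itself, one copy's transition leaves the memory ready for
    -- the next copy's. The last component, on threads outside `ι`, is what lets the induction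
    -- append the move of `ι zero`.
    moves : ∀ k (g g′ : Fin k → Fin |Q_C|) → (∀ x → g x ≡ g′ x ⊎ (g x ≡ σ × g′ x ≡ σ′)) →
      (ι : Fin k → Fin t) → (∀ {x y} → ι x ≡ ι y → x ≡ y) →
      ∀ c → mem c ≡ a → (∀ x → pc c (suc (ι x)) ≡ g x) →
      ∃[ c′ ] (c ⟶* c′) × pc c′ zero ≡ pc c zero × mem c′ ≡ a × (∀ x → pc c′ (suc (ι x)) ≡ g′ x) ×
        (∀ j → (∀ x → j ≢ ι x) → pc c′ (suc j) ≡ pc c (suc j))
    moves zero g g′ h ι inj c at-a at = c , ε* , refl , at-a , (λ ()) , λ _ _ → refl
    moves (suc k) g g′ h ι inj c at-a at
      with moves k (g ∘ suc) (g′ ∘ suc) (h ∘ suc) (ι ∘ suc) (Fin.suc-injective ∘ inj) c at-a (at ∘ suc)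
    ... | c₁ , run₁ , q₁ , a₁ , at₁ , off₁
      with h zero | trans (off₁ (ι zero) (λ x p → case inj p of λ ())) (at zero)
    ... | inj₁ same | at₀ = c₁ , run₁ , q₁ , a₁ ,
      (λ { zero → trans at₀ same ; (suc x) → at₁ x }) , λ j z → off₁ j (z ∘ suc)
    ... | inj₂ (g≡σ , g′≡σ′) | at₀ with Move.move t e tr c₁ a₁ (ι zero) (trans at₀ g≡σ)
    ... | c₂ , step , q₂ , a₂ , at₂ , off₂ = c₂ , run₁ ◅◅ step ◅ ε* , trans q₂ q₁ , a₂ ,
      (λ { zero → trans at₂ (sym g′≡σ′)
         ; (suc x) → trans (off₂ (ι (suc x)) λ p → case inj p of λ ()) (at₁ x) }) ,
      λ j z → trans (off₂ j (z zero)) (off₁ j (z ∘ suc))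

  -- Copycats: wherever `σ′` is demanded, a copy in `σ` is requested instead, and all these copies
  -- then take the transition. The disjunction in the demand itself tells which copies have to move.
  Supplied-grow : ∀ {q a l σ σ′ P} → Eff l a a → P σ → δ contributor σ l σ′ ≡ true →
    Supplied (q , a) P → Supplied (q , a) (λ x → P x ⊎ x ≡ σ′)
  Supplied-grow {q} {a} {l} {σ} {σ′} {P} e Pσ tr S k g′ P′g′ = result (S k g Pg)
    where
    choose : ∀ {x} → P x ⊎ x ≡ σ′ → Fin |Q_C|
    choose {x} (inj₁ _) = x
    choose     (inj₂ _) = σ
    g : Fin k → Fin |Q_C|
    g x = choose (P′g′ x)
    choose-P : ∀ {x} (d : P x ⊎ x ≡ σ′) → P (choose d)
    choose-P (inj₁ p) = p
    choose-P (inj₂ _) = Pσ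
    Pg : ∀ x → P (g x)
    Pg x = choose-P (P′g′ x)
    choose-step : ∀ {x} (d : P x ⊎ x ≡ σ′) → choose d ≡ x ⊎ (choose d ≡ σ × x ≡ σ′)
    choose-step (inj₁ _) = inj₁ refl
    choose-step (inj₂ p) = inj₂ (refl , p)
    result : Placement (q , a) k g → Placement (q , a) k g′
    result (t , c , run , refl , refl , ι , inj , at)
      with Copycat.moves t σ σ′ l a e tr k g g′ (λ x → choose-step (P′g′ x)) ι inj c refl at
    ... | c′ , run′ , q≡ , a≡ , at′ , _ = t , c′ , run ◅◅ run′ , q≡ , a≡ , ι , inj , at′

-- Reasoning about conditionals and loops; counting nonzero entries.

run-cond : ∀ {p} (P : State → Set p) e c c′ s →
  (val e s ≢ 0 → P (run c s)) → (val e s ≡ 0 → P (run c′ s)) → P (run (cond e c c′) s)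
run-cond P e c c′ s then else with val e s
... | zero  = else refl
... | suc _ = then λ ()

for-inv : ∀ {p} (P : ℕ → State → Set p) x n c s → P 0 s →
  (∀ i s′ → i < vars s n → P i s′ → P (suc i) (run c (setV x i s′))) → P (vars s n) (run (for x n c) s)
for-inv P x n c s = up-inv P (vars s n)

nonzero : ℕ → ℕ
nonzero zero    = 0
nonzero (suc _) = 1

count : ℕ → (ℕ → ℕ) → ℕ
count zero    f = 0
count (suc n) f = nonzero (f n) + count n f

nonzero-mono : ∀ {m n} → (m ≢ 0 → n ≢ 0) → nonzero m ≤ nonzero n
nonzero-mono {zero}          h = z≤n
nonzero-mono {suc m} {zero}  h = ⊥-elim (h (λ ()) refl)
nonzero-mono {suc m} {suc n} h = ≤-refl

nonzero≤1 : ∀ n → nonzero n ≤ 1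
nonzero≤1 zero    = z≤n
nonzero≤1 (suc n) = ≤-refl

count-≤ : ∀ n f → count n f ≤ n
count-≤ zero    f = z≤n
count-≤ (suc n) f = +-mono-≤ (nonzero≤1 (f n)) (count-≤ n f)

count-mono : ∀ n {f g} → (∀ x → x < n → f x ≢ 0 → g x ≢ 0) → count n f ≤ count n g
count-mono zero    h = z≤n
count-mono (suc n) h = +-mono-≤ (nonzero-mono (h n ≤-refl)) (count-mono n λ x x<n → h x (m≤n⇒m≤1+n x<n))

count-strict : ∀ n {f g p} → (∀ x → x < n → f x ≢ 0 → g x ≢ 0) → p < n → f p ≡ 0 → g p ≢ 0 → count n f < count n g
count-strict (suc n) {f} {g} {p} h p<1+n fp gp with p ≟ n
... | yes refl = +-mono-≤ (strict (f p) (g p) fp gp) (count-mono n λ x x<n → h x (m≤n⇒m≤1+n x<n))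
  where
  strict : ∀ a b → a ≡ 0 → b ≢ 0 → suc (nonzero a) ≤ nonzero b
  strict zero zero    _ b≢0 = ⊥-elim (b≢0 refl)
  strict zero (suc b) _ _   = ≤-refl
... | no p≢n = subst (_≤ count (suc n) g) (+-suc (nonzero (f n)) (count n f))
  (+-mono-≤ (nonzero-mono (h n ≤-refl))
    (count-strict n (λ x x<n → h x (m≤n⇒m≤1+n x<n)) (≤∧≢⇒< (≤-pred p<1+n) p≢n) fp gp))

count-full : ∀ n {f} → n ≤ count n f → ∀ x → x < n → f x ≢ 0
count-full n {f} full x x<n fx≡0 = <⇒≱ (count-strict n {f} {λ _ → 1} (λ _ _ _ ()) x<n fx≡0 λ ())
  (≤-trans (count-≤ n (λ _ → 1)) full)

-- The rule behind the completeness of loops that set marks: the relevant round sets the mark, later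
-- rounds cannot erase it, and `R` carries the facts that the decisive round relies on.
for-hit : ∀ {r q} (R : State → Set r) (Q : State → Set q) x n c s i → i < vars s n → R s →
  (∀ j s′ → j < vars s n → R s′ → R (run c (setV x j s′))) →
  (∀ s′ → R s′ → Q (run c (setV x i s′))) →
  (∀ j s′ → j < vars s n → R s′ → Q s′ → Q (run c (setV x j s′))) →
  Q (run (for x n c) s)
for-hit R Q x n c s i i<n Rs keep hit hold =
  proj₂ (up-inv (λ j s′ → R s′ × (i < j → Q s′)) (vars s n) (Rs , λ ())
    λ j s′ j<n (Rs′ , Qs′) → keep j s′ j<n Rs′ , λ i<1+j → case i ≟ j of λ
      { (yes refl) → hit s′ Rs′
      ; (no i≢j)   → hold j s′ j<n Rs′ (Qs′ (≤∧≢⇒< (≤-pred i<1+j) i≢j)) }) i<n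

-- Closure of a marked set under the edges of a graph.

clear : (k : ℕ) {k<16 : T (k <ᵇ 16)} → ℕ → Com
clear k {k<16} n = for 18 n (put k {k<16} (var 18) (lit 0))

putA-other : ∀ j i v s {j′} i′ → j ≢ j′ → arrs (putA j i v s) j′ i′ ≡ arrs s j′ i′
putA-other j i v s i′ j≢j′ rewrite ≢⇒≡ᵇ j≢j′ = refl

putA-same : ∀ j i v s i′ → arrs (putA j i v s) j i′ ≡ (arrs s j [ i ↦ v ]) i′
putA-same j i v s i′ rewrite ≡ᵇ-refl j = refl

cleared : ∀ k {k<16} n s x → x < vars s n → arrs (run (clear k {k<16} n) s) k x ≡ 0
cleared k {k<16} n s = for-inv (λ i s → ∀ x → x < i → arrs s k x ≡ 0) 18 n (put k {k<16} (var 18) (lit 0)) s (λ _ ())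
  λ i s _ h x x<1+i → trans (putA-same k i 0 (setV 18 i s) x) (case i ≟ x of λ
    { (yes refl) → update-same (arrs s k) i
    ; (no i≢x)   → trans (update-other (arrs s k) i≢x) (h x (≤∧≢⇒< (≤-pred x<1+i) (≢-sym i≢x))) })

-- Marks in array k everything reachable from what is marked there, where test
-- sets variable 22 to a nonzero value if there is an edge from variable 20 to
-- variable 19. Array 6 holds the processed numbers; each round processes one
-- more, so that the number of tests is quadratic.
closureScan closureRound closure : (k : ℕ) {k<16 : T (k <ᵇ 16)} → ℕ → Com → Com
closureScan k {k<16} n test =
  set 21 (lit 0) ⍮
  for 18 n (cond (arr 6 (var 18)) nop
    (cond (arr k {k<16} (var 18)) (set 21 (lit 1) ⍮ set 20 (var 18)) nop))
closureRound k {k<16} n test =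
  closureScan k {k<16} n test ⍮
  cond (var 21)
    (put 6 (var 20) (lit 1) ⍮ for 19 n (test ⍮ cond (var 22) (put k {k<16} (var 19) (lit 1)) nop))
    nop
closure k {k<16} n test =
  clear 6 n ⍮ for 23 n (closureRound k {k<16} n test)

module Closure
  (k : ℕ) (k<16 : T (k <ᵇ 16)) (k≢6 : k ≢ 6) (nv : ℕ) (nv<16 : T (nv <ᵇ 16)) (test : Com)
  (test-arrs : ∀ j → writesA j test ≡ false)
  (test-params : ∀ y → T (y <ᵇ 16) → writesV y test ≡ false)
  (test-19 : writesV 19 test ≡ false) (test-20 : writesV 20 test ≡ false)
  (s₀ : State) (E : ℕ → ℕ → Set)
  where

  n : ℕ
  n = vars s₀ nv

  -- Apart from working variables, only the marks and the list of processed numbers change during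
  -- the computation. The test therefore decides the same relation `E` at every moment.
  record Similar (s : State) : Set where
    constructor sim
    field
      same-params : ∀ y → T (y <ᵇ 16) → vars s y ≡ vars s₀ y
      same-arrs   : ∀ j → j ≢ k → j ≢ 6 → ∀ i → arrs s j i ≡ arrs s₀ j i

  open Similar

  Marked Done : State → ℕ → Set
  Marked s x = arrs s k x ≢ 0
  Done   s x = arrs s 6 x ≢ 0

  similar-setV : ∀ x v {s} → T (15 <ᵇ x) → Similar s → Similar (setV x v s)
  similar-setV x v {s} p S .same-params y y<16 =
    trans (update-other (vars s) (params≢ {x} {y} p y<16)) (same-params S y y<16)
  similar-setV x v p S .same-arrs = same-arrs S

  similar-putk : ∀ i v {s} → Similar s → Similar (putA k i v s)
  similar-putk i v S .same-params = same-params S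
  similar-putk i v {s} S .same-arrs j j≢k j≢6 i′ =
    trans (putA-other k i v s i′ (≢-sym j≢k)) (same-arrs S j j≢k j≢6 i′)

  similar-put6 : ∀ i v {s} → Similar s → Similar (putA 6 i v s)
  similar-put6 i v S .same-params = same-params S
  similar-put6 i v {s} S .same-arrs j j≢k j≢6 i′ =
    trans (putA-other 6 i v s i′ (≢-sym j≢6)) (same-arrs S j j≢k j≢6 i′)

  similar-test : ∀ {s} → Similar s → Similar (run test s)
  similar-test {s} S .same-params y y<16 =
    trans (vars-frame test s (test-params y y<16)) (same-params S y y<16)
  similar-test {s} S .same-arrs j j≢k j≢6 i =
    trans (arrs-frame test s (test-arrs j) i) (same-arrs S j j≢k j≢6 i)

  -- `J` is the soundness property of the marked set, left abstract because it has three uses: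
  -- marked nodes are reachable, marked contributor states can be supplied, and the trivial property
  -- when only growth and closedness are wanted. Antitonicity allows passing to the marks actually
  -- present in an array.
  module Correct
    (test-sound : ∀ s → Similar s → vars s 20 < n → vars s 19 < n →
      vars (run test s) 22 ≢ 0 → E (vars s 20) (vars s 19))
    (test-complete : ∀ s → Similar s → vars s 20 < n → vars s 19 < n →
      E (vars s 20) (vars s 19) → vars (run test s) 22 ≢ 0)
    (J : (ℕ → Set) → Set)
    (J-antitone : ∀ {P Q : ℕ → Set} → (∀ x → Q x → P x) → J P → J Q)
    (J-grow : ∀ {P x y} → x < n → y < n → J P → P x → E x y → J (λ z → P z ⊎ z ≡ y))
    (J₀ : J (Marked s₀))
    where

    record Inv (z : ℕ) (s : State) : Set where
      constructor inv
      field
        similar  : Similar s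
        grows    : ∀ x → Marked s₀ x → Marked s x
        J-marked : J (Marked s)
        closed   : ∀ x y → x < n → y < n → Done s x → E x y → Marked s y
        progress : (∀ x → x < n → Marked s x → Done s x) ⊎ z ≤ count n (arrs s 6)

    open Inv

    record Scanned (s : State) (i : ℕ) (s′ : State) : Set where
      field
        similar : Similar s′
        same    : ∀ j x → arrs s′ j x ≡ arrs s j x
        found   : (vars s′ 21 ≡ 0 × (∀ x → x < i → Marked s x → Done s x)) ⊎
                  (vars s′ 21 ≢ 0 × vars s′ 20 < n × Marked s (vars s′ 20) × arrs s 6 (vars s′ 20) ≡ 0)

    n≡ : ∀ {s} → Similar s → vars s nv ≡ n
    n≡ S = same-params S nv nv<16

    scan : ∀ s → Similar s → Scanned s n (run (closureScan k {k<16} nv test) s)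
    scan s S = subst (λ m → Scanned s m (run loop s₁)) (n≡ S₁)
      (for-inv (Scanned s) 18 nv body s₁
        (record { similar = S₁ ; same = λ _ _ → refl ; found = inj₁ (refl , λ _ ()) }) step)
      where
      s₁ = setV 21 0 s
      S₁ : Similar s₁
      S₁ = similar-setV 21 0 {s} tt S
      look = cond (arr k {k<16} (var 18)) (set 21 (lit 1) ⍮ set 20 (var 18)) nop
      body = cond (arr 6 (var 18)) nop look
      loop = for 18 nv body
      step : ∀ i s′ → i < vars s₁ nv → Scanned s i s′ → Scanned s (suc i) (run body (setV 18 i s′))
      step i s′ i<n R = run-cond (Scanned s (suc i)) (arr 6 (var 18)) nop look (setV 18 i s′)
          (λ done → keep λ _ → subst (_≢ 0) (R.same 6 i) done)
          λ todo → run-cond (Scanned s (suc i)) (arr k {k<16} (var 18)) (set 21 (lit 1) ⍮ set 20 (var 18)) nop (setV 18 i s′)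
            (λ marked → record
              { similar = similar-setV 20 i {setV 21 1 (setV 18 i s′)} tt (similar-setV 21 1 {setV 18 i s′} tt (similar-setV 18 i {s′} tt R.similar))
              ; same = R.same
              ; found = inj₂ ((λ ()) , subst (i <_) (n≡ S₁) i<n , subst (_≢ 0) (R.same k i) marked , trans (sym (R.same 6 i)) todo) })
            λ unmarked → keep λ marked → ⊥-elim (marked (trans (sym (R.same k i)) unmarked))
        where
        module R = Scanned R
        keep : (Marked s i → Done s i) → Scanned s (suc i) (setV 18 i s′)
        keep h = record
          { similar = similar-setV 18 i {s′} tt R.similar
          ; same = R.same
          ; found = case R.found of λ
              { (inj₁ (f≡0 , all)) → inj₁ (f≡0 , λ x x<1+i → case x ≟ i of λ
                  { (yes refl) → h
                  ; (no x≢i)   → all x (≤∧≢⇒< (≤-pred x<1+i) x≢i) })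
              ; (inj₂ r) → inj₂ r } }

    record Processing (s : State) (p i : ℕ) (s′ : State) : Set where
      field
        similar  : Similar s′
        at-p     : vars s′ 20 ≡ p
        done     : ∀ x → arrs s′ 6 x ≡ arrs s 6 x
        grows    : ∀ x → Marked s x → Marked s′ x
        J-marked : J (Marked s′)
        edges    : ∀ y → y < i → E p y → Marked s′ y

    Marked-put : ∀ s y x → Marked (putA k y 1 s) x → Marked s x ⊎ x ≡ y
    Marked-put s y x m with x ≟ y
    ... | yes x≡y = inj₂ x≡y
    ... | no x≢y  = inj₁ (subst (_≢ 0) (trans (putA-same k y 1 s x) (update-other (arrs s k) (≢-sym x≢y))) m)

    put-Marked : ∀ s y x → Marked s x ⊎ x ≡ y → Marked (putA k y 1 s) x
    put-Marked s y x d with x ≟ y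
    ... | yes refl = subst (_≢ 0) (sym (trans (putA-same k y 1 s x) (update-same (arrs s k) x))) λ ()
    put-Marked s y x (inj₁ m)   | no x≢y = subst (_≢ 0) (sym (trans (putA-same k y 1 s x) (update-other (arrs s k) (≢-sym x≢y)))) m
    put-Marked s y x (inj₂ x≡y) | no x≢y = ⊥-elim (x≢y x≡y)

    process : ∀ s p → Similar s → vars s 20 ≡ p → p < n → Marked s p → J (Marked s) →
      Processing s p n (run (for 19 nv (test ⍮ cond (var 22) (put k {k<16} (var 19) (lit 1)) nop)) s)
    process s p S at-p p<n marked-p J-s =
      subst (λ m → Processing s p m (run (for 19 nv body) s)) (n≡ S)
        (for-inv (Processing s p) 19 nv body s
          (record { similar = S ; at-p = at-p ; done = λ _ → refl ; grows = λ _ → id ; J-marked = J-s ; edges = λ _ () })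
          step)
      where
      body = test ⍮ cond (var 22) (put k {k<16} (var 19) (lit 1)) nop
      step : ∀ i s′ → i < vars s nv → Processing s p i s′ → Processing s p (suc i) (run body (setV 19 i s′))
      step i s′ i<n R = run-cond (Processing s p (suc i)) (var 22) (put k {k<16} (var 19) (lit 1)) nop s₂
          (λ edge → subst (λ y → Processing s p (suc i) (putA k y 1 s₂)) (sym at-i) (record
            { similar = similar-putk i 1 S₂
            ; at-p = at-p₂
            ; done = λ x → trans (putA-other k i 1 s₂ x k≢6) (done₂ x)
            ; grows = λ x m → put-Marked s₂ i x (inj₁ (marks x (R.grows x m)))
            ; J-marked = J-antitone (Marked-put s₂ i) (J-grow p<n i<n′ J₂ (marks p (R.grows p marked-p)) (sound edge))
            ; edges = λ y y<1+i Epy → case y ≟ i of λ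
                { (yes y≡i) → put-Marked s₂ i y (inj₂ y≡i)
                ; (no y≢i)  → put-Marked s₂ i y (inj₁ (marks y (R.edges y (≤∧≢⇒< (≤-pred y<1+i) y≢i) Epy))) } }))
          λ no-edge → record
            { similar = S₂
            ; at-p = at-p₂
            ; done = done₂
            ; grows = λ x m → marks x (R.grows x m)
            ; J-marked = J₂
            ; edges = λ y y<1+i Epy → case y ≟ i of λ
                { (yes refl) → ⊥-elim (complete Epy no-edge)
                ; (no y≢i)  → marks y (R.edges y (≤∧≢⇒< (≤-pred y<1+i) y≢i) Epy) } }
        where
        module R = Processing R
        s₁ = setV 19 i s′
        s₂ = run test s₁
        S₁ : Similar s₁
        S₁ = similar-setV 19 i {s′} tt R.similar
        S₂ : Similar s₂
        S₂ = similar-test S₁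
        i<n′ : i < n
        i<n′ = subst (i <_) (n≡ S) i<n
        at-i : vars s₂ 19 ≡ i
        at-i = vars-frame test s₁ test-19
        at-p₂ : vars s₂ 20 ≡ p
        at-p₂ = trans (vars-frame test s₁ test-20) R.at-p
        done₂ : ∀ x → arrs s₂ 6 x ≡ arrs s 6 x
        done₂ x = trans (arrs-frame test s₁ (test-arrs 6) x) (R.done x)
        marks : ∀ x → Marked s′ x → Marked s₂ x
        marks x = subst (_≢ 0) (sym (arrs-frame test s₁ (test-arrs k) x))
        J₂ : J (Marked s₂)
        J₂ = J-antitone (λ x → subst (_≢ 0) (arrs-frame test s₁ (test-arrs k) x)) R.J-marked
        sound : vars s₂ 22 ≢ 0 → E p i
        sound e = subst (λ q → E q i) R.at-p
          (test-sound s₁ S₁ (subst (_< n) (sym R.at-p) p<n) i<n′ e)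
        complete : E p i → vars s₂ 22 ≢ 0
        complete e = test-complete s₁ S₁ (subst (_< n) (sym R.at-p) p<n) i<n′ (subst (λ q → E q i) (sym R.at-p) e)

    round : ∀ z s → Inv z s → Inv (suc z) (run (closureRound k {k<16} nv test) s)
    round z s V = run-cond (Inv (suc z)) (var 21) pick nop s₁ process-one stop
      where
      s₁ = run (closureScan k {k<16} nv test) s
      loop = for 19 nv (test ⍮ cond (var 22) (put k {k<16} (var 19) (lit 1)) nop)
      pick = put 6 (var 20) (lit 1) ⍮ loop
      module R = Scanned (scan s (similar V))
      back : ∀ {x} → Marked s₁ x → Marked s x
      back = subst (_≢ 0) (R.same k _)
      forth : ∀ {x} → Marked s x → Marked s₁ x
      forth = subst (_≢ 0) (sym (R.same k _))
      stop : vars s₁ 21 ≡ 0 → Inv (suc z) s₁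
      stop f≡0 = inv R.similar (λ x m → forth (grows V x m)) (J-antitone (λ _ → back) (J-marked V))
        (λ x y x<n y<n d e → forth (closed V x y x<n y<n (subst (_≢ 0) (R.same 6 x) d) e))
        (inj₁ λ x x<n m → case R.found of λ
          { (inj₁ (_ , all))   → subst (_≢ 0) (sym (R.same 6 x)) (all x x<n (back m))
          ; (inj₂ (f≢0 , _)) → ⊥-elim (f≢0 f≡0) })
      process-one : vars s₁ 21 ≢ 0 → Inv (suc z) (run pick s₁)
      process-one f≢0 = case R.found of λ
        { (inj₁ (f≡0 , _)) → ⊥-elim (f≢0 f≡0)
        ; (inj₂ (_ , p<n , marked , todo)) → go p<n marked todo }
        where
        p = vars s₁ 20
        s₂ = putA 6 p 1 s₁
        s₃ = run loop s₂
        same-k : ∀ x → arrs s₂ k x ≡ arrs s k x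
        same-k x = trans (putA-other 6 p 1 s₁ x (≢-sym k≢6)) (R.same k x)
        go : p < n → Marked s p → arrs s 6 p ≡ 0 → Inv (suc z) s₃
        go p<n marked todo = inv Q.similar (λ x m → keep (grows V x m)) Q.J-marked closed′ progress′
          where
          module Q = Processing (process s₂ p (similar-put6 p 1 R.similar) refl p<n
            (subst (_≢ 0) (sym (same-k p)) marked) (J-antitone (λ x → subst (_≢ 0) (same-k x)) (J-marked V)))
          keep : ∀ {x} → Marked s x → Marked s₃ x
          keep {x} m = Q.grows x (subst (_≢ 0) (sym (same-k x)) m)
          done-p : Done s₃ p
          done-p = subst (_≢ 0) (sym (trans (Q.done p) (update-same (arrs s₁ 6) p))) λ ()
          done-other : ∀ {x} → x ≢ p → arrs s₃ 6 x ≡ arrs s 6 x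
          done-other {x} x≢p = trans (Q.done x) (trans (update-other (arrs s₁ 6) (≢-sym x≢p)) (R.same 6 x))
          closed′ : ∀ x y → x < n → y < n → Done s₃ x → E x y → Marked s₃ y
          closed′ x y x<n y<n d e with x ≟ p
          ... | yes refl = Q.edges y y<n e
          ... | no x≢p   = keep (closed V x y x<n y<n (subst (_≢ 0) (done-other x≢p) d) e)
          done-grows : ∀ x → x < n → Done s x → Done s₃ x
          done-grows x _ d with x ≟ p
          ... | yes refl = done-p
          ... | no x≢p   = subst (_≢ 0) (sym (done-other x≢p)) d
          progress′ : (∀ x → x < n → Marked s₃ x → Done s₃ x) ⊎ suc z ≤ count n (arrs s₃ 6)
          progress′ with progress V
          ... | inj₁ all = ⊥-elim (all p p<n marked todo)
          ... | inj₂ z≤  = inj₂ (≤-trans (s≤s z≤) (count-strict n done-grows p<n todo done-p))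

    initial-inv : Inv 0 (run (clear 6 nv) s₀)
    initial-inv = inv
      (sim (λ y y<16 → vars-frame init s₀ (≢⇒≡ᵇ′ y y<16))
           (λ j j≢k j≢6 i → arrs-frame init s₀ (≢⇒≡ᵇ (≢-sym j≢6)) i))
      (λ x → subst (_≢ 0) (sym (same x))) (J-antitone (λ x → subst (_≢ 0) (same x)) J₀)
      (λ x y x<n y<n d e → ⊥-elim (d (cleared 6 nv s₀ x x<n))) (inj₂ z≤n)
      where
      init = clear 6 nv
      ≢⇒≡ᵇ′ : ∀ y → T (y <ᵇ 16) → writesV y init ≡ false
      ≢⇒≡ᵇ′ y y<16 rewrite ≢⇒≡ᵇ {18} {y} (params≢ {18} {y} tt y<16) = refl
      same : ∀ x → arrs (run init s₀) k x ≡ arrs s₀ k x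
      same = arrs-frame init s₀ (≢⇒≡ᵇ (≢-sym k≢6))

    final : Inv n (run (closure k {k<16} nv test) s₀)
    final = subst (λ m → Inv m (run (closure k {k<16} nv test) s₀)) (n≡ (similar initial-inv))
      (for-inv Inv 23 nv (closureRound k {k<16} nv test) _ initial-inv
        λ i s _ V → round i (setV 23 i s) (inv (similar-setV 23 i {s} tt (similar V)) (grows V) (J-marked V) (closed V) (progress V)))

    -- Either some round found nothing left to process, or each of the `n` rounds processed a new
    -- number, and then all numbers below `n` have been processed.
    closed-below : ∀ x y → x < n → y < n → Marked (run (closure k {k<16} nv test) s₀) x → E x y →
      Marked (run (closure k {k<16} nv test) s₀) y
    closed-below x y x<n y<n m e with progress final
    ... | inj₁ all  = closed final x y x<n y<n (all x x<n m) e
    ... | inj₂ full = closed final x y x<n y<n (count-full n full x x<n) e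

-- The encoding of instances

data At {A : Set} : List A → ℕ → A → Set where
  here  : ∀ {x xs} → At (x ∷ xs) 0 x
  there : ∀ {x y xs p} → At xs p x → At (y ∷ xs) (suc p) x

At⇒contents : ∀ {xs p n} → At xs p n → contents xs p ≡ n
At⇒contents here      = refl
At⇒contents (there a) = At⇒contents a

At-< : ∀ {A : Set} {xs : List A} {p x} → At xs p x → p < length xs
At-< here      = s≤s z≤n
At-< (there a) = s≤s (At-< a)

At-map : ∀ {A B : Set} (f : A → B) {xs p x} → At xs p x → At (map f xs) p (f x)
At-map f here      = here
At-map f (there a) = there (At-map f a)

At-++ˡ : ∀ {A : Set} {xs ys : List A} {p x} → At xs p x → At (xs ++ ys) p x
At-++ˡ here      = here
At-++ˡ (there a) = there (At-++ˡ a)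

At-++ʳ : ∀ {A : Set} (xs : List A) {ys p x} → At ys p x → At (xs ++ ys) (length xs + p) x
At-++ʳ []       a = a
At-++ʳ (_ ∷ xs) a = there (At-++ʳ xs a)

At-tabulate : ∀ {A : Set} {n} (f : Fin n → A) i → At (tabulate f) (toℕ i) (f i)
At-tabulate f zero    = here
At-tabulate f (suc i) = there (At-tabulate (f ∘ suc) i)

At-allFin : ∀ {n} (i : Fin n) → At (allFin n) (toℕ i) i
At-allFin = At-tabulate id

At-toList : ∀ {A : Set} {n} (v : Vec.Vec A n) i → At (Vec.toList v) (toℕ i) (Vec.lookup v i)
At-toList (x Vec.∷ v) zero    = here
At-toList (x Vec.∷ v) (suc i) = there (At-toList v i)

At-concatMap : ∀ {A B : Set} (f : A → List B) m → (∀ x → length (f x) ≡ m) →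
  ∀ {xs p x j y} → At xs p x → At (f x) j y → At (concatMap f xs) (p * m + j) y
At-concatMap f m len here b = At-++ˡ b
At-concatMap f m len {j = j} {y = y} (there {y = z} {xs} {p} a) b =
  subst (λ i → At (f z ++ concatMap f xs) i y) (trans (cong (_+ (p * m + j)) (len z)) (sym (+-assoc m (p * m) j)))
    (At-++ʳ (f z) (At-concatMap f m len a b))

length-concatMap : ∀ {A B : Set} (f : A → List B) m → (∀ x → length (f x) ≡ m) →
  ∀ xs → length (concatMap f xs) ≡ length xs * m
length-concatMap f m len []       = refl
length-concatMap f m len (x ∷ xs) =
  trans (List.length-++ (f x)) (cong₂ _+_ (len x) (length-concatMap f m len xs))

length-map-allFin : ∀ {A : Set} {n} (f : Fin n → A) → length (map f (allFin n)) ≡ n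
length-map-allFin {n = n} f = trans (List.length-map f (allFin n)) (List.length-tabulate id)

labelCount : ℕ → ℕ
labelCount D = suc (D + D)

labelIndex : ∀ {D} → Label D → ℕ
labelIndex nothing           = 0
labelIndex (just (wr a))     = suc (toℕ a)
labelIndex {D} (just (rd a)) = suc (D + toℕ a)

At-labels : ∀ {D} (l : Label D) → At (labels D) (labelIndex l) l
At-labels nothing           = here
At-labels (just (wr a))     = there (At-++ˡ (At-map _ (At-allFin a)))
At-labels {D} (just (rd a)) = there (subst (λ n → At (writings ++ readings) (n + toℕ a) (just (rd a)))
    (length-map-allFin {n = D} (λ a → just (wr a)))
    (At-++ʳ writings (At-map (λ a → just (rd a)) (At-allFin a))))
  where
  writings readings : List (Label D)
  writings = map (λ a → just (wr a)) (allFin D)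
  readings = map (λ a → just (rd a)) (allFin D)

length-labels : ∀ D → length (labels D) ≡ labelCount D
length-labels D = cong suc (trans (List.length-++ (map (λ a → just (wr a)) (allFin D)))
  (cong₂ _+_ (length-map-allFin {n = D} (λ a → just (wr a))) (length-map-allFin {n = D} (λ a → just (rd a)))))

module Table {D} (P : Thread D) where

  targets : Fin (states P) → Label D → List ℕ
  targets q l = map (λ q′ → bit (δ P q l q′)) (allFin (states P))

  length-targets : ∀ q l → length (targets q l) ≡ states P
  length-targets q l = length-map-allFin _

  length-row : ∀ q → length (concatMap (targets q) (labels D)) ≡ labelCount D * states P
  length-row q = trans (length-concatMap (targets q) (states P) (length-targets q) (labels D))
    (cong (_* states P) (length-labels D))

  length-table : length (table P) ≡ states P * (labelCount D * states P)
  length-table = trans (length-concatMap _ (labelCount D * states P) length-row (allFin (states P)))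
    (cong (_* (labelCount D * states P)) (List.length-tabulate {n = states P} id))

  At-table : ∀ q l q′ →
    At (table P) (toℕ q * (labelCount D * states P) + (labelIndex l * states P + toℕ q′)) (bit (δ P q l q′))
  At-table q l q′ = At-concatMap _ (labelCount D * states P) length-row (At-allFin q)
    (At-concatMap (targets q) (states P) (length-targets q) (At-labels l) (At-map _ (At-allFin q′)))

module Encoding (I : Instance) where
  open Instance I

  unsafeAt leaderAt contributorAt : ℕ
  unsafeAt      = 6
  leaderAt      = 6 + |Q_L|
  contributorAt = leaderAt + |Q_L| * (labelCount D * |Q_L|)

  length-unsafe : length (map bit (Vec.toList unsafe)) ≡ |Q_L|
  length-unsafe = trans (List.length-map bit (Vec.toList unsafe)) (Vec.length-toList unsafe)

  At-unsafe : ∀ q → At (encode I) (unsafeAt + toℕ q) (bit (Vec.lookup unsafe q))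
  At-unsafe q = there (there (there (there (there (there (At-++ˡ (At-map bit (At-toList unsafe q))))))))

  At-tables : ∀ {p n} → At (table leader ++ table contributor) p n → At (encode I) (leaderAt + p) n
  At-tables {p} {n} a = there (there (there (there (there (there
    (subst (λ m → At (map bit (Vec.toList unsafe) ++ table leader ++ table contributor) (m + p) n) length-unsafe
      (At-++ʳ (map bit (Vec.toList unsafe)) a)))))))

  At-leader : ∀ q l q′ → At (encode I)
    (leaderAt + (toℕ q * (labelCount D * |Q_L|) + (labelIndex l * |Q_L| + toℕ q′))) (bit (δ leader q l q′))
  At-leader q l q′ = At-tables (At-++ˡ (Table.At-table leader q l q′))

  At-contributor : ∀ q l q′ → At (encode I)
    (contributorAt + (toℕ q * (labelCount D * |Q_C|) + (labelIndex l * |Q_C| + toℕ q′))) (bit (δ contributor q l q′))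
  At-contributor q l q′ = subst (λ j → At (encode I) j (bit (δ contributor q l q′))) (sym (+-assoc leaderAt _ i))
    (subst (λ m → At (encode I) (leaderAt + (m + i)) (bit (δ contributor q l q′))) (Table.length-table leader)
      (At-tables (At-++ʳ (table leader) (Table.At-table contributor q l q′))))
    where
    i = toℕ q * (labelCount D * |Q_C|) + (labelIndex l * |Q_C| + toℕ q′)

  length-encode : length (encode I) ≡ contributorAt + |Q_C| * (labelCount D * |Q_C|)
  length-encode = trans (cong (6 +_) (trans (List.length-++ (map bit (Vec.toList unsafe)))
      (cong₂ _+_ length-unsafe (trans (List.length-++ (table leader))
        (cong₂ _+_ (Table.length-table leader) (Table.length-table contributor))))))
    (sym (trans (+-assoc leaderAt _ _) (+-assoc 6 |Q_L| _)))

-- Bits and arithmetic tests.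

as-fin : ∀ {i n} → i < n → ∃[ x ] toℕ {n} x ≡ i
as-fin i<n = fromℕ< i<n , Fin.toℕ-fromℕ< i<n

bit-sound : ∀ {b n} → n ≡ bit b → n ≢ 0 → b ≡ true
bit-sound {true}  _  _   = refl
bit-sound {false} eq n≢0 = ⊥-elim (n≢0 eq)

bit-complete : ∀ {b n} → n ≡ bit b → b ≡ true → n ≢ 0
bit-complete refl refl ()

+-≢0 : ∀ m {n} → m + n ≢ 0 → m ≢ 0 ⊎ n ≢ 0
+-≢0 zero    h = inj₂ h
+-≢0 (suc m) h = inj₁ λ ()

≢0-+ˡ : ∀ {m n} → m ≢ 0 → m + n ≢ 0
≢0-+ˡ {zero}  h = ⊥-elim (h refl)
≢0-+ˡ {suc m} h = λ ()

≢0-+ʳ : ∀ m {n} → n ≢ 0 → m + n ≢ 0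
≢0-+ʳ zero    h = h
≢0-+ʳ (suc m) h = λ ()

-- The absolute difference, which serves as the test for equality: it vanishes exactly on equal
-- arguments.
distance : ℕ → ℕ → ℕ
distance m n = (m ∸ n) + (n ∸ m)

distance-refl : ∀ n → distance n n ≡ 0
distance-refl n rewrite n∸n≡0 n = refl

distance≡0 : ∀ m n → distance m n ≡ 0 → m ≡ n
distance≡0 m n d = ≤-antisym (m∸n≡0⇒m≤n (m+n≡0⇒m≡0 (m ∸ n) d)) (m∸n≡0⇒m≤n (m+n≡0⇒n≡0 (m ∸ n) d))

-- A bit from which a positive number is subtracted vanishes, so that
-- subtraction expresses conjunctions.
masked-sound : ∀ {b n} d → n ≡ bit b → n ∸ d ≢ 0 → b ≡ true × d ≡ 0
masked-sound {true}  zero    _    _ = refl , refl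
masked-sound {false} zero    refl h = ⊥-elim (h refl)
masked-sound {true}  (suc d) refl h = ⊥-elim (h (0∸n≡0 d))
masked-sound {false} (suc d) refl h = ⊥-elim (h refl)

-- `1 ∸ w` is the negation of `w`, so the sum is zero exactly if `d` is zero and `w` is not; the
-- outer subtraction negates once more.
guarded-sound : ∀ d w → 1 ∸ (d + (1 ∸ w)) ≢ 0 → d ≡ 0 × w ≢ 0
guarded-sound zero    zero    h = ⊥-elim (h refl)
guarded-sound zero    (suc w) h = refl , λ ()
guarded-sound (suc d) w       h = ⊥-elim (h (0∸n≡0 (d + (1 ∸ w))))

guarded-complete : ∀ d w → d ≡ 0 → w ≢ 0 → 1 ∸ (d + (1 ∸ w)) ≢ 0
guarded-complete zero zero    _ h = ⊥-elim (h refl)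
guarded-complete zero (suc w) _ h = λ p → contradiction (trans (sym (cong (1 ∸_) (0∸n≡0 w))) p) λ ()

-- Tests for edges and contributor moves on the encoded instance.

readsOnly : Com → Bool
readsOnly nop           = true
readsOnly (set x e)     = true
readsOnly (put k e e′)  = k <ᵇ 8
readsOnly (c ⍮ c′)      = readsOnly c ∧ readsOnly c′
readsOnly (cond e c c′) = readsOnly c ∧ readsOnly c′
readsOnly (for x n c)   = readsOnly c

readsOnly⇒¬writesA : ∀ c j → T (readsOnly c) → T (7 <ᵇ j) → writesA j c ≡ false
readsOnly⇒¬writesA nop j p q = refl
readsOnly⇒¬writesA (set x e) j p q = refl
readsOnly⇒¬writesA (put k e e′) j p q =
  ≢⇒≡ᵇ {k} {j} (λ { refl → <⇒≱ (<ᵇ⇒< k 8 p) (<ᵇ⇒< 7 k q) })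
readsOnly⇒¬writesA (c ⍮ c′) j p q
  rewrite readsOnly⇒¬writesA c j (T-∧ˡ p) q = readsOnly⇒¬writesA c′ j (T-∧ʳ {readsOnly c} p) q
readsOnly⇒¬writesA (cond e c c′) j p q
  rewrite readsOnly⇒¬writesA c j (T-∧ˡ p) q = readsOnly⇒¬writesA c′ j (T-∧ʳ {readsOnly c} p) q
readsOnly⇒¬writesA (for x n c) j p q = readsOnly⇒¬writesA c j p q

-- Below, variables 1 to 15 are constants: 1 = D, 2 = L, 3 = C, 4 = L D,
-- 5 = 2 D + 1, 6 = (L D) ^ (L D), 10 = address of the unsafe states, 13 = initial
-- contributor state, 14 = initial node. The current node is in variable 17
-- and the answer in variable 16. Working arrays: 0 and 1 = nodes reachable
-- from and reaching the current node, 2 = populated contributor states,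
-- 3 = writable values, 4 = values in the component, 5 = word. Constant arrays:
-- 8 = input, 9 and 10 = leader state and value of a node, 11 and 13 = start of
-- the rows of a leader and contributor state, 12 and 14 = offset of a label.
edgeTest forwardTest backwardTest contributorTest : Com
edgeTest =
  set 26 (arr 9 (var 24)) ⍮ set 27 (arr 10 (var 24)) ⍮
  set 28 (arr 9 (var 25)) ⍮ set 29 (arr 10 (var 25)) ⍮
  set 30 (arr 11 (var 26)) ⍮
  set 31 ((var 27 ⊟ var 29) ⊞ (var 29 ⊟ var 27)) ⍮
  set 22 (arr 8 (var 30 ⊞ (arr 12 (lit 1 ⊞ var 29) ⊞ var 28)) ⊞
    ((arr 8 (var 30 ⊞ (arr 12 (lit 0) ⊞ var 28)) ⊟ var 31) ⊞
    ((arr 8 (var 30 ⊞ (arr 12 (lit 1 ⊞ (var 1 ⊞ var 29)) ⊞ var 28)) ⊟ var 31) ⊞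
    (lit 1 ⊟ (((var 26 ⊟ var 28) ⊞ (var 28 ⊟ var 26)) ⊞ (lit 1 ⊟ arr 3 (var 29)))))))
forwardTest  = set 24 (var 20) ⍮ set 25 (var 19) ⍮ edgeTest
backwardTest = set 24 (var 19) ⍮ set 25 (var 20) ⍮ edgeTest

contributorTest =
  set 24 (arr 13 (var 20)) ⍮
  set 22 (arr 8 (var 24 ⊞ (arr 14 (lit 0) ⊞ var 19))) ⍮
  for 25 1 (cond (arr 4 (var 25))
    (set 22 (var 22 ⊞ (arr 8 (var 24 ⊞ (arr 14 (lit 1 ⊞ var 25) ⊞ var 19)) ⊞
                       arr 8 (var 24 ⊞ (arr 14 (lit 1 ⊞ (var 1 ⊞ var 25)) ⊞ var 19)))))
    nop)

module Search (I : Instance) where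
  open Instance I
  open Model I

  N : ℕ
  N = |Q_L| * D

  index : Node → ℕ
  index (q , a) = toℕ (combine q a)

  index-< : ∀ ν → index ν < N
  index-< (q , a) = Fin.toℕ<n (combine q a)

  index-injective : ∀ {μ ν} → index μ ≡ index ν → μ ≡ ν
  index-injective {q , a} {q′ , a′} eq with Fin.combine-injective q a q′ a′ (Fin.toℕ-injective eq)
  ... | refl , refl = refl

  as-node : ∀ {i} → i < N → ∃[ ν ] index ν ≡ i
  as-node i<N with as-fin i<N
  ... | x , eq = remQuot D x , trans (cong toℕ (Fin.combine-remQuot {|Q_L|} D x)) eq

  -- The address of a table entry is a sum of two looked-up multiples and a target state, so that no
  -- product has to be formed during the search.
  record Context (s : State) : Set where
    field
      has-D  : vars s 1 ≡ D
      has-L  : vars s 2 ≡ |Q_L|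
      has-C  : vars s 3 ≡ |Q_C|
      has-N  : vars s 4 ≡ N
      has-M  : vars s 5 ≡ labelCount D
      has-q⁰ : vars s 13 ≡ toℕ (q⁰ contributor)
      has-ν₀ : vars s 14 ≡ index ν₀
      node-q : ∀ q a → arrs s 9 (index (q , a)) ≡ toℕ q
      node-a : ∀ q a → arrs s 10 (index (q , a)) ≡ toℕ a
      has-unsafe      : ∀ q → arrs s 8 (vars s 10 + toℕ q) ≡ bit (Vec.lookup unsafe q)
      has-leader      : ∀ q l q′ →
        arrs s 8 (arrs s 11 (toℕ q) + (arrs s 12 (labelIndex l) + toℕ q′)) ≡ bit (δ leader q l q′)
      has-contributor : ∀ σ l σ′ →
        arrs s 8 (arrs s 13 (toℕ σ) + (arrs s 14 (labelIndex l) + toℕ σ′)) ≡ bit (δ contributor σ l σ′)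

  open Context

  Context-resp : ∀ {s s′} → (∀ y → T (y <ᵇ 16) → vars s′ y ≡ vars s y) →
    (∀ j → T (7 <ᵇ j) → ∀ i → arrs s′ j i ≡ arrs s j i) → Context s → Context s′
  Context-resp {s} {s′} V A X = record
    { has-D  = trans (V 1 tt) (has-D X)
    ; has-L  = trans (V 2 tt) (has-L X)
    ; has-C  = trans (V 3 tt) (has-C X)
    ; has-N  = trans (V 4 tt) (has-N X)
    ; has-M  = trans (V 5 tt) (has-M X)
    ; has-q⁰ = trans (V 13 tt) (has-q⁰ X)
    ; has-ν₀ = trans (V 14 tt) (has-ν₀ X)
    ; node-q = λ q a → trans (A 9 tt _) (node-q X q a)
    ; node-a = λ q a → trans (A 10 tt _) (node-a X q a)
    ; has-unsafe = λ q → trans (A 8 tt _) (trans (cong (λ o → arrs s 8 (o + toℕ q)) (V 10 tt)) (has-unsafe X q))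
    ; has-leader = λ q l q′ → trans (A 8 tt _)
        (trans (cong₂ (λ o o′ → arrs s 8 (o + (o′ + toℕ q′))) (A 11 tt _) (A 12 tt _)) (has-leader X q l q′))
    ; has-contributor = λ σ l σ′ → trans (A 8 tt _)
        (trans (cong₂ (λ o o′ → arrs s 8 (o + (o′ + toℕ σ′))) (A 13 tt _) (A 14 tt _)) (has-contributor X σ l σ′))
    }

  -- `safe` protects the variables below 16 and `readsOnly` the arrays from 8 on, and `Context`
  -- mentions nothing else.
  Context-run : ∀ c {s} → T (safe c) → T (readsOnly c) → Context s → Context (run c s)
  Context-run c {s} ok ro = Context-resp
    (λ y y<16 → vars-frame c s (safe⇒¬writesV c y ok y<16))
    (λ j 7<j → arrs-frame c s (readsOnly⇒¬writesA c j ro 7<j))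

  InF InB : State → Node → Set
  InF s ν = arrs s 0 (index ν) ≢ 0
  InB s ν = arrs s 1 (index ν) ≢ 0

  Stock : State → Fin |Q_C| → Set
  Stock s σ = arrs s 2 (toℕ σ) ≢ 0

  InW InA : State → Fin D → Set
  InW s b = arrs s 3 (toℕ b) ≢ 0
  InA s a = arrs s 4 (toℕ a) ≢ 0

  -- A disjunction of the four kinds of edges: a leader's write, its silent move, its read, and a
  -- contributor's write. The second and third are masked unless the memory stays the same, the last
  -- unless the leader does and `b` is writable.
  edge-value : State → (q a q′ b : ℕ) → ℕ
  edge-value s q a q′ b =
    arrs s 8 (arrs s 11 q + (arrs s 12 (suc b) + q′)) +
    ((arrs s 8 (arrs s 11 q + (arrs s 12 0 + q′)) ∸ distance a b) +
    ((arrs s 8 (arrs s 11 q + (arrs s 12 (suc (vars s 1 + b)) + q′)) ∸ distance a b) +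
    (1 ∸ (distance q q′ + (1 ∸ arrs s 3 b)))))

  edgeTest-value : ∀ {s μ ν} → Context s → vars s 24 ≡ index μ → vars s 25 ≡ index ν →
    vars (run edgeTest s) 22 ≡ edge-value s (toℕ (proj₁ μ)) (toℕ (proj₂ μ)) (toℕ (proj₁ ν)) (toℕ (proj₂ ν))
  edgeTest-value {s} {q , a} {q′ , b} X eq eq′ =
    trans (cong₂ (λ i j → edge-value s (arrs s 9 i) (arrs s 10 i) (arrs s 9 j) (arrs s 10 j)) eq eq′)
      (trans (cong₂ (λ q a → edge-value s q a (arrs s 9 (index (q′ , b))) (arrs s 10 (index (q′ , b)))) (node-q X q a) (node-a X q a))
        (cong₂ (edge-value s (toℕ q) (toℕ a)) (node-q X q′ b) (node-a X q′ b)))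

  has-read : ∀ {s} → Context s → ∀ q a q′ →
    arrs s 8 (arrs s 11 (toℕ q) + (arrs s 12 (suc (vars s 1 + toℕ a)) + toℕ q′)) ≡ bit (δ leader q (just (rd a)) q′)
  has-read {s} X q a q′ = trans (cong (λ d → arrs s 8 (arrs s 11 (toℕ q) + (arrs s 12 (suc (d + toℕ a)) + toℕ q′))) (has-D X))
    (has-leader X q (just (rd a)) q′)

  edge-sound : ∀ {s μ ν} → Context s → vars s 24 ≡ index μ → vars s 25 ≡ index ν →
    vars (run edgeTest s) 22 ≢ 0 → Edge (InW s) μ ν
  edge-sound {s} {q , a} {q′ , b} X eq eq′ h
    with +-≢0 _ (subst (_≢ 0) (edgeTest-value {s} X eq eq′) h)
  ... | inj₁ wr≢0 = leads (bit-sound (has-leader X q (just (wr b)) q′) wr≢0) write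
  ... | inj₂ h with +-≢0 (_ ∸ distance (toℕ a) (toℕ b)) h
  ... | inj₁ ε≢0 with masked-sound _ (has-leader X q nothing q′) ε≢0
  ...   | t , d with Fin.toℕ-injective (distance≡0 (toℕ a) (toℕ b) d)
  ...     | refl = leads t ε
  edge-sound {s} {q , a} {q′ , b} X eq eq′ h | inj₂ _ | inj₂ h′ with +-≢0 (_ ∸ distance (toℕ a) (toℕ b)) h′
  ... | inj₁ rd≢0 with masked-sound _ (has-read X q b q′) rd≢0
  ...   | t , d with Fin.toℕ-injective (distance≡0 (toℕ a) (toℕ b) d)
  ...     | refl = leads t read
  edge-sound {s} {q , a} {q′ , b} X eq eq′ h | inj₂ _ | inj₂ _ | inj₂ w with guarded-sound (distance (toℕ q) (toℕ q′)) _ w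
  ... | d , w≢0 with Fin.toℕ-injective (distance≡0 (toℕ q) (toℕ q′) d)
  ...   | refl = writes w≢0

  edge-complete : ∀ {s μ ν} → Context s → vars s 24 ≡ index μ → vars s 25 ≡ index ν →
    Edge (InW s) μ ν → vars (run edgeTest s) 22 ≢ 0
  edge-complete {s} {q , a} {q′ , b} X eq eq′ e = subst (_≢ 0) (sym (edgeTest-value {s} X eq eq′)) (value e)
    where
    dist = distance (toℕ a) (toℕ b)
    unmasked : ∀ {c n} → n ≡ bit c → c ≡ true → a ≡ b → n ∸ dist ≢ 0
    unmasked p q refl rewrite distance-refl (toℕ a) = bit-complete p q
    value : Edge (InW s) (q , a) (q′ , b) → edge-value s (toℕ q) (toℕ a) (toℕ q′) (toℕ b) ≢ 0
    value (leads t write) = ≢0-+ˡ (bit-complete (has-leader X q (just (wr b)) q′) t)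
    value (leads t ε) = ≢0-+ʳ (arrs s 8 _) (≢0-+ˡ (unmasked (has-leader X q nothing q′) t refl))
    value (leads t read) = ≢0-+ʳ (arrs s 8 _) (≢0-+ʳ (arrs s 8 _ ∸ dist) (≢0-+ˡ (unmasked (has-read X q b q′) t refl)))
    value (writes w) = ≢0-+ʳ (arrs s 8 _) (≢0-+ʳ (arrs s 8 _ ∸ dist) (≢0-+ʳ (arrs s 8 _ ∸ dist)
      (guarded-complete (distance (toℕ q) (toℕ q)) (arrs s 3 (toℕ b)) (distance-refl (toℕ q)) w)))

  Allowed : State → Label D → Set
  Allowed s nothing       = ⊤
  Allowed s (just (wr a)) = InA s a
  Allowed s (just (rd a)) = InA s a

  Moves : State → Fin |Q_C| → Fin |Q_C| → Set
  Moves s σ σ′ = ∃[ l ] Allowed s l × δ contributor σ l σ′ ≡ true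

-- One round of saturation.

computeW forward backward allowed saturate : Com
computeW =
  clear 3 1 ⍮
  for 18 3 (cond (arr 2 (var 18))
    (for 19 3 (for 20 1 (cond (arr 8 (arr 13 (var 18) ⊞ (arr 14 (lit 1 ⊞ var 20) ⊞ var 19)))
      (put 3 (var 20) (lit 1)) nop)))
    nop)
forward  = clear 0 4 ⍮ put 0 (var 17) (lit 1) ⍮ closure 0 4 forwardTest
backward = clear 1 4 ⍮ put 1 (var 17) (lit 1) ⍮ closure 1 4 backwardTest
allowed  =
  clear 4 1 ⍮
  for 18 4 (cond (arr 0 (var 18)) (cond (arr 1 (var 18)) (put 4 (arr 10 (var 18)) (lit 1)) nop) nop)
saturate = computeW ⍮ forward ⍮ backward ⍮ allowed ⍮ closure 2 3 contributorTest

put-sound : ∀ k i s x → arrs (putA k i 1 s) k x ≢ 0 → x ≡ i ⊎ arrs s k x ≢ 0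
put-sound k i s x h with i ≟ x
... | yes refl = inj₁ refl
... | no i≢x   = inj₂ (subst (_≢ 0) (trans (putA-same k i 1 s x) (update-other (arrs s k) i≢x)) h)

put-hit : ∀ k i s → arrs (putA k i 1 s) k i ≢ 0
put-hit k i s = subst (_≢ 0) (sym (trans (putA-same k i 1 s i) (update-same (arrs s k) i))) λ ()

put-keep : ∀ k i s x → arrs s k x ≢ 0 → arrs (putA k i 1 s) k x ≢ 0
put-keep k i s x h with i ≟ x
... | yes refl = put-hit k i s
... | no i≢x   = subst (_≢ 0) (sym (trans (putA-same k i 1 s x) (update-other (arrs s k) i≢x))) h

module Saturate (I : Instance) where
  open Instance I
  open Model I
  open Search I
  open Context

  module ContributorTest (s : State) (X : Context s) (σ σ′ : Fin |Q_C|)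
    (at-σ : vars s 20 ≡ toℕ σ) (at-σ′ : vars s 19 ≡ toℕ σ′) where

    s₁ : State
    s₁ = run (set 24 (arr 13 (var 20)) ⍮ set 22 (arr 8 (var 24 ⊞ (arr 14 (lit 0) ⊞ var 19)))) s

    add body : Com
    add = set 22 (var 22 ⊞ (arr 8 (var 24 ⊞ (arr 14 (lit 1 ⊞ var 25) ⊞ var 19)) ⊞
                            arr 8 (var 24 ⊞ (arr 14 (lit 1 ⊞ (var 1 ⊞ var 25)) ⊞ var 19))))
    body = cond (arr 4 (var 25)) add nop

    record R (s′ : State) : Set where
      constructor r
      field
        same : arrs s′ ≡ arrs s
        row  : vars s′ 24 ≡ arrs s 13 (toℕ σ)
        dst  : vars s′ 19 ≡ toℕ σ′
        dom  : vars s′ 1 ≡ D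

    R₁ : R s₁
    R₁ = r refl (cong (arrs s 13) at-σ) at-σ′ (has-D X)

    R-step : ∀ i s′ → R s′ → R (run body (setV 25 i s′))
    R-step i s′ h = run-cond R (arr 4 (var 25)) add nop (setV 25 i s′)
      (λ _ → r (R.same h) (R.row h) (R.dst h) (R.dom h)) (λ _ → r (R.same h) (R.row h) (R.dst h) (R.dom h))

    entry : ∀ {s′} → R s′ → ∀ l → ∀ {m} → m ≡ labelIndex l →
      arrs s′ 8 (vars s′ 24 + (arrs s′ 14 m + vars s′ 19)) ≡ bit (δ contributor σ l σ′)
    entry (r refl p q _) l refl rewrite p | q = has-contributor X σ l σ′

    read-index : ∀ {s′} → R s′ → ∀ (a : Fin D) → suc (vars s′ 1 + toℕ a) ≡ labelIndex {D} (just (rd a))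
    read-index h a = cong (λ d → suc (d + toℕ a)) (R.dom h)

    s₂ : State
    s₂ = run contributorTest s

    sound : vars s₂ 22 ≢ 0 → Moves s σ σ′
    sound = proj₂ (for-inv (λ _ s′ → R s′ × (vars s′ 22 ≢ 0 → Moves s σ σ′)) 25 1 body s₁
      (R₁ , λ h → nothing , tt , bit-sound (entry R₁ nothing refl) h)
      λ i s′ i<D (h , P) → R-step i s′ h , step i s′ (subst (i <_) (has-D X) i<D) h P)
      where
      step : ∀ i s′ → i < D → R s′ → (vars s′ 22 ≢ 0 → Moves s σ σ′) →
        vars (run body (setV 25 i s′)) 22 ≢ 0 → Moves s σ σ′
      step i s′ i<D h P with as-fin i<D
      ... | a , refl = run-cond (λ s″ → vars s″ 22 ≢ 0 → Moves s σ σ′) (arr 4 (var 25)) add nop (setV 25 i s′)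
        (λ ok → λ h≢0 → case +-≢0 (vars s′ 22) h≢0 of λ
          { (inj₁ old) → P old
          ; (inj₂ new) → case +-≢0 _ new of λ
            { (inj₁ wr≢0) → just (wr a) , subst (λ A → A 4 (toℕ a) ≢ 0) (R.same h) ok ,
                bit-sound (entry h (just (wr a)) refl) wr≢0
            ; (inj₂ rd≢0) → just (rd a) , subst (λ A → A 4 (toℕ a) ≢ 0) (R.same h) ok ,
                bit-sound (entry h (just (rd a)) (read-index h a)) rd≢0 } })
        (λ _ → P)

    keep : ∀ i s′ → vars s′ 22 ≢ 0 → vars (run body (setV 25 i s′)) 22 ≢ 0
    keep i s′ h = run-cond (λ s″ → vars s″ 22 ≢ 0) (arr 4 (var 25)) add nop (setV 25 i s′)
      (λ _ → ≢0-+ˡ h) (λ _ → h)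

    hit : ∀ (a : Fin D) → InA s a → (∀ s′ → R s′ →
        arrs s′ 8 (vars s′ 24 + (arrs s′ 14 (suc (toℕ a)) + vars s′ 19)) +
        arrs s′ 8 (vars s′ 24 + (arrs s′ 14 (suc (vars s′ 1 + toℕ a)) + vars s′ 19)) ≢ 0) →
      vars s₂ 22 ≢ 0
    hit a ok val≢0 = for-hit R (λ s′ → vars s′ 22 ≢ 0) 25 1 body s₁ (toℕ a)
      (subst (toℕ a <_) (sym (has-D X)) (Fin.toℕ<n a)) R₁ (λ i s′ _ → R-step i s′)
      (λ s′ h → run-cond (λ s″ → vars s″ 22 ≢ 0) (arr 4 (var 25)) add nop (setV 25 (toℕ a) s′)
        (λ _ → ≢0-+ʳ (vars s′ 22) (val≢0 s′ h))
        λ no → ⊥-elim (ok (trans (cong (λ A → A 4 (toℕ a)) (sym (R.same h))) no)))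
      (λ i s′ _ _ → keep i s′)

    complete : Moves s σ σ′ → vars s₂ 22 ≢ 0
    complete (nothing , _ , t) = up-inv′ (λ s′ → vars s′ 22 ≢ 0) (vars s₁ 1)
      (bit-complete (entry R₁ nothing refl) t) keep
    complete (just (wr a) , ok , t) = hit a ok λ s′ h → ≢0-+ˡ (bit-complete (entry h (just (wr a)) refl) t)
    complete (just (rd a) , ok , t) = hit a ok λ s′ h →
      ≢0-+ʳ (arrs s′ 8 _) (bit-complete (entry h (just (rd a)) (read-index h a)) t)

  module ComputeW (s : State) (X : Context s) where

    cell : Exp
    cell = arr 8 (arr 13 (var 18) ⊞ (arr 14 (lit 1 ⊞ var 20) ⊞ var 19))

    look row scan : Com
    look = cond cell (put 3 (var 20) (lit 1)) nop
    row  = for 20 1 look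
    scan = cond (arr 2 (var 18)) (for 19 3 row) nop

    record P (s′ : State) : Set where
      constructor p
      field
        ctx   : Context s′
        same  : ∀ x → arrs s′ 2 x ≡ arrs s 2 x
        sound : ∀ b → InW s′ b → Writable (Stock s) b

    record P₂ (σ σ′ : Fin |Q_C|) (s′ : State) : Set where
      constructor p₂
      field
        old  : P s′
        at-σ : vars s′ 18 ≡ toℕ σ
        at-σ′ : vars s′ 19 ≡ toℕ σ′

    P₁ : Fin |Q_C| → State → Set
    P₁ σ s′ = P s′ × vars s′ 18 ≡ toℕ σ

    cell-value : ∀ {σ σ′ s′} (b : Fin D) → P₂ σ σ′ s′ →
      val cell (setV 20 (toℕ b) s′) ≡ bit (δ contributor σ (just (wr b)) σ′)
    cell-value {σ} {σ′} b (p₂ (p X′ _ _) e e′) rewrite e | e′ = has-contributor X′ σ (just (wr b)) σ′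

    P-look : ∀ {σ σ′} b s′ → Stock s σ → P₂ σ σ′ s′ → P₂ σ σ′ (run look (setV 20 (toℕ b) s′))
    P-look {σ} {σ′} b s′ Sσ h@(p₂ (p X′ same sound) at-σ at-σ′) =
      p₂ (p (Context-run (set 20 (lit (toℕ b)) ⍮ look) {s′} tt tt X′)
            (λ x → trans (arrs-frame look s″ refl x) (same x))
            (run-cond (λ s‴ → ∀ b → InW s‴ b → Writable (Stock s) b) cell (put 3 (var 20) (lit 1)) nop s″
              (λ hit c w → case put-sound 3 (toℕ b) s″ (toℕ c) w of λ
                { (inj₁ eq)  → subst (Writable (Stock s)) (sym (Fin.toℕ-injective eq)) (σ , σ′ , Sσ ,
                    bit-sound (cell-value b h) hit)
                ; (inj₂ old) → sound c old })
              λ _ → sound))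
         (trans (vars-frame look s″ refl) at-σ) (trans (vars-frame look s″ refl) at-σ′)
      where
      s″ = setV 20 (toℕ b) s′

    P-row : ∀ {σ σ′} s′ → Stock s σ → P₂ σ σ′ s′ → P₂ σ σ′ (run row s′)
    P-row {σ} {σ′} s′ Sσ h = for-inv (λ _ → P₂ σ σ′) 20 1 look s′ h step
      where
      step : ∀ i s″ → i < vars s′ 1 → P₂ σ σ′ s″ → P₂ σ σ′ (run look (setV 20 i s″))
      step i s″ i<n h′ with as-fin (subst (i <_) (has-D (P.ctx (P₂.old h))) i<n)
      ... | b , refl = P-look b s″ Sσ h′

    at-row : ∀ {σ s′} σ′ → P₁ σ s′ → P₂ σ σ′ (setV 19 (toℕ σ′) s′)
    at-row {s′ = s′} σ′ (p X′ same sound , at-σ) =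
      p₂ (p (Context-run (set 19 (lit (toℕ σ′))) {s′} tt tt X′) same sound) at-σ refl

    P-rows : ∀ {σ} i s′ → Stock s σ → i < |Q_C| → P₁ σ s′ → P₁ σ (run row (setV 19 i s′))
    P-rows i s′ Sσ i<n h with as-fin i<n
    ... | σ′ , refl with P-row (setV 19 (toℕ σ′) s′) Sσ (at-row {s′ = s′} σ′ h)
    ... | p₂ h′ e _ = h′ , e

    at-scan : ∀ {s′} (σ : Fin |Q_C|) → P s′ → P₁ σ (setV 18 (toℕ σ) s′)
    at-scan {s′} σ (p X′ same sound) = p (Context-run (set 18 (lit (toℕ σ))) {s′} tt tt X′) same sound , refl

    C≡ : ∀ {s′} → P s′ → vars s′ 3 ≡ |Q_C|
    C≡ h = has-C (P.ctx h)

    P-scan : ∀ i s′ → i < |Q_C| → P s′ → P (run scan (setV 18 i s′))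
    P-scan i s′ i<n h with as-fin i<n
    ... | σ , refl = run-cond P (arr 2 (var 18)) (for 19 3 row) nop s″
      (λ Sσ → proj₁ (for-inv (λ _ → P₁ σ) 19 3 row s″ (at-scan {s′} σ h) λ j t j<n h′ →
        P-rows j t (subst (_≢ 0) (P.same h (toℕ σ)) Sσ) (subst (j <_) (C≡ h) j<n) h′))
      λ _ → proj₁ (at-scan {s′} σ h)
      where
      s″ = setV 18 (toℕ σ) s′

    s₁ s₂ : State
    s₁ = run (clear 3 1) s
    s₂ = run computeW s

    P-initial : P s₁
    P-initial = p (Context-run (clear 3 1) {s} tt tt X) (arrs-frame (clear 3 1) s refl)
      λ b w → ⊥-elim (w (cleared 3 1 s (toℕ b) (subst (toℕ b <_) (sym (has-D X)) (Fin.toℕ<n b))))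

    P-final : P s₂
    P-final = for-inv (λ _ → P) 18 3 scan s₁ P-initial λ i s′ i<n → P-scan i s′ (subst (i <_) (C≡ P-initial) i<n)

    module _ (b : Fin D) where

      keep-look : ∀ i s′ → InW s′ b → InW (run look (setV 20 i s′)) b
      keep-look i s′ w = run-cond (λ t → InW t b) cell (put 3 (var 20) (lit 1)) nop (setV 20 i s′)
        (λ _ → put-keep 3 i (setV 20 i s′) (toℕ b) w) (λ _ → w)

      keep-row : ∀ i s′ → InW s′ b → InW (run row (setV 19 i s′)) b
      keep-row i s′ w = up-inv′ (λ t → InW t b) (vars s′ 1) w keep-look

      keep-scan : ∀ i s′ → InW s′ b → InW (run scan (setV 18 i s′)) b
      keep-scan i s′ w = run-cond (λ t → InW t b) (arr 2 (var 18)) (for 19 3 row) nop (setV 18 i s′)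
        (λ _ → up-inv′ (λ t → InW t b) (vars s′ 3) w keep-row) (λ _ → w)

      W-complete : Writable (Stock s) b → InW s₂ b
      W-complete (σ , σ′ , Sσ , t) =
        for-hit P (λ t → InW t b) 18 3 scan s₁ (toℕ σ) (subst (toℕ σ <_) (sym (C≡ P-initial)) (Fin.toℕ<n σ)) P-initial
          (λ i s′ i<n → P-scan i s′ (subst (i <_) (C≡ P-initial) i<n)) hit-scan (λ i s′ _ _ → keep-scan i s′)
        where
        hit-look : ∀ s′ → P₂ σ σ′ s′ → InW (run look (setV 20 (toℕ b) s′)) b
        hit-look s′ h = run-cond (λ t → InW t b) cell (put 3 (var 20) (lit 1)) nop (setV 20 (toℕ b) s′)
          (λ _ → put-hit 3 (toℕ b) (setV 20 (toℕ b) s′)) λ no → ⊥-elim (bit-complete (cell-value b h) t no)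
        hit-row : ∀ s′ → P₁ σ s′ → InW (run row (setV 19 (toℕ σ′) s′)) b
        hit-row s′ h = for-hit (P₂ σ σ′) (λ t → InW t b) 20 1 look (setV 19 (toℕ σ′) s′) (toℕ b)
          (subst (toℕ b <_) (sym (has-D (P.ctx (proj₁ h)))) (Fin.toℕ<n b)) (at-row {s′ = s′} σ′ h)
          (λ i t i<n h′ → step i t (subst (i <_) (has-D (P.ctx (proj₁ h))) i<n) h′)
          hit-look (λ i t _ _ → keep-look i t)
          where
          step : ∀ i t → i < D → P₂ σ σ′ t → P₂ σ σ′ (run look (setV 20 i t))
          step i t i<n h′ with as-fin i<n
          ... | c , refl = P-look c t Sσ h′
        hit-scan : ∀ s′ → P s′ → InW (run scan (setV 18 (toℕ σ) s′)) b
        hit-scan s′ h = run-cond (λ t → InW t b) (arr 2 (var 18)) (for 19 3 row) nop (setV 18 (toℕ σ) s′)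
          (λ _ → for-hit (P₁ σ) (λ t → InW t b) 19 3 row (setV 18 (toℕ σ) s′) (toℕ σ′)
            (subst (toℕ σ′ <_) (sym (C≡ h)) (Fin.toℕ<n σ′)) (at-scan {s′} σ h)
            (λ i t i<n → P-rows i t Sσ (subst (i <_) (C≡ h) i<n)) hit-row (λ i t _ _ → keep-row i t))
          λ no → ⊥-elim (Sσ (trans (sym (P.same h (toℕ σ))) no))

    W-sound : ∀ b → InW s₂ b → Writable (Stock s) b
    W-sound = P.sound P-final

  -- The relation is a parameter so that nodes reaching the current one are found by exploring the
  -- converse of `Edge` forwards.
  module Explore
    (k : ℕ) (k<16 : T (k <ᵇ 16)) (k<8 : T (k <ᵇ 8)) (k≢3 : k ≢ 3) (k≢6 : k ≢ 6) (test : Com)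
    (ok : T (safe test)) (test-arrs : ∀ j → writesA j test ≡ false)
    (test-19 : writesV 19 test ≡ false) (test-20 : writesV 20 test ≡ false)
    (Rel : (Fin D → Set) → Node → Node → Set)
    (Rel-mono : ∀ {W W′ : Fin D → Set} → (∀ {b} → W b → W′ b) → ∀ {μ ν} → Rel W μ ν → Rel W′ μ ν)
    (test-sound : ∀ {s μ ν} → Context s → vars s 20 ≡ index μ → vars s 19 ≡ index ν →
      vars (run test s) 22 ≢ 0 → Rel (InW s) μ ν)
    (test-complete : ∀ {s μ ν} → Context s → vars s 20 ≡ index μ → vars s 19 ≡ index ν →
      Rel (InW s) μ ν → vars (run test s) 22 ≢ 0)
    (s : State) (X : Context s) (ν : Node) (at-ν : vars s 17 ≡ index ν)
    where

    start : Com
    start = clear k {k<16} 4 ⍮ put k {k<16} (var 17) (lit 1)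

    s₁ s₂ : State
    s₁ = run start s
    s₂ = run (start ⍮ closure k {k<16} 4 test) s

    X₁ : Context s₁
    X₁ = Context-run start {s} tt (both k<8) X
      where
      both : ∀ {b} → T b → T (b ∧ b)
      both {true} _ = tt

    Link : ℕ → ℕ → Set
    Link x y = ∃[ μ ] ∃[ ν ] x ≡ index μ × y ≡ index ν × Rel (InW s) μ ν

    module K = Closure k k<16 k≢6 4 tt test test-arrs (λ y → safe⇒¬writesV test y ok) test-19 test-20 s₁ Link

    n≡N : K.n ≡ N
    n≡N = has-N X₁

    same-W₁ : ∀ x → arrs s₁ 3 x ≡ arrs s 3 x
    same-W₁ = arrs-frame start s same
      where
      same : writesA 3 start ≡ false
      same rewrite ≢⇒≡ᵇ k≢3 = refl

    module _ (s′ : State) (S : K.Similar s′) where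

      Similar⇒Context : Context s′
      Similar⇒Context = Context-resp (K.Similar.same-params S)
        (λ j 7<j → K.Similar.same-arrs S j (λ { refl → <⇒≱ (<ᵇ⇒< k 8 k<8) (<ᵇ⇒< 7 k 7<j) }) (λ { refl → 7<j })) X₁

      same-W : ∀ x → arrs s′ 3 x ≡ arrs s 3 x
      same-W x = trans (K.Similar.same-arrs S 3 (≢-sym k≢3) (λ ()) x) (same-W₁ x)

    Reached : (ℕ → Set) → Set
    Reached P = ∀ μ → P (index μ) → Star (Rel (InW s)) ν μ

    start-17 : vars (run (clear k {k<16} 4) s) 17 ≡ vars s 17
    start-17 = vars-frame (clear k {k<16} 4) s refl

    start-put : ∀ x → arrs s₁ k x ≢ 0 → arrs (putA k (vars s 17) 1 (run (clear k {k<16} 4) s)) k x ≢ 0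
    start-put x = subst (λ v → arrs (putA k v 1 (run (clear k {k<16} 4) s)) k x ≢ 0) start-17

    link-sound : ∀ s′ → K.Similar s′ → vars s′ 20 < K.n → vars s′ 19 < K.n →
      vars (run test s′) 22 ≢ 0 → Link (vars s′ 20) (vars s′ 19)
    link-sound s′ S x<n y<n h
      with as-node (subst (vars s′ 20 <_) n≡N x<n) | as-node (subst (vars s′ 19 <_) n≡N y<n)
    ... | μ , e | μ′ , e′ = μ , μ′ , sym e , sym e′ ,
      Rel-mono (λ {b} → subst (_≢ 0) (same-W s′ S (toℕ b))) (test-sound {s′} (Similar⇒Context s′ S) (sym e) (sym e′) h)

    link-complete : ∀ s′ → K.Similar s′ → vars s′ 20 < K.n → vars s′ 19 < K.n →
      Link (vars s′ 20) (vars s′ 19) → vars (run test s′) 22 ≢ 0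
    link-complete s′ S _ _ (μ , μ′ , e , e′ , rel) = test-complete {s′} (Similar⇒Context s′ S) e e′
      (Rel-mono (λ {b} → subst (_≢ 0) (sym (same-W s′ S (toℕ b)))) rel)

    reached-grow : ∀ {P : ℕ → Set} {x y} → x < K.n → y < K.n → Reached P → P x → Link x y →
      Reached (λ z → P z ⊎ z ≡ y)
    reached-grow _ _ h Px (μ , μ′ , refl , refl , rel) μ″ (inj₁ Pz) = h μ″ Pz
    reached-grow _ _ h Px (μ , μ′ , refl , refl , rel) μ″ (inj₂ eq) with index-injective eq
    ... | refl = h μ Px ◅◅ rel ◅ ε*

    reached-start : Reached (K.Marked s₁)
    reached-start μ m with put-sound k (vars s 17) (run (clear k {k<16} 4) s) (index μ) (start-put (index μ) m)
    ... | inj₂ old = ⊥-elim (old (cleared k {k<16} 4 s (index μ) (subst (index μ <_) (sym (has-N X)) (index-< μ))))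
    ... | inj₁ eq with index-injective {μ} {ν} (trans eq at-ν)
    ...   | refl = ε*

    module C = K.Correct link-sound link-complete Reached (λ {P} {Q} Q⊆P h μ q → h μ (Q⊆P (index μ) q))
      reached-grow reached-start

    marked-sound : ∀ μ → arrs s₂ k (index μ) ≢ 0 → Star (Rel (InW s)) ν μ
    marked-sound = C.Inv.J-marked C.final

    marked-start : arrs s₂ k (index ν) ≢ 0
    marked-start = C.Inv.grows C.final (index ν)
      (subst (λ i → arrs s₁ k i ≢ 0) (trans start-17 at-ν)
        (put-hit k (vars (run (clear k {k<16} 4) s) 17) (run (clear k {k<16} 4) s)))

    marked-closed : ∀ {μ μ′} → arrs s₂ k (index μ) ≢ 0 → Star (Rel (InW s)) μ μ′ → arrs s₂ k (index μ′) ≢ 0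
    marked-closed m ε* = m
    marked-closed {μ} m (_◅_ {j = μ₁} rel rels) = marked-closed
      (C.closed-below (index μ) (index μ₁) (below μ) (below μ₁) m (μ , μ₁ , refl , refl , rel)) rels
      where
      below : ∀ μ → index μ < K.n
      below μ = subst (index μ <_) (sym n≡N) (index-< μ)

    marked-complete : ∀ μ → Star (Rel (InW s)) ν μ → arrs s₂ k (index μ) ≢ 0
    marked-complete μ = marked-closed marked-start

module Saturated (I : Instance) where
  open Instance I
  open Model I
  open Search I
  open Saturate I
  open Context

  module Allow (s : State) (X : Context s) where

    mark body : Com
    mark = cond (arr 1 (var 18)) (put 4 (arr 10 (var 18)) (lit 1)) nop
    body = cond (arr 0 (var 18)) mark nop

    s₁ s₂ : State
    s₁ = run (clear 4 1) s
    s₂ = run allowed s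

    record P (s′ : State) : Set where
      constructor p
      field
        ctx   : Context s′
        same  : ∀ j → (4 ≡ᵇ j) ≡ false → ∀ x → arrs s′ j x ≡ arrs s j x
        sound : ∀ a → InA s′ a → ∃[ q ] InF s (q , a) × InB s (q , a)

    P₁ : P s₁
    P₁ = p (Context-run (clear 4 1) {s} tt tt X) (λ j j≢4 → arrs-frame (clear 4 1) s j≢4)
      λ a h → ⊥-elim (h (cleared 4 1 s (toℕ a) (subst (toℕ a <_) (sym (has-D X)) (Fin.toℕ<n a))))

    same-body : ∀ j → (4 ≡ᵇ j) ≡ false → writesA j body ≡ false
    same-body j e rewrite e = refl

    P-step : ∀ i s′ → i < N → P s′ → P (run body (setV 18 i s′))
    P-step i s′ i<N (p X′ same sound) with as-node i<N
    ... | (q , a) , refl = p (Context-run (set 18 (lit i) ⍮ body) {s′} tt tt X′)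
      (λ j j≢4 x → trans (arrs-frame body (setV 18 i s′) (same-body j j≢4) x) (same j j≢4 x))
      (run-cond (λ t → ∀ c → InA t c → _) (arr 0 (var 18)) mark nop (setV 18 i s′)
        (λ f → run-cond (λ t → ∀ c → InA t c → _) (arr 1 (var 18)) (put 4 (arr 10 (var 18)) (lit 1)) nop (setV 18 i s′)
          (λ b c h → case put-sound 4 (arrs s′ 10 i) (setV 18 i s′) (toℕ c) h of λ
            { (inj₁ eq)  → q , subst (λ a → InF s (q , a)) (a≡c c eq) (subst (_≢ 0) (same 0 refl i) f) ,
                               subst (λ a → InB s (q , a)) (a≡c c eq) (subst (_≢ 0) (same 1 refl i) b)
            ; (inj₂ old) → sound c old })
          λ _ → sound)
        λ _ → sound)
      where
      a≡c : ∀ c → toℕ c ≡ arrs s′ 10 i → a ≡ c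
      a≡c c eq = Fin.toℕ-injective (sym (trans eq (node-a X′ q a)))

    A-sound : ∀ a → InA s₂ a → ∃[ q ] InF s (q , a) × InB s (q , a)
    A-sound = P.sound (for-inv (λ _ → P) 18 4 body s₁ P₁ λ i s′ i<n → P-step i s′ (subst (i <_) (has-N (P.ctx P₁)) i<n))

    A-complete : ∀ q a → InF s (q , a) → InB s (q , a) → InA s₂ a
    A-complete q a f b = for-hit P (λ t → InA t a) 18 4 body s₁ i
      (subst (i <_) (sym (has-N (P.ctx P₁))) (index-< (q , a))) P₁
      (λ i s′ i<n → P-step i s′ (subst (i <_) (has-N (P.ctx P₁)) i<n))
      (λ s′ h → run-cond (λ t → InA t a) (arr 0 (var 18)) mark nop (setV 18 i s′)
        (λ _ → run-cond (λ t → InA t a) (arr 1 (var 18)) (put 4 (arr 10 (var 18)) (lit 1)) nop (setV 18 i s′)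
          (λ _ → subst (λ c → arrs (putA 4 (arrs s′ 10 i) 1 (setV 18 i s′)) 4 c ≢ 0) (node-a (P.ctx h) q a)
            (put-hit 4 (arrs s′ 10 i) (setV 18 i s′)))
          λ no → ⊥-elim (b (trans (sym (P.same h 1 refl i)) no)))
        λ no → ⊥-elim (f (trans (sym (P.same h 0 refl i)) no)))
      λ j s′ _ _ h → run-cond (λ t → InA t a) (arr 0 (var 18)) mark nop (setV 18 j s′)
        (λ _ → run-cond (λ t → InA t a) (arr 1 (var 18)) (put 4 (arr 10 (var 18)) (lit 1)) nop (setV 18 j s′)
          (λ _ → put-keep 4 (arrs s′ 10 j) (setV 18 j s′) (toℕ a) h) (λ _ → h))
        (λ _ → h)
      where
      i = index (q , a)

  module Grow (s : State) (X : Context s) where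

    Link : ℕ → ℕ → Set
    Link x y = ∃[ σ ] ∃[ σ′ ] x ≡ toℕ σ × y ≡ toℕ σ′ × Moves s σ σ′

    module K = Closure 2 tt (λ ()) 3 tt contributorTest (λ _ → refl)
      (λ y → safe⇒¬writesV contributorTest y tt) refl refl s Link

    n≡C : K.n ≡ |Q_C|
    n≡C = has-C X

    s₂ : State
    s₂ = run (closure 2 3 contributorTest) s

    module _ (s′ : State) (S : K.Similar s′) where

      Similar⇒Context : Context s′
      Similar⇒Context = Context-resp (K.Similar.same-params S)
        (λ j 7<j → K.Similar.same-arrs S j (λ { refl → 7<j }) (λ { refl → 7<j })) X

      same-A : ∀ a → arrs s′ 4 a ≡ arrs s 4 a
      same-A = K.Similar.same-arrs S 4 (λ ()) λ ()

      Allowed-forth : ∀ l → Allowed s l → Allowed s′ l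
      Allowed-forth nothing       _ = tt
      Allowed-forth (just (wr a)) h = subst (_≢ 0) (sym (same-A (toℕ a))) h
      Allowed-forth (just (rd a)) h = subst (_≢ 0) (sym (same-A (toℕ a))) h

      Allowed-back : ∀ l → Allowed s′ l → Allowed s l
      Allowed-back nothing       _ = tt
      Allowed-back (just (wr a)) h = subst (_≢ 0) (same-A (toℕ a)) h
      Allowed-back (just (rd a)) h = subst (_≢ 0) (same-A (toℕ a)) h

    link-sound : ∀ s′ → K.Similar s′ → vars s′ 20 < K.n → vars s′ 19 < K.n →
      vars (run contributorTest s′) 22 ≢ 0 → Link (vars s′ 20) (vars s′ 19)
    link-sound s′ S x<n y<n h
      with as-fin (subst (vars s′ 20 <_) n≡C x<n) | as-fin (subst (vars s′ 19 <_) n≡C y<n)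
    ... | σ , e | σ′ , e′ with ContributorTest.sound s′ (Similar⇒Context s′ S) σ σ′ (sym e) (sym e′) h
    ... | l , ok , t = σ , σ′ , sym e , sym e′ , l , Allowed-back s′ S l ok , t

    link-complete : ∀ s′ → K.Similar s′ → vars s′ 20 < K.n → vars s′ 19 < K.n →
      Link (vars s′ 20) (vars s′ 19) → vars (run contributorTest s′) 22 ≢ 0
    link-complete s′ S _ _ (σ , σ′ , e , e′ , l , ok , t) =
      ContributorTest.complete s′ (Similar⇒Context s′ S) σ σ′ e e′ (l , Allowed-forth s′ S l ok , t)

    module Result (ν : Node) (S₀ : Fin |Q_C| → Set)
      (A-loop : ∀ a → InA s a → ∃[ q ] Reach (Writable S₀) ν (q , a) × Reach (Writable S₀) (q , a) ν)
      (S₀⊆ : ∀ σ → S₀ σ → Stock s σ) (supplied : Supplied ν (Stock s)) where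

      -- To let copies take a transition, leader and memory go to the node where its label occurs
      -- and return. The values for this trip are writable from `S₀`, the stock at the start of the
      -- round, so `S₀` is kept in the demand next to the marked states.
      with-S₀ : (ℕ → Set) → Fin |Q_C| → Set
      with-S₀ P σ = P (toℕ σ) ⊎ S₀ σ

      J : (ℕ → Set) → Set
      J P = Supplied ν (with-S₀ P)

      label-loop : ∀ l → Allowed s l → ∃[ q ] ∃[ a ] Eff l a a ×
        Reach (Writable S₀) ν (q , a) × Reach (Writable S₀) (q , a) ν
      label-loop nothing       _  = proj₁ ν , proj₂ ν , ε , ε* , ε*
      label-loop (just (wr a)) ok with A-loop a ok
      ... | q , to , from = q , a , write , to , from
      label-loop (just (rd a)) ok with A-loop a ok
      ... | q , to , from = q , a , read , to , from

      grow : ∀ {P : ℕ → Set} {x y} → x < K.n → y < K.n → J P → P x → Link x y → J (λ z → P z ⊎ z ≡ y)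
      grow {P} _ _ h Px (σ , σ′ , refl , refl , l , ok , t) with label-loop l ok
      ... | q , a , e , to , from = Supplied-mono {P = λ τ → with-S₀ P τ ⊎ τ ≡ σ′} {with-S₀ (λ z → P z ⊎ z ≡ toℕ σ′)} widen
        (Supplied-reach (Reach-mono (Writable-mono {S₀} {λ τ → with-S₀ P τ ⊎ τ ≡ σ′} (λ h → inj₁ (inj₂ h))) from)
          (Supplied-grow {P = with-S₀ P} e (inj₁ Px) t (Supplied-reach (Reach-mono (Writable-mono {S₀} {with-S₀ P} inj₂) to) h)))
        where
        widen : ∀ τ → (P (toℕ τ) ⊎ toℕ τ ≡ toℕ σ′) ⊎ S₀ τ → (P (toℕ τ) ⊎ S₀ τ) ⊎ τ ≡ σ′
        widen τ (inj₁ (inj₁ Pτ)) = inj₁ (inj₁ Pτ)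
        widen τ (inj₁ (inj₂ eq)) = inj₂ (Fin.toℕ-injective eq)
        widen τ (inj₂ S₀τ)       = inj₁ (inj₂ S₀τ)

      J-antitone : ∀ {P Q : ℕ → Set} → (∀ x → Q x → P x) → J P → J Q
      J-antitone {P} {Q} Q⊆P = Supplied-mono {P = with-S₀ P} {with-S₀ Q}
        λ { σ (inj₁ q) → inj₁ (Q⊆P (toℕ σ) q) ; σ (inj₂ r) → inj₂ r }

      J-start : J (K.Marked s)
      J-start = Supplied-mono {P = Stock s} {with-S₀ (K.Marked s)} (λ { σ (inj₁ m) → m ; σ (inj₂ r) → S₀⊆ σ r }) supplied

      module C = K.Correct link-sound link-complete J J-antitone grow J-start

      supplied′ : Supplied ν (Stock s₂)
      supplied′ = Supplied-mono {P = with-S₀ (K.Marked s₂)} {Stock s₂} (λ σ → inj₁) (C.Inv.J-marked C.final)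

    -- Growth and closedness are facts about the computation alone and must hold without supposing
    -- any supply; hence a second, trivial instance of `J`.
    module C⊤ = K.Correct link-sound link-complete (λ _ → ⊤) (λ _ _ → tt) (λ _ _ _ _ _ → tt) tt

    stock-grows : ∀ σ → Stock s σ → Stock s₂ σ
    stock-grows σ = C⊤.Inv.grows C⊤.final (toℕ σ)

    stock-closed : ∀ σ σ′ → Stock s₂ σ → Moves s σ σ′ → Stock s₂ σ′
    stock-closed σ σ′ m mv = C⊤.closed-below (toℕ σ) (toℕ σ′) (below σ) (below σ′) m (σ , σ′ , refl , refl , mv)
      where
      below : ∀ σ → toℕ σ < K.n
      below σ = subst (toℕ σ <_) (sym n≡C) (Fin.toℕ<n σ)

  module Sat (s : State) (X : Context s) (ν : Node) (at-ν : vars s 17 ≡ index ν) where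

    s₁ s₂ s₃ s₄ s₅ : State
    s₁ = run computeW s
    s₂ = run forward s₁
    s₃ = run backward s₂
    s₄ = run allowed s₃
    s₅ = run saturate s

    X₁ : Context s₁
    X₁ = Context-run computeW {s} tt tt X
    X₂ : Context s₂
    X₂ = Context-run forward {s₁} tt tt X₁
    X₃ : Context s₃
    X₃ = Context-run backward {s₂} tt tt X₂
    X₄ : Context s₄
    X₄ = Context-run allowed {s₃} tt tt X₃
    X₅ : Context s₅
    X₅ = Context-run saturate {s} tt tt X

    at-ν₁ : vars s₁ 17 ≡ index ν
    at-ν₁ = trans (vars-frame computeW s refl) at-ν
    at-ν₂ : vars s₂ 17 ≡ index ν
    at-ν₂ = trans (vars-frame forward s₁ refl) at-ν₁
    at-ν₅ : vars s₅ 17 ≡ index ν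
    at-ν₅ = trans (vars-frame saturate s refl) at-ν

    module W = ComputeW s X
    module F = Explore 0 tt tt (λ ()) (λ ()) forwardTest tt (λ _ → refl) refl refl Edge Edge-mono
      (λ {s} {μ} {ν} X e e′ → edge-sound {setV 25 (vars s 19) (setV 24 (vars s 20) s)} {μ} {ν}
        (Context-run (set 24 (var 20) ⍮ set 25 (var 19)) {s} tt tt X) e e′)
      (λ {s} {μ} {ν} X e e′ → edge-complete {setV 25 (vars s 19) (setV 24 (vars s 20) s)} {μ} {ν}
        (Context-run (set 24 (var 20) ⍮ set 25 (var 19)) {s} tt tt X) e e′)
      s₁ X₁ ν at-ν₁
    module B = Explore 1 tt tt (λ ()) (λ ()) backwardTest tt (λ _ → refl) refl refl
      (λ W μ ν → Edge W ν μ) (λ W⊆ → Edge-mono W⊆)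
      (λ {s} {μ} {ν} X e e′ → edge-sound {setV 25 (vars s 20) (setV 24 (vars s 19) s)} {ν} {μ}
        (Context-run (set 24 (var 19) ⍮ set 25 (var 20)) {s} tt tt X) e′ e)
      (λ {s} {μ} {ν} X e e′ → edge-complete {setV 25 (vars s 20) (setV 24 (vars s 19) s)} {ν} {μ}
        (Context-run (set 24 (var 19) ⍮ set 25 (var 20)) {s} tt tt X) e′ e)
      s₂ X₂ ν at-ν₂
    module A = Allow s₃ X₃
    module G = Grow s₄ X₄

    W₁≡W₅ : ∀ x → arrs s₅ 3 x ≡ arrs s₁ 3 x
    W₁≡W₅ = arrs-frame (forward ⍮ backward ⍮ allowed ⍮ closure 2 3 contributorTest) s₁ refl

    W₁≡W₂ : ∀ x → arrs s₂ 3 x ≡ arrs s₁ 3 x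
    W₁≡W₂ = arrs-frame forward s₁ refl

    F₂≡F₅ : ∀ x → arrs s₅ 0 x ≡ arrs s₂ 0 x
    F₂≡F₅ = arrs-frame (backward ⍮ allowed ⍮ closure 2 3 contributorTest) s₂ refl

    F₂≡F₃ : ∀ x → arrs s₃ 0 x ≡ arrs s₂ 0 x
    F₂≡F₃ = arrs-frame backward s₂ refl

    S≡S₄ : ∀ x → arrs s₄ 2 x ≡ arrs s 2 x
    S≡S₄ = arrs-frame (computeW ⍮ forward ⍮ backward ⍮ allowed) s refl

    InW-sound : ∀ {b} → InW s₅ b → Writable (Stock s) b
    InW-sound {b} h = W.W-sound b (subst (_≢ 0) (W₁≡W₅ (toℕ b)) h)

    InW-complete : ∀ {b} → Writable (Stock s) b → InW s₅ b
    InW-complete {b} w = subst (_≢ 0) (sym (W₁≡W₅ (toℕ b))) (W.W-complete b w)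

    InW₁₅ : ∀ {b} → InW s₁ b → InW s₅ b
    InW₁₅ {b} = subst (_≢ 0) (sym (W₁≡W₅ (toℕ b)))

    InW₅₁ : ∀ {b} → InW s₅ b → InW s₁ b
    InW₅₁ {b} = subst (_≢ 0) (W₁≡W₅ (toℕ b))

    InW₅₂ : ∀ {b} → InW s₅ b → InW s₂ b
    InW₅₂ {b} h = subst (_≢ 0) (sym (W₁≡W₂ (toℕ b))) (InW₅₁ {b} h)

    F-sound : ∀ μ → InF s₅ μ → Reach (InW s₅) ν μ
    F-sound μ h = Reach-mono (λ {b} → InW₁₅ {b}) (F.marked-sound μ (subst (_≢ 0) (F₂≡F₅ (index μ)) h))

    F-complete : ∀ μ → Reach (InW s₅) ν μ → InF s₅ μ
    F-complete μ r = subst (_≢ 0) (sym (F₂≡F₅ (index μ))) (F.marked-complete μ (Reach-mono (λ {b} → InW₅₁ {b}) r))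

    W₂-sound : ∀ {b} → InW s₂ b → Writable (Stock s) b
    W₂-sound {b} w = W.W-sound b (subst (_≢ 0) (W₁≡W₂ (toℕ b)) w)

    A-loop : ∀ a → InA s₄ a → ∃[ q ] Reach (Writable (Stock s)) ν (q , a) × Reach (Writable (Stock s)) (q , a) ν
    A-loop a h = let (q , f , b) = A.A-sound a h in q ,
      Reach-mono {InW s₁} (λ {b} → W.W-sound b) (F.marked-sound (q , a) (subst (_≢ 0) (F₂≡F₃ (index (q , a))) f)) ,
      Reach-mono {InW s₂} W₂-sound (reverse id (B.marked-sound (q , a) b))

    A-complete : ∀ q a → Reach (InW s₅) ν (q , a) → Reach (InW s₅) (q , a) ν → InA s₄ a
    A-complete q a to from = A.A-complete q a
      (subst (_≢ 0) (sym (F₂≡F₃ (index (q , a)))) (F.marked-complete (q , a) (Reach-mono (λ {b} → InW₅₁ {b}) to)))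
      (B.marked-complete (q , a) (reverse id (Reach-mono (λ {b} → InW₅₂ {b}) from)))

    stock-grows : ∀ σ → Stock s σ → Stock s₅ σ
    stock-grows σ h = G.stock-grows σ (subst (_≢ 0) (sym (S≡S₄ (toℕ σ))) h)

    stock-closed : Closed (InW s₅) ν (Stock s₅)
    stock-closed q a l σ σ′ to from m e t = G.stock-closed σ σ′ m (l , ok e , t)
      where
      ok : ∀ {l} → Eff l a a → Allowed s₄ l
      ok ε     = tt
      ok read  = A-complete q a to from
      ok write = A-complete q a to from

    supplied : Supplied ν (Stock s) → Supplied ν (Stock s₅)
    supplied S = G.Result.supplied′ ν (Stock s) A-loop (λ σ → subst (_≢ 0) (sym (S≡S₄ (toℕ σ))))
      (Supplied-mono (λ σ → subst (_≢ 0) (S≡S₄ (toℕ σ))) S)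

  -- The graph of a round is that of the stock before the round, while the stock afterwards may
  -- write more. Closedness with respect to `InW s′` thus falls short of saturation until the
  -- writable values stop growing.
  record Saturates (ν : Node) (s s′ : State) : Set where
    field
      ctx          : Context s′
      at           : vars s′ 17 ≡ index ν
      InW-sound    : ∀ b → InW s′ b → Writable (Stock s) b
      InW-complete : ∀ b → Writable (Stock s) b → InW s′ b
      F-sound      : ∀ μ → InF s′ μ → Reach (InW s′) ν μ
      F-complete   : ∀ μ → Reach (InW s′) ν μ → InF s′ μ
      stock-grows  : ∀ σ → Stock s σ → Stock s′ σ
      stock-closed : Closed (InW s′) ν (Stock s′)
      supplied     : Supplied ν (Stock s) → Supplied ν (Stock s′)

  saturate-saturates : ∀ s ν → Context s → vars s 17 ≡ index ν → Saturates ν s (run saturate s)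
  saturate-saturates s ν X at-ν = record
    { ctx = Z.X₅ ; at = Z.at-ν₅
    ; InW-sound = λ b → Z.InW-sound {b} ; InW-complete = λ b → Z.InW-complete {b}
    ; F-sound = Z.F-sound ; F-complete = Z.F-complete
    ; stock-grows = Z.stock-grows ; stock-closed = Z.stock-closed ; supplied = Z.supplied }
    where module Z = Sat s X ν at-ν

-- Saturating a component, and simulating one word.

-- A round of saturation that leaves the set of writable values unchanged is
-- the last one needed; hence D + 2 rounds suffice, and 2 D + 1 is at hand.
component pick letter raiseFlag checkNode check candidate : Com
component = for 36 5 saturate
pick = cond (arr 0 (arr 5 (var 32))) (set 17 (arr 5 (var 32))) nop
letter = component ⍮ pick
raiseFlag = cond (arr 8 (var 10 ⊞ arr 9 (var 18))) (set 16 (lit 1)) nop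
checkNode = cond (arr 0 (var 18)) raiseFlag nop
check = for 18 4 checkNode
candidate =
  set 17 (var 14) ⍮ clear 2 3 ⍮ put 2 (var 13) (lit 1) ⍮
  for 32 4 letter ⍮ check

new-or-none : ∀ n (f g : ℕ → ℕ) → (∃[ b ] b < n × g b ≢ 0 × f b ≡ 0) ⊎ (∀ b → b < n → g b ≢ 0 → f b ≢ 0)
new-or-none zero    f g = inj₂ λ _ ()
new-or-none (suc n) f g with new-or-none n f g | g n ≟ 0 | f n ≟ 0
... | inj₁ (b , b<n , h) | _ | _ = inj₁ (b , m≤n⇒m≤1+n b<n , h)
... | inj₂ _   | no gn≢0 | yes fn≡0 = inj₁ (n , ≤-refl , gn≢0 , fn≡0)
... | inj₂ all | yes gn≡0 | _ = inj₂ λ b b<1+n gb → case b ≟ n of λ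
  { (yes refl) → ⊥-elim (gb gn≡0)
  ; (no b≢n)   → all b (≤∧≢⇒< (≤-pred b<1+n) b≢n) gb }
... | inj₂ all | _ | no fn≢0 = inj₂ λ b b<1+n gb → case b ≟ n of λ
  { (yes refl) → fn≢0
  ; (no b≢n)   → all b (≤∧≢⇒< (≤-pred b<1+n) b≢n) gb }

-- Turns an array into a Boolean predicate, the kind of predicate over which `Saturation`
-- quantifies.
positive? : ℕ → Bool
positive? zero    = false
positive? (suc _) = true

positive⇒≢0 : ∀ {n} → T (positive? n) → n ≢ 0
positive⇒≢0 {suc n} _ ()

≢0⇒positive : ∀ {n} → n ≢ 0 → T (positive? n)
≢0⇒positive {zero}  h = ⊥-elim (h refl)
≢0⇒positive {suc n} _ = tt

module Candidate (I : Instance) where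
  open Instance I
  open Model I
  open Search I
  open Saturate I
  open Saturated I
  open Context

  D≥1 : 1 ≤ D
  D≥1 = ≤-trans (s≤s z≤n) (Fin.toℕ<n a⁰)

  module Component (s : State) (X : Context s) (ν : Node) (at-ν : vars s 17 ≡ index ν) where

    -- A saturated `P` between the initial and the present stock contains the least saturation. It
    -- is a separate set because array 0 refers to the graph of an earlier stock: `P` will be the
    -- stock before the round that brought no new writable value.
    Good : State → Set
    Good s′ = Σ (Fin |Q_C| → Bool) λ P → (∀ σ → Stock s σ → T (P σ)) × (∀ σ → T (P σ) → Stock s′ σ) ×
      Saturated ν (λ σ → T (P σ)) × (∀ μ → Reach (Writable (λ σ → T (P σ))) ν μ → InF s′ μ)

    Closing : ℕ → State → Set
    Closing j s′ = j ≤ count D (arrs s′ 3) × Closed (InW s′) ν (Stock s′) × (∀ b → InW s′ b → Writable (Stock s′) b)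

    -- The case `j ≡ 0` is separate because arrays 0 and 3 may hold leftovers of an earlier
    -- component before the first round; counting starts with the second.
    record Inv (j : ℕ) (s′ : State) : Set where
      constructor inv
      field
        ctx      : Context s′
        at       : vars s′ 17 ≡ index ν
        grows    : ∀ σ → Stock s σ → Stock s′ σ
        supplied : Supplied ν (Stock s) → Supplied ν (Stock s′)
        F-sound  : j ≡ 0 ⊎ (∀ μ → InF s′ μ → Reach (Writable (Stock s′)) ν μ)
        progress : Good s′ ⊎ j ≡ 0 ⊎ (∃[ i ] j ≡ suc i × Closing i s′)

    module Step (i : ℕ) (t t′ : State) (Z : Saturates ν t t′) where
      module Z = Saturates Z

      W⊆ : ∀ b → InW t′ b → Writable (Stock t′) b
      W⊆ b w = Writable-mono (λ {σ} → Z.stock-grows σ) (Z.InW-sound b w)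

      good : Good t → Good t′
      good (P , S⊆P , P⊆ , sat , F) = P , S⊆P , (λ σ h → Z.stock-grows σ (P⊆ σ h)) , sat ,
        λ μ r → Z.F-complete μ (Reach-mono {Writable (λ σ → T (P σ))} {InW t′}
          (λ {b} w → Z.InW-complete b (Writable-mono (λ {σ} → P⊆ σ) w)) r)
      -- If a value becomes writable, the count rises. Otherwise the graph of `Stock t` is no larger
      -- than the one for which the previous round closed it, so `Stock t` is saturated.
      closing : ∀ {j} → (∀ σ → Stock s σ → Stock t σ) → Closing j t → Good t′ ⊎ Closing (suc j) t′
      closing {j} grows (j≤ , closed , W-sound) = case new-or-none D (arrs t 3) (arrs t′ 3) of λ
        { (inj₁ (b , b<D , new , old)) → inj₂ (≤-trans (s≤s j≤) (count-strict D W-grows b<D old new) , Z.stock-closed , W⊆)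
        ; (inj₂ none) → inj₁ (P , (λ σ h → ≢0⇒positive (grows σ h)) , (λ σ h → Z.stock-grows σ (P⇒ σ h)) ,
            (λ q a l σ σ′ to from m e tr → ≢0⇒positive (closed q a l σ σ′
              (Reach-mono {Writable (λ σ → T (P σ))} {InW t} (λ {b} → back none b) to)
              (Reach-mono {Writable (λ σ → T (P σ))} {InW t} (λ {b} → back none b) from) (P⇒ σ m) e tr)) ,
            λ μ r → Z.F-complete μ (Reach-mono {Writable (λ σ → T (P σ))} {InW t′} (λ {b} w → Z.InW-complete b (P-W w)) r)) }
        where
        P : Fin |Q_C| → Bool
        P σ = positive? (arrs t 2 (toℕ σ))
        P⇒ : ∀ σ → T (P σ) → Stock t σ
        P⇒ σ = positive⇒≢0
        P-W : ∀ {b} → Writable (λ σ → T (P σ)) b → Writable (Stock t) b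
        P-W = Writable-mono (λ {σ} → P⇒ σ)
        back : (∀ b → b < D → arrs t′ 3 b ≢ 0 → arrs t 3 b ≢ 0) → ∀ b → Writable (λ σ → T (P σ)) b → InW t b
        back none b w = none (toℕ b) (Fin.toℕ<n b) (Z.InW-complete b (P-W w))
        W-grows : ∀ x → x < D → arrs t 3 x ≢ 0 → arrs t′ 3 x ≢ 0
        W-grows x x<D h with as-fin x<D
        ... | b , refl = Z.InW-complete b (W-sound b h)
      progress′ : (∀ σ → Stock s σ → Stock t σ) → Good t ⊎ i ≡ 0 ⊎ (∃[ j ] i ≡ suc j × Closing j t) →
        Good t′ ⊎ suc i ≡ 0 ⊎ (∃[ j ] suc i ≡ suc j × Closing j t′)
      progress′ grows (inj₁ g) = inj₁ (good g)
      progress′ grows (inj₂ (inj₁ refl)) = inj₂ (inj₂ (0 , refl , z≤n , Z.stock-closed , W⊆))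
      progress′ grows (inj₂ (inj₂ (j , refl , c))) = case closing grows c of λ
        { (inj₁ g)  → inj₁ g
        ; (inj₂ c′) → inj₂ (inj₂ (suc j , refl , c′)) }

      step : Inv i t → Inv (suc i) t′
      step (inv ctx at grows supplied F-sound progress) = inv Z.ctx Z.at (λ σ h → Z.stock-grows σ (grows σ h))
        (λ S → Z.supplied (supplied S))
        (inj₂ λ μ f → Reach-mono {InW t′} {Writable (Stock t′)} (λ {b} w → W⊆ b w) (Z.F-sound μ f)) (progress′ grows progress)

    Inv-setV : ∀ i j t → Inv i t → Inv i (setV 36 j t)
    Inv-setV i j t V = inv (Context-run (set 36 (lit j)) {t} tt tt ctx) at grows supplied F-sound progress
      where open Inv V

    final : Inv (labelCount D) (run component s)
    final = subst (λ n → Inv n (run component s)) (has-M X) (for-inv Inv 36 5 saturate s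
      (inv X at-ν (λ _ → id) id (inj₁ refl) (inj₂ (inj₁ refl)))
      λ i t _ V → let V′ = Inv-setV i i t V in
        Step.step i (setV 36 i t) _ (saturate-saturates (setV 36 i t) ν (Inv.ctx V′) (Inv.at V′)) V′)

  -- Soundness is expressed by supply. Completeness is relative to any `S₀` inside the stock, since
  -- of the base of a chain only its inclusion in the stock is maintained.
  record Explores (ν : Node) (s s′ : State) : Set₁ where
    field
      ctx          : Context s′
      at           : vars s′ 17 ≡ index ν
      supplied     : Supplied ν (Stock s) → Supplied ν (Stock s′)
      F-supplied   : Supplied ν (Stock s) → ∀ μ → InF s′ μ → Supplied μ (Stock s′)
      Saturation⊆  : ∀ (S₀ : Fin |Q_C| → Set) → (∀ σ → S₀ σ → Stock s σ) → ∀ σ → Saturation ν S₀ σ → Stock s′ σ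
      F-complete   : ∀ (S₀ : Fin |Q_C| → Set) → (∀ σ → S₀ σ → Stock s σ) →
        ∀ μ → Reach (Writable (Saturation ν S₀)) ν μ → InF s′ μ

  module _ (ν : Node) (s : State) (X : Context s) (at-ν : vars s 17 ≡ index ν) where
    open Component s X ν at-ν

    Inv⇒Explores : ∀ s′ → Inv (labelCount D) s′ → Explores ν s s′
    Inv⇒Explores s′ V = record
      { ctx = Inv.ctx V ; at = Inv.at V ; supplied = Inv.supplied V
      ; F-supplied = λ S μ f → Supplied-reach (F-sound μ f) (Inv.supplied V S)
      ; Saturation⊆ = λ S₀ S₀⊆ σ h → let (P , S⊆P , P⊆ , sat , F) = good in
          P⊆ σ (h P (λ {x} x∈ → S⊆P x (S₀⊆ x x∈)) sat)
      ; F-complete = λ S₀ S₀⊆ μ r → let (P , S⊆P , P⊆ , sat , F) = good in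
          F μ (Reach-mono {Writable (Saturation ν S₀)} {Writable (λ σ → T (P σ))}
            (Writable-mono {Saturation ν S₀} {λ σ → T (P σ)} λ {σ} h → h P (λ {x} x∈ → S⊆P x (S₀⊆ x x∈)) sat) r)
      }
      where
      F-sound : ∀ μ → InF s′ μ → Reach (Writable (Stock s′)) ν μ
      F-sound with Inv.F-sound V
      ... | inj₂ h = h
      good : Good s′
      good with Inv.progress V
      ... | inj₁ g = g
      -- Without stabilisation, `2 D + 1` rounds would make `2 D` out of `D` values writable.
      ... | inj₂ (inj₂ (_ , refl , D+D≤ , _)) = ⊥-elim (<⇒≱ (≤-trans (+-monoˡ-≤ D D≥1) D+D≤) (count-≤ D (arrs s′ 3)))

    component-explores : Explores ν s (run component s)
    component-explores = Inv⇒Explores (run component s) final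

  record Sound (i : ℕ) (s : State) : Set where
    constructor snd
    field
      ctx      : Context s
      node     : Node
      at       : vars s 17 ≡ index node
      supplied : Supplied node (Stock s)
      F-sound  : i ≡ 0 ⊎ (∀ μ → InF s μ → Supplied μ (Stock s))

  Digits : State → Set
  Digits s = ∀ i → i < N → arrs s 5 i < N

  -- An unreachable letter leaves the node where it is, and a reachable one is a node at which the
  -- stock can be supplied; the word needs no further property than being in range.
  pick-sound : ∀ {i ν} s t → Explores ν s t → Supplied ν (Stock s) → arrs t 5 (vars t 32) < N → Sound (suc i) (run pick t)
  pick-sound {i} {ν} s t Z S word<N = run-cond (Sound (suc i)) (arr 0 (arr 5 (var 32))) (set 17 (arr 5 (var 32))) nop t
      (λ f → let (μ , e) = as-node word<N in
        snd (Context-run (set 17 (arr 5 (var 32))) {t} tt tt Z.ctx) μ (sym e)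
          (Z.F-supplied S μ (subst (λ j → arrs t 0 j ≢ 0) (sym e) f)) (inj₂ (Z.F-supplied S)))
      λ _ → snd Z.ctx ν Z.at (Z.supplied S) (inj₂ (Z.F-supplied S))
    where module Z = Explores Z

  word-unchanged : ∀ s → arrs (run component s) 5 (vars (run component s) 32) ≡ arrs s 5 (vars s 32)
  word-unchanged s = trans (arrs-frame component s refl (vars (run component s) 32)) (cong (arrs s 5) (vars-frame component s refl))

  letter-sound : ∀ i s → i < N → Digits s → Sound i s → Sound (suc i) (run letter (setV 32 i s))
  letter-sound i s i<N digits (snd ctx ν at S F) =
    pick-sound (setV 32 i s) (run component (setV 32 i s))
      (component-explores ν (setV 32 i s) (Context-run (set 32 (lit i)) {s} tt tt ctx) at) S
      (subst (_< N) (sym (word-unchanged (setV 32 i s))) (digits i i<N))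

  -- The state before a letter, when only `base ρ` is guaranteed. `After` is the state behind it,
  -- when the component has been saturated and the node replaced, while array 0 still describes the
  -- component just left or kept.
  record Follows (ρ : List Node) (s : State) : Set where
    constructor flw
    field
      ctx   : Context s
      at    : vars s 17 ≡ index (current ρ)
      stk   : ∀ σ → base ρ σ → Stock s σ

  record After (ρ : List Node) (μ : Node) (t : State) : Set where
    constructor aft
    field
      ctx : Context t
      at  : vars t 17 ≡ index μ
      stk : ∀ σ → stock ρ σ → Stock t σ
      F   : ∀ μ → Reachᶜ ρ (current ρ) μ → InF t μ

  pick-after : ∀ ρ μ s t → Explores (current ρ) s t → (∀ σ → base ρ σ → Stock s σ) →
    arrs t 5 (vars t 32) ≡ index μ → Reachᶜ ρ (current ρ) μ → After ρ μ (run pick t)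
  pick-after ρ μ s t Z base⊆ word reach =
    run-cond (After ρ μ) (arr 0 (arr 5 (var 32))) (set 17 (arr 5 (var 32))) nop t
      (λ _ → aft (Context-run (set 17 (arr 5 (var 32))) {t} tt tt Z.ctx) word
        (Z.Saturation⊆ (base ρ) base⊆) (Z.F-complete (base ρ) base⊆))
      λ no → ⊥-elim (Z.F-complete (base ρ) base⊆ μ reach (trans (cong (arrs t 0) (sym word)) no))
    where module Z = Explores Z

  letter-after : ∀ ρ μ i s → Follows ρ s → arrs s 5 i ≡ index μ → Reachᶜ ρ (current ρ) μ →
    After ρ μ (run letter (setV 32 i s))
  letter-after ρ μ i s (flw ctx at base⊆) word =
    pick-after ρ μ (setV 32 i s) (run component (setV 32 i s))
      (component-explores (current ρ) (setV 32 i s) (Context-run (set 32 (lit i)) {s} tt tt ctx) at) base⊆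
      (trans (word-unchanged (setV 32 i s)) word)

  check-sound : ∀ s → Context s → (∀ μ → InF s μ → Supplied μ (Stock s)) →
    vars (run check s) 16 ≡ vars s 16 ⊎ (vars (run check s) 16 ≡ 1 × LCR I)
  check-sound s X F = proj₂ (proj₂ (for-inv P 18 4 checkNode s (X , (λ _ _ → refl) , inj₁ refl) step))
    where
    P : ℕ → State → Set
    P i t = Context t × (∀ j x → arrs t j x ≡ arrs s j x) × (vars t 16 ≡ vars s 16 ⊎ (vars t 16 ≡ 1 × LCR I))
    step : ∀ i t → i < vars s 4 → P i t → P (suc i) (run checkNode (setV 18 i t))
    step i t i<n (X′ , same , flag) with as-node (subst (i <_) (has-N X) i<n)
    ... | (q , a) , refl = Context-run (set 18 (lit i) ⍮ checkNode) {t} tt tt X′ ,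
      (λ j x → trans (arrs-frame checkNode (setV 18 i t) refl x) (same j x)) ,
      run-cond (λ u → vars u 16 ≡ vars s 16 ⊎ (vars u 16 ≡ 1 × LCR I)) (arr 0 (var 18)) raiseFlag nop (setV 18 i t)
        (λ f → run-cond (λ u → vars u 16 ≡ vars s 16 ⊎ (vars u 16 ≡ 1 × LCR I)) (arr 8 (var 10 ⊞ arr 9 (var 18))) (set 16 (lit 1)) nop (setV 18 i t)
          (λ u → inj₂ (refl , Supplied-unsafe {P = Stock s} (F (q , a) (subst (_≢ 0) (same 0 i) f))
            (Vec.lookup⇒[]= q unsafe (bit-sound (has-unsafe X′ q) (subst (λ j → arrs t 8 (vars t 10 + j) ≢ 0) (node-q X′ q a) u)))))
          λ _ → flag)
        λ _ → flag

  check-complete : ∀ s → Context s → ∀ q a → InF s (q , a) → q ∈ unsafe → vars (run check s) 16 ≡ 1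
  check-complete s X q a f bad = for-hit P (λ t → vars t 16 ≡ 1) 18 4 checkNode s i
    (subst (i <_) (sym (has-N X)) (index-< (q , a))) (X , (λ _ _ → refl))
    (λ j t _ (X′ , same) → Context-run (set 18 (lit j) ⍮ checkNode) {t} tt tt X′ ,
      (λ k x → trans (arrs-frame checkNode (setV 18 j t) refl x) (same k x)))
    (λ t (X′ , same) → run-cond (λ u → vars u 16 ≡ 1) (arr 0 (var 18)) raiseFlag nop (setV 18 i t)
      (λ _ → run-cond (λ u → vars u 16 ≡ 1) (arr 8 (var 10 ⊞ arr 9 (var 18))) (set 16 (lit 1)) nop (setV 18 i t)
        (λ _ → refl)
        λ no → ⊥-elim (bit-complete (has-unsafe X′ q) (Vec.[]=⇒lookup bad) (trans (cong (λ j → arrs t 8 (vars t 10 + j)) (sym (node-q X′ q a))) no)))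
      λ no → ⊥-elim (f (trans (sym (same 0 i)) no)))
    λ j t _ _ h → run-cond (λ u → vars u 16 ≡ 1) (arr 0 (var 18)) raiseFlag nop (setV 18 j t)
      (λ _ → run-cond (λ u → vars u 16 ≡ 1) (arr 8 (var 10 ⊞ arr 9 (var 18))) (set 16 (lit 1)) nop (setV 18 j t) (λ _ → refl) (λ _ → h))
      (λ _ → h)
    where
    i = index (q , a)
    P : State → Set
    P t = Context t × (∀ j x → arrs t j x ≡ arrs s j x)

-- Enumerating all words by counting in base `L D`.

increment search : Com
increment =
  set 33 (lit 1) ⍮
  for 18 4 (set 34 (arr 5 (var 18) ⊞ var 33) ⍮
    cond (var 4 ⊟ var 34) (put 5 (var 18) (var 34) ⍮ set 33 (lit 0)) (put 5 (var 18) (lit 0)))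
search = for 35 6 (candidate ⍮ increment)

value : ℕ → ℕ → (ℕ → ℕ) → ℕ
value b zero    f = 0
value b (suc n) f = value b n f + f n * b ^ n

value-cong : ∀ b n {f g} → (∀ i → i < n → f i ≡ g i) → value b n f ≡ value b n g
value-cong b zero    h = refl
value-cong b (suc n) h = cong₂ _+_ (value-cong b n λ i i<n → h i (m≤n⇒m≤1+n i<n)) (cong (_* b ^ n) (h n ≤-refl))

value-zero : ∀ b n {f} → (∀ i → i < n → f i ≡ 0) → value b n f ≡ 0
value-zero b zero    h = refl
value-zero b (suc n) h = cong₂ _+_ (value-zero b n λ i i<n → h i (m≤n⇒m≤1+n i<n)) (cong (_* b ^ n) (h n ≤-refl))

value-< : ∀ b n {f} → (∀ i → i < n → f i < b) → value b n f < b ^ n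
value-< b zero    h = s≤s z≤n
value-< b (suc n) {f} h =
  ≤-trans (+-monoˡ-≤ (f n * b ^ n) (value-< b n λ i i<n → h i (m≤n⇒m≤1+n i<n))) (*-monoˡ-≤ (b ^ n) (h n ≤-refl))

-- A remainder below `b ^ n` cannot make up for a smaller leading digit.
digit-≤ : ∀ {b n x y v w} → v < b ^ n → v + x * b ^ n ≡ w + y * b ^ n → y ≤ x
digit-≤ {b} {n} {x} {y} {v} {w} v< eq = ≮⇒≥ λ x<y → <-irrefl eq
  (<-≤-trans (+-monoˡ-< (x * b ^ n) v<) (≤-trans (*-monoˡ-≤ (b ^ n) x<y) (m≤n+m (y * b ^ n) w)))

leading-digit : ∀ b n {f g} → (∀ i → i < suc n → f i < b) → (∀ i → i < suc n → g i < b) →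
  value b (suc n) f ≡ value b (suc n) g → f n ≡ g n
leading-digit b n hf hg eq =
  ≤-antisym (digit-≤ {b} {n} (value-< b n λ j j<n → hg j (m≤n⇒m≤1+n j<n)) (sym eq))
            (digit-≤ {b} {n} (value-< b n λ j j<n → hf j (m≤n⇒m≤1+n j<n)) eq)

value-injective : ∀ b n {f g} → (∀ i → i < n → f i < b) → (∀ i → i < n → g i < b) →
  value b n f ≡ value b n g → ∀ i → i < n → f i ≡ g i
value-injective b (suc n) {f} {g} hf hg eq i i<1+n with i ≟ n
... | yes refl = leading-digit b n hf hg eq
... | no i≢n = value-injective b n (λ j j<n → hf j (m≤n⇒m≤1+n j<n)) (λ j j<n → hg j (m≤n⇒m≤1+n j<n))
    (+-cancelʳ-≡ (f n * b ^ n) (value b n f) (value b n g)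
      (trans eq (cong (λ d → value b n g + d * b ^ n) (sym (leading-digit b n hf hg eq)))))
    i (≤∧≢⇒< (≤-pred i<1+n) i≢n)

module Enumerate (I : Instance) where
  open Instance I
  open Model I
  open Search I
  open Candidate I
  open Context

  -- The word of a chain, earliest node first, padded with the latest.
  letterOf : List Node → ℕ → Node
  letterOf []      i = ν₀
  letterOf (ν ∷ ρ) i = if i <ᵇ length ρ then letterOf ρ i else ν

  <ᵇ-true : ∀ {m n} → m < n → (m <ᵇ n) ≡ true
  <ᵇ-true {m} {n} m<n with m <ᵇ n | <⇒<ᵇ m<n
  ... | true | _ = refl

  <ᵇ-false : ∀ {m n} → n ≤ m → (m <ᵇ n) ≡ false
  <ᵇ-false {m} {n} n≤m with m <ᵇ n in eq
  ... | false = refl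
  ... | true  = ⊥-elim (<⇒≱ (<ᵇ⇒< m n (subst T (sym eq) tt)) n≤m)

  letterOf-early : ∀ ν ρ i → i < length ρ → letterOf (ν ∷ ρ) i ≡ letterOf ρ i
  letterOf-early ν ρ i i< rewrite <ᵇ-true i< = refl

  letterOf-late : ∀ ν ρ i → length ρ ≤ i → letterOf (ν ∷ ρ) i ≡ ν
  letterOf-late ν ρ i ≤i rewrite <ᵇ-false ≤i = refl

  letterOf-current : ∀ ρ i → length ρ ≤ i → letterOf ρ i ≡ current ρ
  letterOf-current []      i _  = refl
  letterOf-current (ν ∷ ρ) i ≤i = letterOf-late ν ρ i (≤-trans (n≤1+n _) ≤i)

  start : Com
  start = set 17 (var 14) ⍮ clear 2 3 ⍮ put 2 (var 13) (lit 1)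

  module Run (s : State) (X : Context s) where

    t : State
    t = run start s

    X-t : Context t
    X-t = Context-run start {s} tt tt X

    at-t : vars t 17 ≡ index ν₀
    at-t = trans (vars-frame (clear 2 3 ⍮ put 2 (var 13) (lit 1)) (setV 17 (vars s 14) s) refl) (has-ν₀ X)

    u : State
    u = run (clear 2 3) (setV 17 (vars s 14) s)

    q⁰-u : vars u 13 ≡ toℕ (q⁰ contributor)
    q⁰-u = trans (vars-frame (clear 2 3) (setV 17 (vars s 14) s) refl) (has-q⁰ X)

    stock-sound : ∀ σ → Stock t σ → σ ≡ q⁰ contributor
    stock-sound σ h = case put-sound 2 (vars u 13) u (toℕ σ) h of λ
      { (inj₁ eq)  → Fin.toℕ-injective (trans eq q⁰-u)
      ; (inj₂ old) → ⊥-elim (old (cleared 2 3 (setV 17 (vars s 14) s) (toℕ σ)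
          (subst (toℕ σ <_) (sym (has-C X)) (Fin.toℕ<n σ)))) }

    stock-complete : ∀ σ → σ ≡ q⁰ contributor → Stock t σ
    stock-complete σ refl = subst (λ x → arrs t 2 x ≢ 0) q⁰-u (put-hit 2 (vars u 13) u)

    after : ℕ → State
    after i = up i (λ i s′ → run letter (setV 32 i s′)) t

    word-after : ∀ i x → arrs (after i) 5 x ≡ arrs s 5 x
    word-after i = up-inv′ (λ s′ → ∀ x → arrs s′ 5 x ≡ arrs s 5 x) i (arrs-frame start s refl)
      λ j s′ h x → trans (arrs-frame letter (setV 32 j s′) refl x) (h x)

    flag-after : ∀ i → vars (after i) 16 ≡ vars s 16
    flag-after i = up-inv′ (λ s′ → vars s′ 16 ≡ vars s 16) i (vars-frame start s refl)
      λ j s′ h → trans (vars-frame letter (setV 32 j s′) refl) h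

    sound-after : Digits s → ∀ i → i ≤ N → Sound i (after i)
    sound-after digits zero    _   = snd X-t ν₀ at-t (Supplied-mono stock-sound Supplied-initial) (inj₁ refl)
    sound-after digits (suc i) i<N = letter-sound i (after i) i<N
      (λ j j<N → subst (_< N) (sym (word-after i j)) (digits j j<N)) (sound-after digits i (<⇒≤ i<N))

    next : ∀ ρ i → Follows ρ (after i) → ∀ μ → Reachᶜ ρ (current ρ) μ → arrs s 5 i ≡ index μ →
      After ρ μ (after (suc i))
    next ρ i F μ reach word-i = letter-after ρ μ i (after i) F (trans (word-after i i) word-i) reach

    repeat : ∀ ρ {s′} → After ρ (current ρ) s′ → Follows ρ s′
    repeat ρ (aft ctx at stk F) = flw ctx at λ σ b → stk σ (⊆-Saturation {current ρ} {base ρ} b)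

    enter : ∀ ν ρ {s′} → After ρ ν s′ → Follows (ν ∷ ρ) s′
    enter ν ρ (aft ctx at stk F) = flw ctx at stk

    -- `d` counts padding letters. Each names the current node again and merely repeats the
    -- saturation; once they are peeled off, the last letter is the one that enters the head of the
    -- chain.
    follow : ∀ ρ d → Chain ρ → (∀ j → j < d + length ρ → arrs s 5 j ≡ index (letterOf ρ j)) →
      Follows ρ (after (d + length ρ))
    follow ρ (suc d) chain word = repeat ρ (next ρ (d + length ρ)
      (follow ρ d chain λ j j<i → word j (m≤n⇒m≤1+n j<i)) (current ρ) ε*
      (trans (word (d + length ρ) ≤-refl) (cong index (letterOf-current ρ (d + length ρ) (m≤n+m (length ρ) d)))))
    follow []      zero chain word = flw X-t at-t stock-complete
    follow (ν ∷ ρ) zero chain word = enter ν ρ (next ρ (length ρ)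
      (follow ρ 0 (proj₁ chain) λ j j<i → trans (word j (m≤n⇒m≤1+n j<i)) (cong index (letterOf-early ν ρ j j<i)))
      ν (proj₁ (proj₂ chain)) (trans (word (length ρ) ≤-refl) (cong index (letterOf-late ν ρ (length ρ) ≤-refl))))

    final : run candidate s ≡ run check (after N)
    final = cong (λ n → run check (after n)) (has-N X-t)

    check-after : ∀ u → vars u 16 ≡ vars s 16 → Sound N u →
      vars (run check u) 16 ≡ vars s 16 ⊎ (vars (run check u) 16 ≡ 1 × LCR I)
    check-after u same (snd _   _ _ _ (inj₁ N≡0)) = ⊥-elim (m<n⇒n≢0 (index-< ν₀) N≡0)
    check-after u same (snd ctx _ _ _ (inj₂ F))   = case check-sound u ctx F of λ
      { (inj₁ p) → inj₁ (trans p same)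
      ; (inj₂ h) → inj₂ h }

    candidate-sound : Digits s →
      vars (run candidate s) 16 ≡ vars s 16 ⊎ (vars (run candidate s) 16 ≡ 1 × LCR I)
    candidate-sound digits = subst (λ u → vars u 16 ≡ vars s 16 ⊎ (vars u 16 ≡ 1 × LCR I)) (sym final)
      (check-after (after N) (flag-after N) (sound-after digits N ≤-refl))

    candidate-complete : ∀ ρ → Succeeds ρ → (∀ j → j < N → arrs s 5 j ≡ index (letterOf ρ j)) →
      vars (run candidate s) 16 ≡ 1
    candidate-complete ρ (chain , q , a , reach , bad) word = subst (λ u → vars u 16 ≡ 1) (sym final)
      (subst (λ n → vars (run check (after n)) 16 ≡ 1) M<N
        (check-complete (after (suc M)) (After.ctx A) q a (After.F A (q , a) reach) bad))
      where
      -- The last letter is set aside. By the strict length bound it is padding, and its round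
      -- saturates the final component and fills array 0 with the nodes that `check` inspects.
      M : ℕ
      M = pred N
      M<N : suc M ≡ N
      M<N = suc-pred N ⦃ >-nonZero (≤-<-trans z≤n (Chain⇒short ρ chain)) ⦄
      long : length ρ ≤ M
      long = ≤-pred (subst (length ρ <_) (sym M<N) (Chain⇒short ρ chain))
      F : Follows ρ (after M)
      F = subst (λ i → Follows ρ (after i)) (m∸n+n≡m long) (follow ρ (M ∸ length ρ) chain λ j j<i →
        word j (≤-trans (≤-trans j<i (≤-reflexive (m∸n+n≡m long))) (≤-trans (n≤1+n M) (≤-reflexive M<N))))
      A : After ρ (current ρ) (after (suc M))
      A = next ρ M F (current ρ) ε* (trans (word M (≤-reflexive M<N)) (cong index (letterOf-current ρ M long)))

  module Increment (s : State) (N≡ : vars s 4 ≡ N) (digits : Digits s) where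

    digit advance : Com
    digit = cond (var 4 ⊟ var 34) (put 5 (var 18) (var 34) ⍮ set 33 (lit 0)) (put 5 (var 18) (lit 0))
    advance = set 34 (arr 5 (var 18) ⊞ var 33) ⍮ digit

    f : ℕ → ℕ
    f = arrs s 5

    record Inv (i : ℕ) (s′ : State) : Set where
      constructor inv
      field
        N≡′    : vars s′ 4 ≡ N
        carry  : vars s′ 33 ≤ 1
        lower  : ∀ j → j < i → arrs s′ 5 j < N
        upper  : ∀ j → i ≤ j → arrs s′ 5 j ≡ f j
        total  : value N i (arrs s′ 5) + vars s′ 33 * N ^ i ≡ suc (value N i f)

    step : ∀ i s′ → i < N → Inv i s′ → Inv (suc i) (run advance (setV 18 i s′))
    step i s′ i<N (inv N≡′ carry lower upper total) = run-cond (Inv (suc i)) (var 4 ⊟ var 34)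
        (put 5 (var 18) (var 34) ⍮ set 33 (lit 0)) (put 5 (var 18) (lit 0)) t
        (λ fits → inv N≡′ z≤n (lower′ w (w<N fits)) (upper′ w) (begin
          value N i (g [ i ↦ w ]) + (g [ i ↦ w ]) i * N ^ i + 0
            ≡⟨ +-identityʳ _ ⟩
          value N i (g [ i ↦ w ]) + (g [ i ↦ w ]) i * N ^ i
            ≡⟨ cong₂ (λ v d → v + d * N ^ i) (value-g w) (update-same g i) ⟩
          value N i g + (g i + c) * N ^ i
            ≡⟨ solve 4 (λ v x c p → v :+ (x :+ c) :* p := v :+ c :* p :+ x :* p) refl (value N i g) (g i) c (N ^ i) ⟩
          value N i g + c * N ^ i + g i * N ^ i
            ≡⟨ cong₂ (λ v d → v + d * N ^ i) total (upper i ≤-refl) ⟩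
          suc (value N (suc i) f) ∎))
        λ full → inv N≡′ carry (lower′ 0 (≤-<-trans z≤n i<N)) (upper′ 0) (begin
          value N i (g [ i ↦ 0 ]) + (g [ i ↦ 0 ]) i * N ^ i + c * (N * N ^ i)
            ≡⟨ cong₂ (λ v d → v + d * N ^ i + c * (N * N ^ i)) (value-g 0) (update-same g i) ⟩
          value N i g + 0 + c * (N * N ^ i)
            ≡⟨ cong₂ (λ v z → v + z) (+-identityʳ _) (trans (cong (_* (N * N ^ i)) (c≡1 full)) (trans (+-identityʳ _) (cong (_* N ^ i) (sym (w≡N full))))) ⟩
          value N i g + (g i + c) * N ^ i
            ≡⟨ solve 4 (λ v x c p → v :+ (x :+ c) :* p := v :+ c :* p :+ x :* p) refl (value N i g) (g i) c (N ^ i) ⟩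
          value N i g + c * N ^ i + g i * N ^ i
            ≡⟨ cong₂ (λ v d → v + d * N ^ i) total (upper i ≤-refl) ⟩
          suc (value N (suc i) f) ∎)
      where
      open ≡-Reasoning
      open +-*-Solver using (solve; _:+_; _:*_; _:=_)
      g : ℕ → ℕ
      g = arrs s′ 5
      c w : ℕ
      c = vars s′ 33
      w = g i + c
      t : State
      t = setV 34 w (setV 18 i s′)
      gi<N : g i < N
      gi<N = subst (_< N) (sym (upper i ≤-refl)) (digits i i<N)
      w<N : vars s′ 4 ∸ w ≢ 0 → w < N
      w<N fits = ≰⇒> λ N≤w → fits (m≤n⇒m∸n≡0 (subst (_≤ w) (sym N≡′) N≤w))
      N≤w : vars s′ 4 ∸ w ≡ 0 → N ≤ w
      N≤w full = subst (_≤ w) N≡′ (m∸n≡0⇒m≤n full)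
      -- Digit below `N` and carry at most 1: a sum that does not fit is exactly `N`, so the digit
      -- becomes 0 and the carry remains.
      w≡N : vars s′ 4 ∸ w ≡ 0 → w ≡ N
      w≡N full = ≤-antisym (≤-trans (+-monoʳ-≤ (g i) carry) (≤-trans (≤-reflexive (+-comm (g i) 1)) gi<N)) (N≤w full)
      c≡1 : vars s′ 4 ∸ w ≡ 0 → c ≡ 1
      c≡1 full = ≤-antisym carry (n≢0⇒n>0 λ c≡0 → <⇒≱ gi<N
        (subst (N ≤_) (trans (cong (g i +_) c≡0) (+-identityʳ (g i))) (N≤w full)))
      lower′ : ∀ v → v < N → ∀ j → j < suc i → (g [ i ↦ v ]) j < N
      lower′ v v<N j j<1+i with i ≟ j
      ... | yes refl = subst (_< N) (sym (update-same g i)) v<N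
      ... | no i≢j = subst (_< N) (sym (update-other g i≢j)) (lower j (≤∧≢⇒< (≤-pred j<1+i) (≢-sym i≢j)))
      upper′ : ∀ v j → suc i ≤ j → (g [ i ↦ v ]) j ≡ f j
      upper′ v j i<j = trans (update-other g (<⇒≢ i<j)) (upper j (<⇒≤ i<j))
      value-g : ∀ v → value N i (g [ i ↦ v ]) ≡ value N i g
      value-g v = value-cong N i λ j j<i → update-other g (≢-sym (<⇒≢ j<i))

    final : Inv N (run increment s)
    final = subst (λ n → Inv n (run increment s)) N≡
      (for-inv Inv 18 4 advance (setV 33 1 s) (inv N≡ ≤-refl (λ _ ()) (λ _ _ → refl) refl)
        λ i s′ i<n → step i s′ (subst (i <_) N≡ i<n))

    Digits-increment : Digits (run increment s)
    Digits-increment = Inv.lower final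

    -- A carry out of the last digit would contribute at least `N ^ N` to the total.
    value-increment : suc (value N N f) < N ^ N → value N N (arrs (run increment s) 5) ≡ suc (value N N f)
    value-increment = no-overflow _ (vars (run increment s) 33) (Inv.total final)
      where
      no-overflow : ∀ v c {x b} → v + c * b ≡ x → x < b → v ≡ x
      no-overflow v zero    eq x<b = trans (sym (+-identityʳ v)) eq
      no-overflow v (suc c) {b = b} eq x<b =
        ⊥-elim (<⇒≱ x<b (≤-trans (≤-trans (m≤m+n b (c * b)) (m≤n+m (b + c * b) v)) (≤-reflexive eq)))

  module Main (s : State) (X : Context s) (T≡ : vars s 6 ≡ N ^ N)
    (flag≡0 : vars s 16 ≡ 0) (zeros : ∀ i → i < N → arrs s 5 i ≡ 0) where

    record Inv (j : ℕ) (s′ : State) : Set where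
      constructor inv
      field
        ctx    : Context s′
        digits : Digits s′
        word   : j < N ^ N → value N N (arrs s′ 5) ≡ j
        flag   : vars s′ 16 ≡ 0 ⊎ (vars s′ 16 ≡ 1 × LCR I)
        hit    : ∀ ρ → Succeeds ρ → value N N (λ i → index (letterOf ρ i)) < j → vars s′ 16 ≡ 1

    advance : ∀ j t t′ → j < N ^ N → Inv j t →
      Context t′ → (∀ x → arrs t′ 5 x ≡ arrs t 5 x) →
      vars t′ 16 ≡ vars t 16 ⊎ (vars t′ 16 ≡ 1 × LCR I) →
      (∀ ρ → Succeeds ρ → (∀ j → j < N → arrs t 5 j ≡ index (letterOf ρ j)) → vars t′ 16 ≡ 1) →
      Inv (suc j) (run increment t′)
    advance j t t′ j<T (inv ctx digits word flag hit) ctx′ same sound complete =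
      inv (Context-run increment {t′} tt tt ctx′) Inc.Digits-increment
        (λ 1+j<T → trans (Inc.value-increment (subst (λ v → suc v < N ^ N) (sym value-t′) 1+j<T)) (cong suc value-t′))
        (flag-of sound flag) hit′
      where
      digits′ : Digits t′
      digits′ i i<N = subst (_< N) (sym (same i)) (digits i i<N)
      module Inc = Increment t′ (has-N ctx′) digits′
      value-t′ : value N N (arrs t′ 5) ≡ j
      value-t′ = trans (value-cong N N λ i _ → same i) (word j<T)
      flag≡ : vars (run increment t′) 16 ≡ vars t′ 16
      flag≡ = vars-frame increment t′ refl
      flag-of : vars t′ 16 ≡ vars t 16 ⊎ (vars t′ 16 ≡ 1 × LCR I) → vars t 16 ≡ 0 ⊎ (vars t 16 ≡ 1 × LCR I) →
        vars (run increment t′) 16 ≡ 0 ⊎ (vars (run increment t′) 16 ≡ 1 × LCR I)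
      flag-of (inj₂ (p , l)) _             = inj₂ (trans flag≡ p , l)
      flag-of (inj₁ p) (inj₁ q)            = inj₁ (trans flag≡ (trans p q))
      flag-of (inj₁ p) (inj₂ (q , l))      = inj₂ (trans flag≡ (trans p q) , l)
      hit′ : ∀ ρ → Succeeds ρ → value N N (λ i → index (letterOf ρ i)) < suc j → vars (run increment t′) 16 ≡ 1
      -- Words of equal value are equal, so the chain whose word has value `j` is tested in this
      -- very round; those of smaller value have already raised the flag, which is never lowered.
      hit′ ρ S v<1+j = trans flag≡ (case value N N (λ i → index (letterOf ρ i)) ≟ j of λ
        { (yes v≡j) → complete ρ S (value-injective N N digits (λ i _ → index-< (letterOf ρ i))
            (trans (word j<T) (sym v≡j)))
        ; (no v≢j) → keep v≢j sound })
        where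
        keep : value N N (λ i → index (letterOf ρ i)) ≢ j → vars t′ 16 ≡ vars t 16 ⊎ (vars t′ 16 ≡ 1 × LCR I) → vars t′ 16 ≡ 1
        keep v≢j (inj₁ p)       = trans p (hit ρ S (≤∧≢⇒< (≤-pred v<1+j) v≢j))
        keep v≢j (inj₂ (p , _)) = p

    step : ∀ j t → j < N ^ N → Inv j t → Inv (suc j) (run (candidate ⍮ increment) (setV 35 j t))
    step j t j<T V = advance j t (run candidate t₁) j<T V (Context-run candidate {t₁} tt tt X₁)
      (arrs-frame candidate t₁ refl) (Run.candidate-sound t₁ X₁ (Inv.digits V)) (Run.candidate-complete t₁ X₁)
      where
      t₁ : State
      t₁ = setV 35 j t
      X₁ : Context t₁
      X₁ = Context-run (set 35 (lit j)) {t} tt tt (Inv.ctx V)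

    final : Inv (N ^ N) (run search s)
    final = subst (λ n → Inv n (run search s)) T≡ (for-inv Inv 35 6 (candidate ⍮ increment) s
      (inv X (λ i i<N → subst (_< N) (sym (zeros i i<N)) (≤-<-trans z≤n i<N))
        (λ _ → value-zero N N zeros) (inj₁ flag≡0) λ _ _ ())
      λ j t j<n → step j t (subst (j <_) T≡ j<n))

    correct : ∀ t → Inv (N ^ N) t → vars t 16 ≡ 1 ⇔ LCR I
    correct t V = mk⇔ to from
      where
      to : vars t 16 ≡ 1 → LCR I
      to p with Inv.flag V
      ... | inj₂ (_ , l) = l
      ... | inj₁ q = contradiction (trans (sym p) q) λ ()
      from : LCR I → vars t 16 ≡ 1
      -- Equality with 1 is decidable, hence stable, which removes the double negation left by the
      -- covering of plays.
      from l = decidable-stable (vars t 16 ≟ 1) λ no → LCR⇒Succeeds l λ (ρ , S) →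
        no (Inv.hit V ρ S (value-< N N λ i _ → index-< (letterOf ρ i)))

    search-correct : vars (run search s) 16 ≡ 1 ⇔ LCR I
    search-correct = correct (run search s) final

-- Setting up the constants and tables of the search.

multiplyBy : ℕ → Com
multiplyBy y = set 21 (lit 0) ⍮ for 22 y (set 21 (var 21 ⊞ var 20)) ⍮ set 20 (var 21)

fill : (k : ℕ) {k<16 : T (k <ᵇ 16)} (n step : ℕ) → Exp → Com
fill k {k<16} n step e =
  set 21 e ⍮ for 18 n (put k {k<16} (var 18) (var 21) ⍮ set 21 (var 21 ⊞ var step))

-- The input is copied behind itself: entry n + x of array 8 receives the
-- contents of address x, where n, in variable 7, is at least the length of the
-- input.
parameters offsets multiples nodes words : Com → Com
parameters c =
  set 1 (raw (lit 0)) ⍮ set 2 (raw (lit 1)) ⍮ set 3 (raw (lit 2)) ⍮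
  set 5 (lit 1 ⊞ (var 1 ⊞ var 1)) ⍮ set 13 (raw (lit 5)) ⍮
  (set 20 (var 2) ⍮ multiplyBy 1) ⍮ set 4 (var 20) ⍮
  (set 20 (raw (lit 4)) ⍮ multiplyBy 1) ⍮ set 14 (var 20 ⊞ raw (lit 3)) ⍮
  (set 20 (var 2) ⍮ multiplyBy 5) ⍮ set 8 (var 20) ⍮
  (set 20 (var 3) ⍮ multiplyBy 5) ⍮ set 9 (var 20) ⍮
  (set 20 (lit 1) ⍮ for 19 4 (multiplyBy 4)) ⍮ set 6 (var 20) ⍮
  (set 20 (var 8) ⍮ multiplyBy 2 ⍮ multiplyBy 3 ⍮ multiplyBy 3) ⍮
  set 7 (var 20 ⊞ var 20 ⊞ var 20 ⊞ var 20 ⊞ var 20 ⊞ var 20 ⊞ var 20 ⊞ var 20 ⊞ var 20) ⍮ c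
offsets c =
  for 18 7 (put 8 (var 7 ⊞ var 18) (raw (var 18))) ⍮
  (set 20 (var 8) ⍮ multiplyBy 2) ⍮
  set 10 (var 7 ⊞ lit 6) ⍮ set 11 (var 10 ⊞ var 2) ⍮ set 12 (var 11 ⊞ var 20) ⍮ c
multiples c = fill 11 2 8 (var 11) ⍮ fill 12 5 2 (lit 0) ⍮ fill 13 3 9 (var 12) ⍮ fill 14 5 3 (lit 0) ⍮ c
nodes c =
  (set 21 (lit 0) ⍮
  for 18 2 (for 19 1 (put 9 (var 21) (var 18) ⍮ put 10 (var 21) (var 19) ⍮ set 21 (var 21 ⊞ lit 1)))) ⍮ c
words c = clear 5 4 ⍮ set 16 (lit 0) ⍮ c

program : Com
program = parameters (offsets (multiples (nodes (words (search ⍮ set 0 (var 16))))))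

multiplyBy-value : ∀ y s → T (y <ᵇ 16) → vars (run (multiplyBy y) s) 20 ≡ vars s 20 * vars s y
multiplyBy-value y s y<16 = trans
  (proj₁ (for-inv (λ i t → vars t 21 ≡ i * vars s 20 × vars t 20 ≡ vars s 20) 22 y (set 21 (var 21 ⊞ var 20)) (setV 21 0 s)
    (refl , refl) λ i t _ (p , q) → trans (cong₂ _+_ p q) (+-comm (i * vars s 20) (vars s 20)) , q))
  (trans (cong (_* vars s 20) (update-other (vars s) (params≢ {21} {y} tt y<16))) (*-comm (vars s y) (vars s 20)))

fill-value : ∀ k {k<16} n step e s → T (n <ᵇ 16) → T (step <ᵇ 16) → ∀ x → x < vars s n →
  arrs (run (fill k {k<16} n step e) s) k x ≡ val e s + x * vars s step
fill-value k {k<16} n step e s n<16 step<16 x x<n =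
  proj₁ (for-inv Inv 18 n body s₁ ((λ _ ()) , trans (update-same (vars s) 21) (sym (+-identityʳ _)) ,
      update-other (vars s) (params≢ {21} {step} tt step<16)) round)
    x (subst (x <_) (sym (update-other (vars s) (params≢ {21} {n} tt n<16))) x<n)
  where
  s₁ = setV 21 (val e s) s
  body : Com
  body = put k {k<16} (var 18) (var 21) ⍮ set 21 (var 21 ⊞ var step)
  Inv : ℕ → State → Set
  Inv i t = (∀ x → x < i → arrs t k x ≡ val e s + x * vars s step) ×
    vars t 21 ≡ val e s + i * vars s step × vars t step ≡ vars s step
  round : ∀ i t → i < vars s₁ n → Inv i t → Inv (suc i) (run body (setV 18 i t))
  round i t _ (entries , p , q) =
    (λ x x<1+i → trans (putA-same k i (vars t 21) (setV 18 i t) x) (case i ≟ x of λ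
      { (yes refl) → trans (update-same (arrs t k) i) p
      ; (no i≢x)   → trans (update-other (arrs t k) i≢x) (entries x (≤∧≢⇒< (≤-pred x<1+i) (≢-sym i≢x))) })) ,
    trans (cong₂ _+_ p q′)
      (trans (+-assoc (val e s) (i * vars s step) _) (cong (val e s +_) (+-comm (i * vars s step) _))) ,
    trans (update-other (vars (setV 18 i t)) {21} {step} (params≢ {21} {step} tt step<16)) q′
    where
    q′ : vars (setV 18 i t) step ≡ vars s step
    q′ = trans (update-other (vars t) (params≢ {18} {step} tt step<16)) q

nine : ℕ → ℕ
nine x = x + x + x + x + x + x + x + x + x

≤-*ʳ : ∀ {x y} → 1 ≤ y → x ≤ x * y
≤-*ʳ {x} 1≤y = ≤-trans (≤-reflexive (sym (*-identityʳ x))) (*-monoʳ-≤ x 1≤y)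

≤-*ˡ : ∀ {x y} → 1 ≤ y → x ≤ y * x
≤-*ˡ {x} {y} 1≤y = ≤-trans (≤-*ʳ 1≤y) (≤-reflexive (*-comm x y))

module Init (I : Instance) where
  open Instance I
  open Model I
  open Search I
  open Encoding I

  M A T₀ n : ℕ
  M  = labelCount D
  A  = 3 * N
  T₀ = N ^ N
  n  = nine (|Q_L| * M * |Q_L| * |Q_C| * |Q_C|)

  L≥1 : 1 ≤ |Q_L|
  L≥1 = ≤-trans (s≤s z≤n) (Fin.toℕ<n (q⁰ leader))

  C≥1 : 1 ≤ |Q_C|
  C≥1 = ≤-trans (s≤s z≤n) (Fin.toℕ<n (q⁰ contributor))

  D≥1 : 1 ≤ D
  D≥1 = ≤-trans (s≤s z≤n) (Fin.toℕ<n a⁰)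

  N≥1 : 1 ≤ N
  N≥1 = *-mono-≤ L≥1 D≥1

  A≥1 : 1 ≤ A
  A≥1 = *-mono-≤ {1} {3} (s≤s z≤n) N≥1

  T≥1 : 1 ≤ T₀
  T≥1 = ≤-trans (≤-reflexive (sym (^-zeroˡ N))) (^-monoˡ-≤ N N≥1)

  open CostBound A |Q_C| T₀ A≥1 C≥1 T≥1

  -- The degree of the search: one factor `A` each for the letters of a word and the rounds in a
  -- component, two for pairs of nodes in a closure, `C ^ 2` for pairs of contributor states, and
  -- `T₀` words.
  d : Degree
  d = deg 4 2 1

  Cheap : Com → State → Set
  Cheap c s = cost c s ≤ factor c * ⟦ d ⟧ᵈ

  record Result (c : Com) (s : State) : Set where
    constructor result
    field
      cheap   : Cheap c s
      correct : vars (run c s) 0 ≡ 1 ⇔ LCR I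

  Agrees : (ℕ → ℕ) → State → Set
  Agrees f s = Bounded s × (∀ y → T (y <ᵇ 16) → vars s y ≡ f y)

  agrees-run : ∀ {f} c s → T (safe c) → Agrees f s → Agrees f (run c s)
  agrees-run c s ok (B , h) = Bounded-run c ok B ,
    λ y y<16 → trans (vars-frame c s (safe⇒¬writesV c y ok y<16)) (h y y<16)

  agrees-set : ∀ {f} y {v} s → Agrees f s → (T (y <ᵇ 8) → v ≤ ⟦ degreeV y ⟧ᵈ) → Agrees (f [ y ↦ v ]) (setV y v s)
  agrees-set {f} y {v} s (B , h) bound = B′ , h′
    where
    B′ : Bounded (setV y v s)
    B′ z z<8 with y ≟ z
    ... | yes refl = subst (_≤ ⟦ degreeV y ⟧ᵈ) (sym (update-same (vars s) y)) (bound z<8)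
    ... | no y≢z   = subst (_≤ ⟦ degreeV z ⟧ᵈ) (sym (update-other (vars s) y≢z)) (B z z<8)
    h′ : ∀ z → T (z <ᵇ 16) → (vars s [ y ↦ v ]) z ≡ (f [ y ↦ v ]) z
    h′ z z<16 with y ≡ᵇ z
    ... | true  = refl
    ... | false = h z z<16

  cheap-safe : ∀ c s → T (safe c) → degree c ⊔ᵈ d ≡ d → Bounded s → Cheap c s
  cheap-safe c s ok deg≤ B = ≤-trans (cost-≤ c s ok B)
    (*-monoʳ-≤ (factor c) (subst (λ e → ⟦ degree c ⟧ᵈ ≤ ⟦ e ⟧ᵈ) deg≤ (⊔ᵈ-≤ˡ (degree c) d)))

  -- A Hoare triple in continuation style, where `f` records the values of the constants set so far.
  -- All costs are compared with the single monomial of `d`, so that composition only adds factors.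
  Achieves : (ℕ → ℕ) → (State → Set) → Com → Set
  Achieves f P c = ∀ s → Agrees f s → P s → Result c s

  _then_ : ∀ {c c′ s} → Cheap c s → Result c′ (run c s) → Result (c ⍮ c′) s
  _then_ {c} {c′} cheap (result cheap′ iff) =
    result (≤-trans (+-mono-≤ cheap cheap′) (≤-reflexive (sym (*-distribʳ-+ ⟦ d ⟧ᵈ (factor c) (factor c′))))) iff

  achieve-safe : ∀ {f P Q} c {c′} → T (safe c) → degree c ⊔ᵈ d ≡ d →
    (∀ s → Agrees f s → P s → Q (run c s)) → Achieves f Q c′ → Achieves f P (c ⍮ c′)
  achieve-safe c {c′} ok deg≤ PQ k s ag Ps =
    _then_ {c} {c′} (cheap-safe c s ok deg≤ (proj₁ ag)) (k (run c s) (agrees-run c s ok ag) (PQ s ag Ps))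

  -- Setting a constant is not `safe`, so it is treated here with an explicit bound on the new
  -- value; the static cost bound then applies to the code that follows.
  achieve-set : ∀ {f P} y v e {c′} → (∀ s → Agrees f s → P s → val e s ≡ v) → (T (y <ᵇ 8) → v ≤ ⟦ degreeV y ⟧ᵈ) →
    (∀ s → P s → P (setV y v s)) → Achieves (f [ y ↦ v ]) P c′ → Achieves f P (set y e ⍮ c′)
  achieve-set y v e {c′} e≡v bound keep k s ag Ps =
    _then_ {set y e} {c′} (n≤n*⟦⟧ᵈ (1 + size (compileE e)) d)
      (subst (λ v → Result c′ (setV y v s)) (sym (e≡v s ag Ps)) (k (setV y v s) (agrees-set y s ag bound) (keep s Ps)))

  input : ℕ → ℕ
  input = contents (encode I)

  Memory Copied Zeros : State → Set
  Memory s = ∀ k i → arrs s k i ≡ input (loc k i)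
  Copied s = ∀ p v → At (encode I) p v → arrs s 8 (n + p) ≡ v
  Zeros s  = ∀ i → i < N → arrs s 5 i ≡ 0

  Memory-run : ∀ c s → (∀ k → writesA k c ≡ false) → Memory s → Memory (run c s)
  Memory-run c s ro m k i = trans (arrs-frame c s (ro k) i) (m k i)

  X : ℕ
  X = |Q_L| * M * |Q_L| * |Q_C| * |Q_C|

  M≥1 : 1 ≤ M
  M≥1 = s≤s z≤n

  CC≥1 : 1 ≤ |Q_C| * |Q_C|
  CC≥1 = *-mono-≤ C≥1 C≥1

  LML≥1 : 1 ≤ |Q_L| * M * |Q_L|
  LML≥1 = *-mono-≤ (*-mono-≤ L≥1 M≥1) L≥1

  LML≤X : |Q_L| * M * |Q_L| ≤ X
  LML≤X = ≤-trans (≤-*ʳ CC≥1) (≤-reflexive (sym (*-assoc (|Q_L| * M * |Q_L|) |Q_C| |Q_C|)))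

  -- Origin of the nine: six copies of `X` cover the six numbers at the front, and one each covers
  -- the unsafe states and the two tables.
  length-encode-≤ : length (encode I) ≤ n
  length-encode-≤ = begin
    length (encode I)                            ≡⟨ length-encode ⟩
    6 + |Q_L| + |Q_L| * (M * |Q_L|) + |Q_C| * (M * |Q_C|)
      ≤⟨ +-mono-≤ (+-mono-≤ (+-mono-≤ (*-monoʳ-≤ 6 (≤-trans LML≥1 LML≤X)) L≤X) LML≤X′) CMC≤X ⟩
    6 * X + X + X + X                            ≡⟨ solve 1 (λ x → con 6 :* x :+ x :+ x :+ x := x :+ x :+ x :+ x :+ x :+ x :+ x :+ x :+ x) refl X ⟩
    n                                            ∎
    where
    open ≤-Reasoning
    open +-*-Solver using (solve; con; _:+_; _:*_; _:=_)
    L≤X : |Q_L| ≤ X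
    L≤X = ≤-trans (≤-*ˡ (*-mono-≤ L≥1 M≥1)) LML≤X
    LML≤X′ : |Q_L| * (M * |Q_L|) ≤ X
    LML≤X′ = ≤-trans (≤-reflexive (sym (*-assoc |Q_L| M |Q_L|))) LML≤X
    CMC≤X : |Q_C| * (M * |Q_C|) ≤ X
    CMC≤X = ≤-trans (≤-*ˡ (*-mono-≤ L≥1 L≥1)) (≤-reflexive
      (solve 3 (λ l m c → l :* l :* (c :* (m :* c)) := l :* m :* l :* c :* c) refl |Q_L| M |Q_C|))

  ≤A : ∀ {x} → x ≤ A → x ≤ ⟦ deg 1 0 0 ⟧ᵈ
  ≤A {x} h = ≤-trans h (≤-reflexive (solve 1 (λ a → a := a :* con 1 :* con 1 :* con 1) refl A))
    where open +-*-Solver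

  M≤3D : M ≤ 3 * D
  M≤3D = ≤-trans (+-monoˡ-≤ (D + D) D≥1) (≤-reflexive (cong (λ x → D + (D + x)) (sym (+-identityʳ D))))

  bound-D : D ≤ A
  bound-D = ≤-trans (≤-*ˡ L≥1) (≤-*ˡ {y = 3} (s≤s z≤n))

  bound-L : |Q_L| ≤ A
  bound-L = ≤-trans (≤-*ʳ D≥1) (≤-*ˡ {y = 3} (s≤s z≤n))

  bound-M : M ≤ A
  bound-M = ≤-trans M≤3D (*-monoʳ-≤ 3 (≤-*ˡ L≥1))

  bound-C : |Q_C| ≤ ⟦ deg 0 1 0 ⟧ᵈ
  bound-C = ≤-reflexive (solve 1 (λ c → c := con 1 :* (c :* con 1) :* con 1) refl |Q_C|)
    where open +-*-Solver

  bound-T : T₀ ≤ ⟦ deg 0 0 1 ⟧ᵈ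
  bound-T = ≤-reflexive (solve 1 (λ t → t := con 1 :* con 1 :* (t :* con 1)) refl T₀)
    where open +-*-Solver

  -- The 9 is shared by two of the factors `A = 3 L D`, each bounding `3 L`; the third bounds
  -- `2 D + 1`.
  bound-n : n ≤ ⟦ deg 3 2 0 ⟧ᵈ
  bound-n = begin
    nine (|Q_L| * M * |Q_L| * |Q_C| * |Q_C|)
      ≡⟨ solve 3 (λ l m c → let x = l :* m :* l :* c :* c in
           x :+ x :+ x :+ x :+ x :+ x :+ x :+ x :+ x := (con 9 :* (l :* l)) :* (m :* (c :* c))) refl |Q_L| M |Q_C| ⟩
    9 * (|Q_L| * |Q_L|) * (M * (|Q_C| * |Q_C|))
      ≤⟨ *-mono-≤ {9 * (|Q_L| * |Q_L|)} {A * A} LL≤AA (*-monoˡ-≤ (|Q_C| * |Q_C|) bound-M) ⟩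
    A * A * (A * (|Q_C| * |Q_C|))
      ≡⟨ solve 2 (λ a c → a :* a :* (a :* (c :* c)) := a :* (a :* (a :* con 1)) :* (c :* (c :* con 1)) :* con 1) refl A |Q_C| ⟩
    ⟦ deg 3 2 0 ⟧ᵈ ∎
    where
    open ≤-Reasoning
    open +-*-Solver using (solve; con; _:+_; _:*_; _:=_)
    LL≤AA : 9 * (|Q_L| * |Q_L|) ≤ A * A
    LL≤AA = ≤-trans (≤-reflexive (solve 1 (λ l → con 9 :* (l :* l) := con 3 :* l :* (con 3 :* l)) refl |Q_L|))
      (*-mono-≤ {3 * |Q_L|} {A} (*-monoʳ-≤ 3 (≤-*ʳ {|Q_L|} D≥1)) (*-monoʳ-≤ 3 (≤-*ʳ {|Q_L|} D≥1)))

module Correctness (I : Instance) where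
  open Instance I
  open Model I
  open Search I
  open Encoding I
  open Init I
  open CostBound A |Q_C| T₀ A≥1 C≥1 T≥1

  f₁ f₂ f₃ f₄ f₅ f₆ f₇ f₈ f₉ : ℕ → ℕ
  f₁ = (λ _ → 0) [ 1 ↦ D ] [ 2 ↦ |Q_L| ] [ 3 ↦ |Q_C| ] [ 5 ↦ M ] [ 13 ↦ toℕ (q⁰ contributor) ]
  f₂ = f₁ [ 4 ↦ N ]
  f₃ = f₂ [ 14 ↦ index ν₀ ]
  f₄ = f₃ [ 8 ↦ |Q_L| * M ]
  f₅ = f₄ [ 9 ↦ |Q_C| * M ]
  f₆ = f₅ [ 6 ↦ T₀ ]
  f₇ = f₆ [ 7 ↦ n ]
  f₈ = f₇ [ 10 ↦ n + 6 ] [ 11 ↦ n + 6 + |Q_L| ]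
  f₉ = f₈ [ 12 ↦ n + 6 + |Q_L| + |Q_L| * M * |Q_L| ]

  unbounded : ∀ y {v} → 8 ≤ y → T (y <ᵇ 8) → v ≤ ⟦ degreeV y ⟧ᵈ
  unbounded y 8≤y y<8 = ⊥-elim (<⇒≱ (<ᵇ⇒< y 8 y<8) 8≤y)

  Has : ℕ → ℕ → (State → Set) → State → Set
  Has y v P s = vars s y ≡ v × P s

  multiply : ∀ {f} y s {v} → T (y <ᵇ 16) → Agrees f s → vars s 20 ≡ v → vars (run (multiplyBy y) s) 20 ≡ v * f y
  multiply y s y<16 (_ , h) eq = trans (multiplyBy-value y s y<16) (cong₂ _*_ eq (h y y<16))

  product : ∀ {f} y e {v} s → T (y <ᵇ 16) → Agrees f s → val e s ≡ v →
    vars (run (set 20 e ⍮ multiplyBy y) s) 20 ≡ v * f y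
  product {f} y e s y<16 ag eq =
    multiply {f} y (setV 20 (val e s) s) y<16 (agrees-run {f} (set 20 e) s tt ag) eq

  parameters-correct : ∀ {c} → Achieves f₇ Memory c → Achieves (λ _ → 0) Memory (parameters c)
  parameters-correct k =
    achieve-set {P = Memory} 1 D (raw (lit 0)) (λ s _ m → m 0 0) (λ _ → ≤A bound-D) (λ _ → id)
    (achieve-set {P = Memory} 2 |Q_L| (raw (lit 1)) (λ s _ m → m 1 0) (λ _ → ≤A bound-L) (λ _ → id)
    (achieve-set {P = Memory} 3 |Q_C| (raw (lit 2)) (λ s _ m → m 2 0) (λ _ → bound-C) (λ _ → id)
    (achieve-set {P = Memory} 5 M (lit 1 ⊞ (var 1 ⊞ var 1)) (λ s (_ , h) _ → cong (λ x → suc (x + x)) (h 1 tt)) (λ _ → ≤A bound-M) (λ _ → id)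
    (achieve-set {P = Memory} 13 (toℕ (q⁰ contributor)) (raw (lit 5)) (λ s _ m → m 5 0) (unbounded 13 (m≤m+n 8 5)) (λ _ → id)
    (achieve-safe {f₁} {Memory} {Has 20 N Memory} (set 20 (var 2) ⍮ multiplyBy 1) tt refl
      (λ s ag m → product {f₁} 1 (var 2) s tt ag (proj₂ ag 2 tt) , Memory-run (set 20 (var 2) ⍮ multiplyBy 1) s (λ _ → refl) m)
    (achieve-set {P = Has 20 N Memory} 4 N (var 20) (λ s _ → proj₁) (λ _ → ≤A (≤-*ˡ {y = 3} (s≤s z≤n))) (λ _ → id)
    (achieve-safe {f₂} {Has 20 N Memory} {λ s → Has 20 (toℕ (q⁰ leader) * D) Memory s} (set 20 (raw (lit 4)) ⍮ multiplyBy 1) tt refl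
      (λ s ag (_ , m) → product {f₂} 1 (raw (lit 4)) s tt ag (m 4 0) , Memory-run (set 20 (raw (lit 4)) ⍮ multiplyBy 1) s (λ _ → refl) m)
    (achieve-set {P = Has 20 (toℕ (q⁰ leader) * D) Memory} 14 (index ν₀) (var 20 ⊞ raw (lit 3))
      (λ s _ (p , m) → trans (cong₂ _+_ (trans p (*-comm (toℕ (q⁰ leader)) D)) (m 3 0)) (sym (Fin.toℕ-combine (q⁰ leader) a⁰)))
      (unbounded 14 (m≤m+n 8 6)) (λ _ → id)
    (achieve-safe {f₃} {Has 20 (toℕ (q⁰ leader) * D) Memory} {Has 20 (|Q_L| * M) Memory} (set 20 (var 2) ⍮ multiplyBy 5) tt refl
      (λ s ag (_ , m) → product {f₃} 5 (var 2) s tt ag (proj₂ ag 2 tt) , Memory-run (set 20 (var 2) ⍮ multiplyBy 5) s (λ _ → refl) m)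
    (achieve-set {P = Has 20 (|Q_L| * M) Memory} 8 (|Q_L| * M) (var 20) (λ s _ → proj₁) (unbounded 8 ≤-refl) (λ _ → id)
    (achieve-safe {f₄} {Has 20 (|Q_L| * M) Memory} {Has 20 (|Q_C| * M) Memory} (set 20 (var 3) ⍮ multiplyBy 5) tt refl
      (λ s ag (_ , m) → product {f₄} 5 (var 3) s tt ag (proj₂ ag 3 tt) , Memory-run (set 20 (var 3) ⍮ multiplyBy 5) s (λ _ → refl) m)
    (achieve-set {P = Has 20 (|Q_C| * M) Memory} 9 (|Q_C| * M) (var 20) (λ s _ → proj₁) (unbounded 9 (m≤m+n 8 1)) (λ _ → id)
    (achieve-safe {f₅} {Has 20 (|Q_C| * M) Memory} {Has 20 T₀ Memory} (set 20 (lit 1) ⍮ for 19 4 (multiplyBy 4)) tt refl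
      (λ s ag (_ , m) → power s ag , Memory-run (set 20 (lit 1) ⍮ for 19 4 (multiplyBy 4)) s (λ _ → refl) m)
    (achieve-set {P = Has 20 T₀ Memory} 6 T₀ (var 20) (λ s _ → proj₁) (λ _ → bound-T) (λ _ → id)
    (achieve-safe {f₆} {Has 20 T₀ Memory} {Has 20 X Memory} (set 20 (var 8) ⍮ multiplyBy 2 ⍮ multiplyBy 3 ⍮ multiplyBy 3) tt refl
      (λ s ag (_ , m) → four s ag , Memory-run (set 20 (var 8) ⍮ multiplyBy 2 ⍮ multiplyBy 3 ⍮ multiplyBy 3) s (λ _ → refl) m)
    (achieve-set {P = Has 20 X Memory} 7 n (var 20 ⊞ var 20 ⊞ var 20 ⊞ var 20 ⊞ var 20 ⊞ var 20 ⊞ var 20 ⊞ var 20 ⊞ var 20)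
      (λ s _ (p , _) → cong nine p) (λ _ → bound-n) (λ _ → id)
    λ s ag (_ , m) → k s ag m))))))))))))))))
    where
    power : ∀ s → Agrees f₅ s → vars (run (set 20 (lit 1) ⍮ for 19 4 (multiplyBy 4)) s) 20 ≡ T₀
    power s ag = subst (λ i → vars (run (for 19 4 (multiplyBy 4)) (setV 20 1 s)) 20 ≡ N ^ i) (proj₂ ag 4 tt)
      (proj₂ (for-inv (λ i t → Agrees f₅ t × vars t 20 ≡ N ^ i) 19 4 (multiplyBy 4) (setV 20 1 s)
        (agrees-run {f₅} (set 20 (lit 1)) s tt ag , refl)
        λ i t _ (ag′ , p) → agrees-run {f₅} (set 19 (lit i) ⍮ multiplyBy 4) t tt ag′ ,
          trans (multiply {f₅} 4 (setV 19 i t) tt (agrees-run {f₅} (set 19 (lit i)) t tt ag′) p) (*-comm (N ^ i) N)))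
    four : ∀ s → Agrees f₆ s → vars (run (set 20 (var 8) ⍮ multiplyBy 2 ⍮ multiplyBy 3 ⍮ multiplyBy 3) s) 20 ≡ X
    four s ag = multiply {f₆} 3 s₃ tt ag₃ (multiply {f₆} 3 s₂ tt ag₂ (product {f₆} 2 (var 8) s tt ag (proj₂ ag 8 tt)))
      where
      s₂ = run (set 20 (var 8) ⍮ multiplyBy 2) s
      s₃ = run (multiplyBy 3) s₂
      ag₂ : Agrees f₆ s₂
      ag₂ = agrees-run {f₆} (set 20 (var 8) ⍮ multiplyBy 2) s tt ag
      ag₃ : Agrees f₆ s₃
      ag₃ = agrees-run {f₆} (multiplyBy 3) s₂ tt ag₂

  copy tableOfNodes : Com
  copy = for 18 7 (put 8 (var 7 ⊞ var 18) (raw (var 18)))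
  tableOfNodes = set 21 (lit 0) ⍮
    for 18 2 (for 19 1 (put 9 (var 21) (var 18) ⍮ put 10 (var 21) (var 19) ⍮ set 21 (var 21 ⊞ lit 1)))

  -- Address `i` has array index `i / 16`, which is below `n`, whereas the copy occupies indices
  -- from `n` on. Input still to be read is therefore never overwritten.
  copy-correct : ∀ s → Agrees f₇ s → Memory s → Copied (run copy s)
  copy-correct s (_ , h) m p v at = trans (proj₁ (proj₂ (subst (λ k → Inv k (run copy s)) n≡
      (for-inv Inv 18 7 (put 8 (var 7 ⊞ var 18) (raw (var 18))) s (n≡ , (λ _ ()) , λ k i _ → m k i) step))) p
        (<-≤-trans (At-< at) length-encode-≤))
    (At⇒contents at)
    where
    n≡ : vars s 7 ≡ n
    n≡ = h 7 tt
    Inv : ℕ → State → Set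
    Inv i t = vars t 7 ≡ n × (∀ x → x < i → arrs t 8 (n + x) ≡ input x) × (∀ k j → j < n → arrs t k j ≡ input (loc k j))
    step : ∀ i t → i < vars s 7 → Inv i t → Inv (suc i) (run (put 8 (var 7 ⊞ var 18) (raw (var 18))) (setV 18 i t))
    step i t i<n (e , new , old) rewrite e = refl , new′ , old′
      where
      t′ = setV 18 i t
      raw-i : arrs t (i % 16) (i / 16) ≡ input i
      raw-i = trans (old (i % 16) (i / 16) (≤-<-trans (m/n≤m i 16) (subst (i <_) n≡ i<n)))
        (cong input (trans (+-comm (i / 16 * 16) (i % 16)) (sym (m≡m%n+[m/n]*n i 16))))
      new′ : ∀ x → x < suc i → arrs (putA 8 (n + i) (arrs t (i % 16) (i / 16)) t′) 8 (n + x) ≡ input x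
      new′ x x<1+i with i ≟ x
      ... | yes refl = trans (update-same (arrs t 8) (n + i)) raw-i
      ... | no i≢x   = trans (update-other (arrs t 8) (i≢x ∘ +-cancelˡ-≡ n i x))
        (new x (≤∧≢⇒< (≤-pred x<1+i) (≢-sym i≢x)))
      old′ : ∀ k j → j < n → arrs (putA 8 (n + i) (arrs t (i % 16) (i / 16)) t′) k j ≡ input (loc k j)
      old′ k j j<n with 8 ≟ k
      ... | yes refl = trans (update-other (arrs t 8) (λ eq → <⇒≱ j<n (subst (n ≤_) eq (m≤m+n n i)))) (old 8 j j<n)
      ... | no 8≢k = trans (putA-other 8 (n + i) _ t′ {k} j 8≢k) (old k j j<n)

  offsets-correct : ∀ {c} → Achieves f₉ Copied c → Achieves f₇ Memory (offsets c)
  offsets-correct k =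
    achieve-safe {f₇} {Memory} {Copied} copy tt refl copy-correct
    (achieve-safe {f₇} {Copied} {Has 20 (|Q_L| * M * |Q_L|) Copied} (set 20 (var 8) ⍮ multiplyBy 2) tt refl
      (λ s ag c → product {f₇} 2 (var 8) s tt ag (proj₂ ag 8 tt) ,
        λ p v at → trans (arrs-frame (set 20 (var 8) ⍮ multiplyBy 2) {8} s refl (n + p)) (c p v at))
    (achieve-set {P = P} 10 (n + 6) (var 7 ⊞ lit 6) (λ s (_ , h) _ → cong (_+ 6) (h 7 tt)) (unbounded 10 (m≤m+n 8 2)) (λ _ → id)
    (achieve-set {P = P} 11 (n + 6 + |Q_L|) (var 10 ⊞ var 2) (λ s (_ , h) _ → cong₂ _+_ (h 10 tt) (h 2 tt)) (unbounded 11 (m≤m+n 8 3)) (λ _ → id)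
    (achieve-set {P = P} 12 (n + 6 + |Q_L| + |Q_L| * M * |Q_L|) (var 11 ⊞ var 20)
      (λ s (_ , h) (p , _) → cong₂ _+_ (h 11 tt) p) (unbounded 12 (m≤m+n 8 4)) (λ _ → id)
    λ s ag (_ , c) → k s ag c))))
    where
    P : State → Set
    P = Has 20 (|Q_L| * M * |Q_L|) Copied

  Multiples : ℕ → (k start step : ℕ) → State → Set
  Multiples m k start step s = ∀ x → x < m → arrs s k x ≡ start + x * step

  P₁ P₂ P₃ P₄ : State → Set
  P₁ s = Copied s × Multiples |Q_L| 11 (n + 6 + |Q_L|) (|Q_L| * M) s
  P₂ s = P₁ s × Multiples M 12 0 |Q_L| s
  P₃ s = P₂ s × Multiples |Q_C| 13 (n + 6 + |Q_L| + |Q_L| * M * |Q_L|) (|Q_C| * M) s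
  P₄ s = P₃ s × Multiples M 14 0 |Q_C| s

  copied-frame : ∀ c s → writesA 8 c ≡ false → Copied s → Copied (run c s)
  copied-frame c s ro h p v at = trans (arrs-frame c s ro (n + p)) (h p v at)

  multiples-frame : ∀ {m k a b} c s → writesA k c ≡ false → Multiples m k a b s → Multiples m k a b (run c s)
  multiples-frame c s ro h x x<m = trans (arrs-frame c s ro x) (h x x<m)

  fill-multiples : ∀ {m k a b} {k<16 : T (k <ᵇ 16)} y z e s → T (y <ᵇ 16) → T (z <ᵇ 16) →
    vars s y ≡ m → val e s ≡ a → vars s z ≡ b → Multiples m k a b (run (fill k {k<16} y z e) s)
  fill-multiples {k = k} {k<16 = k<16} y z e s y<16 z<16 refl refl refl x x<m = fill-value k {k<16} y z e s y<16 z<16 x x<m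

  multiples-correct : ∀ {c} → Achieves f₉ P₄ c → Achieves f₉ Copied (multiples c)
  multiples-correct k =
    achieve-safe {f₉} {Copied} {P₁} F₁ tt refl
      (λ s (_ , h) c → copied-frame F₁ s refl c , fill-multiples {k = 11} 2 8 (var 11) s tt tt (h 2 tt) (h 11 tt) (h 8 tt))
    (achieve-safe {f₉} {P₁} {P₂} F₂ tt refl
      (λ s (_ , h) (c , m₁) → (copied-frame F₂ s refl c , multiples-frame {k = 11} F₂ s refl m₁) ,
        fill-multiples {k = 12} 5 2 (lit 0) s tt tt (h 5 tt) refl (h 2 tt))
    (achieve-safe {f₉} {P₂} {P₃} F₃ tt refl
      (λ s (_ , h) ((c , m₁) , m₂) → ((copied-frame F₃ s refl c , multiples-frame {k = 11} F₃ s refl m₁) , multiples-frame {k = 12} F₃ s refl m₂) ,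
        fill-multiples {k = 13} 3 9 (var 12) s tt tt (h 3 tt) (h 12 tt) (h 9 tt))
    (achieve-safe {f₉} {P₃} {P₄} F₄ tt refl
      (λ s (_ , h) (((c , m₁) , m₂) , m₃) →
        (((copied-frame F₄ s refl c , multiples-frame {k = 11} F₄ s refl m₁) , multiples-frame {k = 12} F₄ s refl m₂) ,
          multiples-frame {k = 13} F₄ s refl m₃) ,
        fill-multiples {k = 14} 5 3 (lit 0) s tt tt (h 5 tt) refl (h 3 tt))
      k)))
    where
    F₁ F₂ F₃ F₄ : Com
    F₁ = fill 11 2 8 (var 11)
    F₂ = fill 12 5 2 (lit 0)
    F₃ = fill 13 3 9 (var 12)
    F₄ = fill 14 5 3 (lit 0)

  Nodes : ℕ → State → Set
  Nodes i s = ∀ q a → index (q , a) < i → arrs s 9 (index (q , a)) ≡ toℕ q × arrs s 10 (index (q , a)) ≡ toℕ a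

  P₅ P₆ : State → Set
  P₅ s = P₄ s × Nodes N s
  P₆ s = (P₅ s × Zeros s) × vars s 16 ≡ 0

  -- The counter in variable 21 meets the pairs row by row, in the order of `combine`, so that
  -- neither division nor multiplication is needed.
  nodes-table : ∀ s → Agrees f₉ s → Nodes N (run tableOfNodes s)
  nodes-table s (_ , h) = subst (λ i → Nodes i (run tableOfNodes s)) (cong (_* D) (h 2 tt)) (proj₂ (proj₂
    (for-inv (λ i t → Inv (i * D) t) 18 2 inner (setV 21 0 s) (h 1 tt , refl , λ _ _ ()) outer-step)))
    where
    body inner : Com
    body  = put 9 (var 21) (var 18) ⍮ put 10 (var 21) (var 19) ⍮ set 21 (var 21 ⊞ lit 1)
    inner = for 19 1 body
    Inv : ℕ → State → Set
    Inv i t = vars t 1 ≡ D × vars t 21 ≡ i × Nodes i t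
    Inv′ : ℕ → ℕ → State → Set
    Inv′ i j t = Inv (i * D + j) t × vars t 18 ≡ i
    body-step : ∀ i j t → i < |Q_L| → j < D → Inv′ i j t → Inv′ i (suc j) (run body (setV 19 j t))
    body-step i j t i<L j<D ((d≡ , p≡ , nodes) , i≡) =
      (d≡ , trans (+-comm (vars t 21) 1) (trans (cong suc p≡) (sym (+-suc (i * D) j))) , nodes′) , i≡
      where
      q = proj₁ (as-fin i<L)
      a = proj₁ (as-fin j<D)
      q≡ : toℕ q ≡ i
      q≡ = proj₂ (as-fin i<L)
      a≡ : toℕ a ≡ j
      a≡ = proj₂ (as-fin j<D)
      here-is : index (q , a) ≡ vars t 21
      here-is = trans (Fin.toℕ-combine q a)
        (trans (cong₂ _+_ (trans (*-comm D (toℕ q)) (cong (_* D) q≡)) a≡) (sym p≡))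
      nodes′ : Nodes (i * D + suc j) (run body (setV 19 j t))
      nodes′ q′ a′ i′< with vars t 21 ≟ index (q′ , a′)
      ... | no ≢ = trans (update-other (arrs t 9) ≢) (proj₁ old) , trans (update-other (arrs t 10) ≢) (proj₂ old)
        where
        old = nodes q′ a′ (≤∧≢⇒< (≤-pred (≤-trans i′< (≤-reflexive (+-suc (i * D) j)))) (λ eq → ≢ (trans p≡ (sym eq))))
      ... | yes eq with index-injective {q , a} {q′ , a′} (trans here-is eq)
      ...   | refl = trans (cong (arrs t 9 [ vars t 21 ↦ vars t 18 ]) (sym eq))
                       (trans (update-same (arrs t 9) (vars t 21)) (trans i≡ (sym q≡))) ,
        trans (cong (arrs t 10 [ vars t 21 ↦ j ]) (sym eq)) (trans (update-same (arrs t 10) (vars t 21)) (sym a≡))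
    outer-step : ∀ i t → i < vars s 2 → Inv (i * D) t → Inv (suc i * D) (run inner (setV 18 i t))
    outer-step i t i<L (d≡ , p≡ , nodes) = subst (λ j → Inv j (run inner (setV 18 i t))) (trans (cong (i * D +_) d≡) (+-comm (i * D) D))
      (proj₁ (for-inv (Inv′ i) 19 1 body (setV 18 i t)
        (subst (λ j → Inv j (setV 18 i t)) (sym (+-identityʳ (i * D))) (d≡ , p≡ , nodes) , refl)
        λ j u j<D → body-step i j u (subst (i <_) (h 2 tt) i<L) (subst (j <_) d≡ j<D)))

  P₄-frame : ∀ c s → (∀ j → T (10 <ᵇ j) → writesA j c ≡ false) → writesA 8 c ≡ false → P₄ s → P₄ (run c s)
  P₄-frame c s ro ro₈ ((((h , m₁) , m₂) , m₃) , m₄) =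
    (((copied-frame c s ro₈ h , multiples-frame {k = 11} c s (ro 11 tt) m₁) , multiples-frame {k = 12} c s (ro 12 tt) m₂) ,
      multiples-frame {k = 13} c s (ro 13 tt) m₃) , multiples-frame {k = 14} c s (ro 14 tt) m₄

  nodes-correct : ∀ {c} → Achieves f₉ P₅ c → Achieves f₉ P₄ (nodes c)
  nodes-correct = achieve-safe {f₉} {P₄} {P₅} tableOfNodes tt refl
    λ s ag h → P₄-frame tableOfNodes s above refl h , nodes-table s ag
    where
    above : ∀ j → T (10 <ᵇ j) → writesA j tableOfNodes ≡ false
    above j 10<j rewrite ≢⇒≡ᵇ {9} {j} (λ { refl → 10<j }) | ≢⇒≡ᵇ {10} {j} (λ { refl → 10<j }) = refl

  words-correct : ∀ {c} → Achieves f₉ P₆ c → Achieves f₉ P₅ (words c)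
  words-correct k =
    achieve-safe {f₉} {P₅} {λ s → P₅ s × Zeros s} (clear 5 4) tt refl
      (λ s (_ , h) (p , nodes) → (P₄-frame (clear 5 4) s (λ j 10<j → ≢⇒≡ᵇ {5} {j} λ { refl → 10<j }) refl p ,
          λ q a < → let (e , e′) = nodes q a < in
            trans (arrs-frame (clear 5 4) {9} s refl _) e , trans (arrs-frame (clear 5 4) {10} s refl _) e′) ,
        λ i i<N → cleared 5 4 s i (subst (i <_) (sym (h 4 tt)) i<N))
    (achieve-safe {f₉} {λ s → P₅ s × Zeros s} {P₆} (set 16 (lit 0)) tt refl (λ s _ h → h , refl) k)

  labelIndex-< : ∀ (l : Label D) → labelIndex l < M
  labelIndex-< l = subst (labelIndex l <_) (length-labels D) (At-< (At-labels l))

  context : ∀ s → Agrees f₉ s → P₅ s → Context s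
  context s (_ , h) (((((copied , m₁) , m₂) , m₃) , m₄) , nodes) = record
    { has-D  = h 1 tt
    ; has-L  = h 2 tt
    ; has-C  = h 3 tt
    ; has-N  = h 4 tt
    ; has-M  = h 5 tt
    ; has-q⁰ = h 13 tt
    ; has-ν₀ = h 14 tt
    ; node-q = λ q a → proj₁ (nodes q a (index-< (q , a)))
    ; node-a = λ q a → proj₂ (nodes q a (index-< (q , a)))
    ; has-unsafe = λ q → trans (cong (λ o → arrs s 8 (o + toℕ q)) (h 10 tt))
        (trans (cong (arrs s 8) (+-assoc n 6 (toℕ q))) (copied _ _ (At-unsafe q)))
    ; has-leader = λ q l q′ → trans (cong₂ (λ r o → arrs s 8 (r + (o + toℕ q′)))
          (m₁ (toℕ q) (Fin.toℕ<n q)) (m₂ (labelIndex l) (labelIndex-< l)))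
        (trans (cong (arrs s 8) (leader-address (toℕ q) (labelIndex l) (toℕ q′))) (copied _ _ (At-leader q l q′)))
    ; has-contributor = λ σ l σ′ → trans (cong₂ (λ r o → arrs s 8 (r + (o + toℕ σ′)))
          (m₃ (toℕ σ) (Fin.toℕ<n σ)) (m₄ (labelIndex l) (labelIndex-< l)))
        (trans (cong (arrs s 8) (contributor-address (toℕ σ) (labelIndex l) (toℕ σ′))) (copied _ _ (At-contributor σ l σ′)))
    }
    where
    open +-*-Solver using (solve; con; _:+_; _:*_; _:=_)
    leader-address : ∀ q l q′ →
      n + 6 + |Q_L| + q * (|Q_L| * M) + (0 + l * |Q_L| + q′) ≡ n + (leaderAt + (q * (M * |Q_L|) + (l * |Q_L| + q′)))
    leader-address = go n |Q_L| M
      where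
      go : ∀ n L M q l q′ → n + 6 + L + q * (L * M) + (0 + l * L + q′) ≡ n + (6 + L + (q * (M * L) + (l * L + q′)))
      go = solve 6 (λ n L M q l q′ → n :+ con 6 :+ L :+ q :* (L :* M) :+ (con 0 :+ l :* L :+ q′) :=
        n :+ (con 6 :+ L :+ (q :* (M :* L) :+ (l :* L :+ q′)))) refl
    contributor-address : ∀ q l q′ →
      n + 6 + |Q_L| + |Q_L| * M * |Q_L| + q * (|Q_C| * M) + (0 + l * |Q_C| + q′) ≡
      n + (contributorAt + (q * (M * |Q_C|) + (l * |Q_C| + q′)))
    contributor-address = go n |Q_L| |Q_C| M
      where
      go : ∀ n L C M q l q′ → n + 6 + L + L * M * L + q * (C * M) + (0 + l * C + q′) ≡
        n + (6 + L + L * (M * L) + (q * (M * C) + (l * C + q′)))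
      go = solve 7 (λ n L C M q l q′ → n :+ con 6 :+ L :+ L :* M :* L :+ q :* (C :* M) :+ (con 0 :+ l :* C :+ q′) :=
        n :+ (con 6 :+ L :+ L :* (M :* L) :+ (q :* (M :* C) :+ (l :* C :+ q′)))) refl

  search-achieves : Achieves f₉ P₆ (search ⍮ set 0 (var 16))
  search-achieves s ag ((p₅ , zeros) , flag≡0) =
    _then_ {search} {set 0 (var 16)} (cheap-safe search s tt refl (proj₁ ag))
      (result (n≤n*⟦⟧ᵈ _ d) (Enumerate.Main.search-correct I s (context s ag p₅) (proj₂ ag 6 tt) flag≡0 zeros))

  initial-state : State
  initial-state = ⟦ (λ _ → 0) , (λ k i → input (loc k i)) ⟧

  program-correct : Result program initial-state
  program-correct = parameters-correct (offsets-correct (multiples-correct (nodes-correct (words-correct search-achieves))))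
    initial-state ((λ _ _ → z≤n) , λ _ _ → refl) λ _ _ → refl

-- The time bound, and assembly of the solution.

D*D≤D^D : ∀ D → 1 ≤ D → D * D ≤ D ^ D
D*D≤D^D 1             _ = ≤-refl
D*D≤D^D (suc (suc D)) _ = *-monoʳ-≤ (2 + D) (≤-*ʳ {2 + D} {(2 + D) ^ D} (m^n>0 (2 + D) D))

-- Of the `D ^ 4` on the left, `Valid` covers two factors and `D ^ D` the other two; `L ^ 4` splits
-- into the `L` of `Wit` and the `L ^ 3` of `Valid`, and 81 is `3 ^ 4`.
budget : ∀ L D C → 1 ≤ D → (3 * (L * D)) ^ 4 * C ^ 2 * ((L * D) ^ (L * D)) ^ 1 ≤ 81 * (Wit L D * Valid L D C)
budget L D C D≥1 = begin
  (3 * (L * D)) ^ 4 * C ^ 2 * power ^ 1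
    ≡⟨ solve 4 (λ l d c t → let a = con 3 :* (l :* d) in
         a :* (a :* (a :* (a :* con 1))) :* (c :* (c :* con 1)) :* (t :* con 1) :=
         con 81 :* (t :* (d :* d) :* l :* (l :* (l :* (l :* con 1)) :* (d :* (d :* con 1)) :* (c :* (c :* con 1)))))
       refl L D C power ⟩
  81 * (power * (D * D) * L * Valid L D C)
    ≤⟨ *-monoʳ-≤ 81 (*-monoˡ-≤ (Valid L D C) (*-monoˡ-≤ L (*-mono-≤
         (^-monoˡ-≤ (L * D) (*-monoʳ-≤ L (m≤m+n D 1))) (D*D≤D^D D D≥1)))) ⟩
  81 * (Wit L D * Valid L D C) ∎
  where
  open ≤-Reasoning
  open +-*-Solver using (solve; con; _:+_; _:*_; _:=_)
  power = (L * D) ^ (L * D)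

module Solution (I : Instance) where
  open Instance I
  open Init I
  open Correctness I

  initial-related : initial (encode I) ~ initial-state
  initial-related = record { regs = λ _ → refl ; mems = λ _ _ _ → refl }

  Solution : Cmd → ℕ → Set
  Solution c k = ∃[ s ] ∃[ n ] (c ⊢ initial (encode I) ⇓ s cost n) ×
    n ≤ k * (Wit |Q_L| D * Valid |Q_L| D |Q_C|) × (output s ≡ 1 ⇔ LCR I)

  solution : ∀ c k s → factor c * 81 ≡ k → Simulates 0 c (initial (encode I)) s → Result c s → Solution (compile 0 c) k
  solution c k s k≡ (simulates σ m E m≤ R _) (result cheap correct) = σ , m , E ,
    ≤-trans m≤ (≤-trans cheap (≤-trans (*-monoʳ-≤ (factor c) (budget |Q_L| D |Q_C| D≥1))
      (≤-reflexive (trans (sym (*-assoc (factor c) 81 W)) (cong (_* W) k≡))))) ,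
    subst (λ x → x ≡ 1 ⇔ LCR I) (sym (regs R 0)) correct
    where W = Wit |Q_L| D * Valid |Q_L| D |Q_C|

  program-solution : ∀ k → factor program * 81 ≡ k → Solution (compile 0 program) k
  program-solution k k≡ = solution program k initial-state k≡
    (simulate program 0 (initial (encode I)) initial-state initial-related) program-correct

-- Abstract, because evaluating this numeral is infeasible.
abstract
  constant : ℕ
  constant = factor program * 81

  constant-value : factor program * 81 ≡ constant
  constant-value = refl

open Instance using (D; |Q_L|; |Q_C|)

theorem1 : LCR SolvableInTimeO (λ I → Wit (|Q_L| I) (D I) * Valid (|Q_L| I) (D I) (|Q_C| I))
theorem1 = compile 0 program , constant , λ I → Solution.program-solution I constant constant-value
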